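{- Let $T$ be a tree in which every vertex has degree at most $3$, and let $\mathcal{R}$ be a finite multiset of rooted subtrees of $T$. Then the algorithm GREEDY-COL (described in the context), run on $(T,\mathcal{R})$, outputs a valid coloring $\psi^{\mathrm{GDY}}$ of $\mathcal{R}$ whose number of colors satisfies $$|\psi^{\mathrm{GDY}}(\mathcal{R})|\le \tfrac{5}{2}\,\min_{\psi\in\Psi_{\mathcal{R}}}|\psi(\mathcal{R})|,$$ where $\Psi_{\mathcal{R}}$ is the set of all valid colorings of $\mathcal{R}$. This holds for every way of resolving the arbitrary choices in the algorithm (BFS root and order, choice of maximum matchings, order in which subtrees are picked).
   Context: A directed graph $\vec{R}$ is a rooted tree if its underlying undirected (multi)graph is a tree, there is a unique vertex of in-degree $0$, and every other vertex has in-degree $1$. $\vec{R}$ is a rooted subtree of a tree $T$ if it is a rooted tree whose underlying undirected graph is a subtree of $T$. Two rooted subtrees collide if they share a directed edge $(a,b)$. A valid coloring of a multiset $\mathcal{R}$ of rooted subtrees is a map $\psi:\mathcal{R}\to\mathbb{N}=\{1,2,\dots\}$ with $\psi(\vec{R})\ne\psi(\vec{S})$ whenever $\vec{R},\vec{S}$ collide; $\psi(\mathcal{S})$ denotes the image of a subset $\mathcal{S}$. For an edge $\{a,b\}$ of $T$ and a multiset $\mathcal{S}$, $\mathcal{S}[\{a,b\}]$ is the sub-multiset of members containing $(a,b)$ or $(b,a)$. "First-fit coloring" of a subtree means assigning it the smallest positive integer not used by any already-colored subtree colliding with it. GREEDY-COL: Run BFS on $T$ from an arbitrary root and list the edges $e_1,\dots,e_m$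 in order of discovery. Set $\mathcal{P}_0=\emptyset$. For $i=1,\dots,m$: let $e_i=\{u,v\}$ with $u$ discovered before $v$, and $\mathcal{Q}_i=\mathcal{R}[e_i]\setminus\mathcal{P}_{i-1}$. Call $e_i$ of type 4 if $u$ has degree $3$ with other incident edges $\{u,w\},\{u,x\}$ where $\{u,w\}=e_j$ with $j<i$ and $\{u,x\}=e_k$ with $k>i$. If $e_i$ is not of type 4, first-fit color the members of $\mathcal{Q}_i$ one at a time in arbitrary order. If $e_i$ is of type 4, compute two extensions $\psi_1,\psi_2$ of the current coloring of $\mathcal{P}_{i-1}$ to $\mathcal{P}_{i-1}\cup\mathcal{Q}_i$ by PROCESS-EDGE-1 and PROCESS-EDGE-2 below, and adopt $\psi_1$ on $\mathcal{Q}_i$ if $|\psi_1(\mathcal{P}_{i-1}\cup\mathcal{Q}_i)|\le|\psi_2(\mathcal{P}_{i-1}\cup\mathcal{Q}_i)|$, otherwise $\psi_2$. Then set $\mathcal{P}_i=\mathcal{P}_{i-1}\cup\mathcal{Q}_i$. PROCESS-EDGE-1 (with $\mathcal{P}=\mathcal{P}_{i-1}$ colored by $\psi$, $\mathcal{Q}=\mathcal{Q}_i$): form graph $B_1$ on vertex set $\mathcal{P}[\{u,v\}]\cup\mathcal{Q}$ containing all edges between colliding pairs, and additionally an edge between a non-colliding pair $\vec{R},\vec{S}$ if either both lie in $\mathcal{P}$ and $\psi(\vec{R})\ne\psi(\vec{S})$, or $\vec{R}\in\mathcal{Q}$, $\vec{S}\in\mathcal{P}$ and some $\vec{U}\in\mathcal{P}$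 with $\psi(\vec{U})=\psi(\vec{S})$ collides with $\vec{R}$. Take a maximum matching $M$ in the complement $\bar B_1$ (which is bipartite). For each matched pair $\{\vec{R},\vec{S}\}$ with $\vec{R}\in\mathcal{Q},\vec{S}\in\mathcal{P}$ set $\psi(\vec{R})=\psi(\vec{S})$. Then while some $\vec{R}\in\mathcal{Q}$ is uncolored: if $\vec{R}$ is matched in $M$ to $\vec{S}$, give both $\vec{R},\vec{S}$ the smallest positive integer not used by any colored subtree colliding with $\vec{R}$ or $\vec{S}$; otherwise first-fit color $\vec{R}$. PROCESS-EDGE-2: same construction with vertex set $(\mathcal{P}[\{u,x\}]\setminus\mathcal{P}[\{u,v\}])\cup\mathcal{Q}[\{u,x\}]$ (graph $B_2$, maximum matching in $\bar B_2$); after assigning matched partners' colors, process uncolored $\vec{R}\in\mathcal{Q}[\{u,x\}]$ as in PROCESS-EDGE-1 (pairs colored jointly, unmatched ones first-fit), and finally first-fit color all remaining uncolored members of $\mathcal{Q}$ one at a time. -}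

module Defs where

open import Data.Nat using (ℕ; zero; suc; _≤_; _<_; _≤ᵇ_; _*_)
open import Data.Nat.Properties using () renaming (_≟_ to _≟ℕ_)
open import Data.Fin using (Fin) renaming (_≟_ to _≟F_)
open import Data.Bool using (Bool; true; false; _∧_; _∨_; not; if_then_else_)
open import Data.Maybe using (Maybe; just; nothing; is-just; is-nothing)
open import Data.List using (List; []; _∷_; _++_; [_]; map; length; filterᵇ; mapMaybe; deduplicate; allFin)
open import Data.List.Membership.Propositional using (_∈_)
open import Data.List.Relation.Unary.Any using (Any)
open import Data.List.Relation.Unary.All using (All)
open import Data.List.Relation.Unary.Unique.Propositional using (Unique)
open import Data.List.Relation.Binary.Permutation.Propositional using (_↭_)
open import Data.Product using (Σ; ∃; _×_; _,_)
open import Data.Sum using (_⊎_)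
open import Relation.Nullary using (¬_)
open import Relation.Nullary.Decidable using (isYes)
open import Relation.Binary.PropositionalEquality using (_≡_; _≢_)

Graph : ℕ → Set
Graph n = Fin n → Fin n → Bool

data Walk {n} (V : Fin n → Bool) (adj : Graph n) : Fin n → Fin n → Set where
  here : ∀ {v} → V v ≡ true → Walk V adj v v
  step : ∀ {u w v} → V u ≡ true → adj u w ≡ true → Walk V adj w v → Walk V adj u v

data Chain {n} (adj : Graph n) : List (Fin n) → Set where
  nil  : Chain adj []
  one  : ∀ {a} → Chain adj (a ∷ [])
  cons : ∀ {a b xs} → adj a b ≡ true → Chain adj (b ∷ xs) → Chain adj (a ∷ b ∷ xs)

Cycle : ∀ {n} → (Fin n → Bool) → Graph n → Set
Cycle {n} V adj =
  Σ (Fin n) λ v0 → Σ (List (Fin n)) λ vs →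
    2 ≤ length vs × Unique (v0 ∷ vs) × All (λ v → V v ≡ true) (v0 ∷ vs)
    × Chain adj (v0 ∷ vs ++ [ v0 ])

IsTreeOn : ∀ {n} → (Fin n → Bool) → Graph n → Set
IsTreeOn {n} V adj =
  (∀ a b → adj a b ≡ true → V a ≡ true × V b ≡ true)
  × (Σ (Fin n) λ v → V v ≡ true)
  × (∀ u v → V u ≡ true → V v ≡ true → Walk V adj u v)
  × ¬ Cycle V adj

IsTree : ∀ {n} → Graph n → Set
IsTree {n} adj =
  (∀ a b → adj a b ≡ adj b a) × (∀ a → adj a a ≡ false) × IsTreeOn (λ _ → true) adj

deg : ∀ {n} → Graph n → Fin n → ℕ
deg {n} adj v = length (filterᵇ (adj v) (allFin n))

MaxDeg≤3 : ∀ {n} → Graph n → Set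
MaxDeg≤3 {n} adj = ∀ (v : Fin n) → deg adj v ≤ 3

record DiGraph (n : ℕ) : Set where
  field
    V : Fin n → Bool
    A : Fin n → Fin n → Bool
open DiGraph public

indeg : ∀ {n} → DiGraph n → Fin n → ℕ
indeg {n} R v = length (filterᵇ (λ a → A R a v) (allFin n))

und : ∀ {n} → DiGraph n → Graph n
und R a b = A R a b ∨ A R b a

IsRootedSubtree : ∀ {n} → Graph n → DiGraph n → Set
IsRootedSubtree {n} T R =
  (∀ a b → A R a b ≡ true → V R a ≡ true × V R b ≡ true × T a b ≡ true)
  -- the underlying multigraph has no parallel edges (else it is not a tree)
  × (∀ a b → A R a b ≡ true → A R b a ≡ false)
  × IsTreeOn (V R) (und R)
  × (Σ (Fin n) λ r → V R r ≡ true × indeg R r ≡ 0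
       × (∀ v → V R v ≡ true → v ≢ r → indeg R v ≡ 1))

-- Colorings.  A multiset of rooted subtrees is an indexed family
-- ℛ : Fin k → DiGraph n (index = multiset member).

Collide : ∀ {n k} → (Fin k → DiGraph n) → Fin k → Fin k → Set
Collide {n} ℛ X Y = Σ (Fin n) λ a → Σ (Fin n) λ b →
  A (ℛ X) a b ≡ true × A (ℛ Y) a b ≡ true

Valid : ∀ {n k} → (Fin k → DiGraph n) → (Fin k → ℕ) → Set
Valid ℛ ψ = (∀ X → 1 ≤ ψ X) × (∀ X Y → X ≢ Y → Collide ℛ X Y → ψ X ≢ ψ Y)

distinct : List ℕ → ℕ
distinct xs = length (deduplicate _≟ℕ_ xs)

numColors : ∀ {k} → (Fin k → ℕ) → ℕ
numColors {k} ψ = distinct (map ψ (allFin k))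

-- GREEDY-COL, as a relation describing all possible runs
-- (all arbitrary choices are existentially chosen in a run).

-- BFS: queue, discovered set, list of discovered edges (u , v) with u
-- discovered before v.  Undiscovered neighbours of the dequeued vertex are
-- enqueued in an arbitrary order.
data BFSRun {n} (T : Graph n) : List (Fin n) → (Fin n → Bool) → List (Fin n × Fin n) → Set where
  done : ∀ {D} → BFSRun T [] D []
  step : ∀ {v q D ns es} →
         ns ↭ filterᵇ (λ w → T v w ∧ not (D w)) (allFin n) →
         BFSRun T (q ++ ns) (λ w → D w ∨ T v w) es →
         BFSRun T (v ∷ q) D (map (v ,_) ns ++ es)

BFS : ∀ {n} → Graph n → Fin n → List (Fin n × Fin n) → Set
BFS T r es = BFSRun T (r ∷ []) (λ w → isYes (w ≟F r)) es

PCol : ℕ → Set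
PCol k = Fin k → Maybe ℕ

numColorsP : ∀ {k} → PCol k → ℕ
numColorsP {k} c = distinct (mapMaybe c (allFin k))

upd : ∀ {k} → PCol k → Fin k → ℕ → PCol k
upd c R m X = if isYes (X ≟F R) then just m else c X

Incident : ∀ {n} → Fin n → Fin n × Fin n → Set
Incident u (a , b) = (a ≡ u) ⊎ (b ≡ u)

module Greedy {n k : ℕ} (T : Graph n) (ℛ : Fin k → DiGraph n) where

  has : Fin k → Fin n → Fin n → Bool
  has X a b = A (ℛ X) a b ∨ A (ℛ X) b a

  Used : PCol k → (Fin k → Set) → ℕ → Set
  Used c S m = Σ (Fin k) λ Y → c Y ≡ just m × Σ (Fin k) λ X → S X × Collide ℛ X Y

  SmallestFree : PCol k → (Fin k → Set) → ℕ → Set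
  SmallestFree c S m =
    1 ≤ m × ¬ Used c S m × (∀ m' → 1 ≤ m' → m' < m → Used c S m')

  Matched : List (Fin k × Fin k) → Fin k → Fin k → Set
  Matched M R S = ((R , S) ∈ M) ⊎ ((S , R) ∈ M)

  -- graph B on Vp ∪ Vq (Vp ⊆ colored, Vq ⊆ uncolored)
  Cross : PCol k → (Vp Vq : Fin k → Bool) → Fin k → Fin k → Set
  Cross c Vp Vq R S = Vq R ≡ true × Vp S ≡ true ×
    Σ (Fin k) λ U → c U ≡ c S × Collide ℛ U R

  BEdge : PCol k → (Vp Vq : Fin k → Bool) → Fin k → Fin k → Set
  BEdge c Vp Vq R S =
    Collide ℛ R S
    ⊎ (Vp R ≡ true × Vp S ≡ true × c R ≢ c S)
    ⊎ Cross c Vp Vq R S ⊎ Cross c Vp Vq S R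

  CoEdge : PCol k → (Vp Vq : Fin k → Bool) → Fin k → Fin k → Set
  CoEdge c Vp Vq R S =
    (Vp R ∨ Vq R) ≡ true × (Vp S ∨ Vq S) ≡ true × R ≢ S × ¬ BEdge c Vp Vq R S

  endpoints : List (Fin k × Fin k) → List (Fin k)
  endpoints [] = []
  endpoints ((a , b) ∷ M) = a ∷ b ∷ endpoints M

  IsMatching : PCol k → (Vp Vq : Fin k → Bool) → List (Fin k × Fin k) → Set
  IsMatching c Vp Vq M =
    All (λ e → CoEdge c Vp Vq (Data.Product.proj₁ e) (Data.Product.proj₂ e)) M
    × Unique (endpoints M)

  IsMaxMatching : PCol k → (Vp Vq : Fin k → Bool) → List (Fin k × Fin k) → Set
  IsMaxMatching c Vp Vq M = IsMatching c Vp Vq M ×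
    (∀ M' → IsMatching c Vp Vq M' → length M' ≤ length M)

  Assign : List (Fin k × Fin k) → (Vp Vq : Fin k → Bool) → PCol k → PCol k → Set
  Assign M Vp Vq c c' = ∀ R →
    (Vq R ≡ true → ∀ S → Vp S ≡ true → Matched M R S → c' R ≡ c S)
    × ((Vq R ≡ false ⊎ ¬ (Σ (Fin k) λ S → Vp S ≡ true × Matched M R S)) → c' R ≡ c R)

  -- "while some R ∈ Vq is uncolored": if R is matched (in M) to S, color
  -- R and S jointly; otherwise first-fit color R.  With M = [] this is
  -- one-at-a-time first-fit coloring of Vq in arbitrary order.
  data Loop (Vq : Fin k → Bool) (M : List (Fin k × Fin k)) : PCol k → PCol k → Set where
    stop   : ∀ {c} → (∀ R → Vq R ≡ true → Σ ℕ λ m → c R ≡ just m) → Loop Vq M c c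
    pair   : ∀ {c c' R S m} → Vq R ≡ true → c R ≡ nothing → Matched M R S →
             SmallestFree c (λ X → (X ≡ R) ⊎ (X ≡ S)) m →
             Loop Vq M (upd (upd c R m) S m) c' → Loop Vq M c c'
    single : ∀ {c c' R m} → Vq R ≡ true → c R ≡ nothing →
             ¬ (Σ (Fin k) λ S → Matched M R S) →
             SmallestFree c (λ X → X ≡ R) m →
             Loop Vq M (upd c R m) c' → Loop Vq M c c'

  ProcessEdge : (Vp Vq Qall : Fin k → Bool) → PCol k → PCol k → Set
  ProcessEdge Vp Vq Qall c c' =
    Σ (List (Fin k × Fin k)) λ M → IsMaxMatching c Vp Vq M ×
    Σ (PCol k) λ c1 → Assign M Vp Vq c c1 ×
    Σ (PCol k) λ c2 → Loop Vq M c1 c2 × Loop Qall [] c2 c'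

  Qset : PCol k → Fin n → Fin n → Fin k → Bool
  Qset c u v X = is-nothing (c X) ∧ has X u v

  ProcessEdge1 : Fin n → Fin n → PCol k → PCol k → Set
  ProcessEdge1 u v c c' =
    ProcessEdge (λ X → is-just (c X) ∧ has X u v) (Qset c u v) (Qset c u v) c c'

  ProcessEdge2 : Fin n → Fin n → Fin n → PCol k → PCol k → Set
  ProcessEdge2 u v x c c' =
    ProcessEdge (λ X → is-just (c X) ∧ has X u x ∧ not (has X u v))
                (λ X → Qset c u v X ∧ has X u x) (Qset c u v) c c'

  Type4 : List (Fin n × Fin n) → Fin n → List (Fin n × Fin n) → Fin n → Set
  Type4 pre u post x =
    deg T u ≡ 3 × Any (Incident u) pre × (((u , x) ∈ post) ⊎ ((x , u) ∈ post))

  choose : PCol k → Fin n → Fin n → PCol k → PCol k → PCol k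
  choose c u v c1 c2 X =
    if Qset c u v X
    then (if numColorsP c1 ≤ᵇ numColorsP c2 then c1 X else c2 X)
    else c X

  data StepE (pre : List (Fin n × Fin n)) (u v : Fin n) (post : List (Fin n × Fin n))
       (c : PCol k) : PCol k → Set where
    notType4 : ∀ {c'} → ¬ (Σ (Fin n) λ x → Type4 pre u post x) →
               Loop (Qset c u v) [] c c' → StepE pre u v post c c'
    type4    : ∀ {x c1 c2} → Type4 pre u post x →
               ProcessEdge1 u v c c1 → ProcessEdge2 u v x c c2 →
               StepE pre u v post c (choose c u v c1 c2)

  data Run (pre : List (Fin n × Fin n)) : List (Fin n × Fin n) → PCol k → PCol k → Set where
    end  : ∀ {c} → Run pre [] c c
    next : ∀ {u v post c c' c''} → StepE pre u v post c c' →
           Run (pre ++ [ (u , v) ]) post c' c'' → Run pre ((u , v) ∷ post) c c''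

  -- ψ is an output of GREEDY-COL.  Members with no arcs belong to no
  -- R[e_i]; they are first-fit colored at the end (they receive color 1).
  GreedyCol : (Fin k → ℕ) → Set
  GreedyCol ψ =
    Σ (Fin n) λ r → Σ (List (Fin n × Fin n)) λ es → BFS T r es ×
    Σ (PCol k) λ c → Run [] es (λ _ → nothing) c ×
    Σ (PCol k) λ c' → Loop (λ _ → true) [] c c' ×
    (∀ X → c' X ≡ just (ψ X))

-- Let K be the number of colours of any valid colouring φ; each colour class of φ contains an edge at
-- most twice, once per direction.  A coloured subtree S meeting a new R ∋ {u,v} below u must contain an
-- edge {u,y} of R, and an already explored edge at u; otherwise S would bypass an edge of T.
-- Unless {u,v} has type 4 this forces y = v, so first-fit stays within the at most 2K members containing {u,v}.
-- For type 4 let w, v, x be the neighbours of u, and let P, B, Q, C be the coloured members on {u,v},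
-- the coloured ones on {u,x} but not {u,v}, the new ones, and the new ones on {u,x}.  All of W = P ∪ B
-- contain {u,w}, so each colour occurs at most twice in W, on "twins".  A colour introduced by PROCESS-EDGE-1
-- is at most |P ∪ Q| + |B| - |M₁| - (twins in B and between B and P), and one introduced by PROCESS-EDGE-2 is
-- at most |B ∪ C| + |P| - |M₂| - (twins in P and between B and P), or else at most 2K.
-- Twins are matching edges; so are pairs of φ-equal members of P ∪ Q with one end in Q and no twin at the
-- other end.  Summing over the classes of φ, each class contributes at most 5 to the sum of the two bounds,
-- so one of the two colourings uses at most 5K/2 colours.  As used colours always form
-- an initial segment, the colouring with fewer colours obeys the bound too.

{-# OPTIONS --safe #-}
module Submission where

open import Defs
open import Algebra.Properties.CommutativeSemigroup using (interchange)
open import Data.Bool using (Bool; true; false; _∧_; _∨_; not; if_then_else_)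
import Data.Bool as Bool
open import Data.Bool.Properties using (T-≡; ∨-comm)
open import Data.Empty using (⊥; ⊥-elim)
open import Data.Fin using (Fin; toℕ) renaming (_≟_ to _≟F_)
import Data.Fin as Fin
open import Data.Fin.Properties using (any?; toℕ-injective)
import Data.Fin.Properties as Finₚ
open import Data.List using (List; []; _∷_; _++_; [_]; map; length; filterᵇ; mapMaybe; deduplicate; allFin; upTo)
open import Data.List.Properties using (length-++; length-map; length-upTo; length-tabulate; ++-identityʳ; ++-assoc)
open import Data.List.Membership.Propositional using (_∈_; _∉_)
open import Data.List.Membership.Propositional.Properties
import Data.List.Membership.DecPropositional as MembershipDec
open import Data.List.Relation.Binary.Permutation.Propositional using (_↭_; ↭-refl; ↭-sym; ↭⇒↭ₛ)
open import Data.List.Relation.Binary.Permutation.Propositional.Properties using (∈-resp-↭)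
import Data.List.Relation.Binary.Permutation.Setoid.Properties as ↭ₛ
open import Data.List.Relation.Unary.All as All using (All; []; _∷_)
import Data.List.Relation.Unary.All.Properties as Allₚ
open import Data.List.Relation.Unary.AllPairs using ([]; _∷_)
open import Data.List.Relation.Unary.Any as Any using (Any; here; there)
open import Data.List.Relation.Unary.Unique.Propositional using (Unique)
import Data.List.Relation.Unary.Unique.Propositional.Properties as Uₚ
import Data.List.Relation.Unary.Unique.DecPropositional as UniqueDec
open import Data.Maybe using (Maybe; just; nothing; is-just; is-nothing; fromMaybe)
open import Data.Maybe.Properties using (just-injective) renaming (≡-dec to Maybe-≡-dec)
open import Data.Nat hiding (_≟_)
open import Data.Nat.DivMod using (m≡m%n+[m/n]*n; m%n<n; m/n*n≤m; m*n/n≡m; /-monoˡ-≤)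
open import Data.Nat.Properties
open import Data.Nat.Solver using (module +-*-Solver)
open import Data.List.Relation.Unary.Unique.DecPropositional.Properties _≟_ using (deduplicate-!)
open import Data.Product using (Σ; ∃; _×_; _,_; proj₁; proj₂; swap)
open import Data.Product.Properties using (≡-dec)
open import Data.Sum as Sum using (_⊎_; inj₁; inj₂; [_,_]′)
open import Function using (_∘_; id; case_of_; Equivalence)
open import Relation.Binary.Construct.Closure.ReflexiveTransitive as Star using (Star; ε; _◅_; _◅◅_)
open import Relation.Binary.Definitions as Tri using (Tri)
open import Relation.Binary.PropositionalEquality hiding ([_])
open import Relation.Nullary using (¬_; Dec; yes; no)
open import Relation.Nullary.Decidable using (isYes; ¬?; _×-dec_; _⊎-dec_; map′; decidable-stable)

-- The estimates concern the largest colour instead of the number of colours: a first-fit colour `m`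
-- certifies that all smaller colours occur among a few members, and those can be counted. `Segment`
-- translates this into numbers of colours, which is what the algorithm compares. Why 5: a class of
-- `φ` puts at most 2 members on each of the three edges at `u`, so it has weight at most 6 in the
-- sum of the two bounds, and one unit must be regained whenever 6 is reached. Then the class has a
-- member with a twin, or two of its members can be matched in the first process. The two twins of a
-- pair share a colour of the run but may lie in different classes of `φ`, so one pair may have to
-- pay for two classes; it can, because each of the two bounds saves it once. A `φ`-equal pair whose
-- coloured end has a twin may fail to be a matching edge, since the twin may collide with the new
-- end. This is why twins are paid for separately. A statement about all runs would be empty without
-- a run; existence rests on finite search and on counters that bound the loops.

private variable
  𝔸 𝔹 : Set

true≢false : ∀ {b} → b ≡ true → b ≡ false → ⊥
true≢false refl ()

∧-true : ∀ {a b} → a ∧ b ≡ true → a ≡ true × b ≡ true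
∧-true {true} {true} _ = refl , refl

∨-true : ∀ {a b} → a ∨ b ≡ true → a ≡ true ⊎ b ≡ true
∨-true {true}  _ = inj₁ refl
∨-true {false} e = inj₂ e

∨-introˡ : ∀ {a} b → a ≡ true → a ∨ b ≡ true
∨-introˡ _ refl = refl

∨-introʳ : ∀ a {b} → b ≡ true → a ∨ b ≡ true
∨-introʳ true  _ = refl
∨-introʳ false e = e

¬true⇒false : ∀ {b} → ¬ b ≡ true → b ≡ false
¬true⇒false {true}  n = ⊥-elim (n refl)
¬true⇒false {false} _ = refl

isYes⁺ : ∀ {P : Set} (d : Dec P) → P → isYes d ≡ true
isYes⁺ (yes _) _ = refl
isYes⁺ (no n)  p = ⊥-elim (n p)

isYes⁻ : ∀ {P : Set} (d : Dec P) → isYes d ≡ true → P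
isYes⁻ (yes p) _ = p

isYes-no : ∀ {P : Set} (d : Dec P) → ¬ P → isYes d ≡ false
isYes-no (yes p) n = ⊥-elim (n p)
isYes-no (no _)  _ = refl

-- Finite sets

∈-filterᵇ⁺ : ∀ (p : 𝔸 → Bool) {x xs} → x ∈ xs → p x ≡ true → x ∈ filterᵇ p xs
∈-filterᵇ⁺ p x∈ px = ∈-filter⁺ (Bool.T? ∘ p) x∈ (Equivalence.from T-≡ px)

∈-filterᵇ⁻ : ∀ (p : 𝔸 → Bool) {x} xs → x ∈ filterᵇ p xs → x ∈ xs × p x ≡ true
∈-filterᵇ⁻ p xs x∈ with ∈-filter⁻ (Bool.T? ∘ p) {xs = xs} x∈
... | x∈xs , px = x∈xs , Equivalence.to T-≡ px

∈-remove : ∀ {x y : 𝔸} ys zs → y ∈ ys ++ x ∷ zs → x ≢ y → y ∈ ys ++ zs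
∈-remove ys zs y∈ x≢y with ∈-++⁻ ys y∈
... | inj₁ y∈ys         = ∈-++⁺ˡ y∈ys
... | inj₂ (here y≡x)   = ⊥-elim (x≢y (sym y≡x))
... | inj₂ (there y∈zs) = ∈-++⁺ʳ ys y∈zs

Unique-⊆⇒length≤ : ∀ {xs ys : List 𝔸} → Unique xs → (∀ {x} → x ∈ xs → x ∈ ys) → length xs ≤ length ys
Unique-⊆⇒length≤ {xs = []} _ _ = z≤n
Unique-⊆⇒length≤ {xs = x ∷ xs} (x∉ ∷ u) sub with ∈-∃++ (sub (here refl))
... | ys , zs , refl = begin
  suc (length xs)         ≤⟨ s≤s (Unique-⊆⇒length≤ u λ y∈ → ∈-remove ys zs (sub (there y∈)) (All.lookup x∉ y∈)) ⟩
  suc (length (ys ++ zs)) ≡⟨ cong suc (length-++ ys) ⟩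
  suc (length ys + length zs) ≡⟨ +-suc (length ys) (length zs) ⟨
  length ys + length (x ∷ zs) ≡⟨ length-++ ys ⟨
  length (ys ++ x ∷ zs)   ∎
  where open ≤-Reasoning

-- Every bound on a single colour comes from here: first-fit supplies the witnesses, and distinct
-- colours sit on distinct members.
covers⇒≤ : ∀ m (xs : List 𝔸) (f : 𝔸 → Maybe ℕ) →
           (∀ j → 1 ≤ j → j ≤ m → ∃ λ x → x ∈ xs × f x ≡ just j) → m ≤ length xs
covers⇒≤ m xs f cov = begin
  m                                     ≡⟨ length-upTo m ⟨
  length (upTo m)                       ≡⟨ length-map (just ∘ suc) (upTo m) ⟨
  length (map (just ∘ suc) (upTo m))    ≤⟨ Unique-⊆⇒length≤ (Uₚ.map⁺ (λ { refl → refl }) (Uₚ.upTo⁺ m)) sub ⟩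
  length (map f xs)                     ≡⟨ length-map f xs ⟩
  length xs                             ∎
  where
  open ≤-Reasoning
  sub : ∀ {y} → y ∈ map (just ∘ suc) (upTo m) → y ∈ map f xs
  sub y∈ with ∈-map⁻ (just ∘ suc) y∈
  ... | i , i∈ , refl with cov (suc i) (s≤s z≤n) (∈-upTo⁻ i∈)
  ...   | x , x∈ , fx = subst (_∈ map f xs) fx (∈-map⁺ f x∈)

𝟙 : Bool → ℕ
𝟙 true  = 1
𝟙 false = 0

∑ : (𝔸 → ℕ) → List 𝔸 → ℕ
∑ f []       = 0
∑ f (x ∷ xs) = f x + ∑ f xs

∑-mono : ∀ {f g : 𝔸 → ℕ} xs → (∀ x → f x ≤ g x) → ∑ f xs ≤ ∑ g xs
∑-mono []       _  = z≤n
∑-mono (x ∷ xs) le = +-mono-≤ (le x) (∑-mono xs le)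

∑-mono-< : ∀ {f g : 𝔸 → ℕ} {y xs} → (∀ x → f x ≤ g x) → y ∈ xs → f y < g y → ∑ f xs < ∑ g xs
∑-mono-< {xs = _ ∷ xs} le (here refl) lt = +-mono-<-≤ lt (∑-mono xs le)
∑-mono-< le (there y∈)  lt = +-mono-≤-< (le _) (∑-mono-< le y∈ lt)

∑-cong : ∀ {f g : 𝔸 → ℕ} xs → (∀ x → f x ≡ g x) → ∑ f xs ≡ ∑ g xs
∑-cong []       _ = refl
∑-cong (x ∷ xs) e = cong₂ _+_ (e x) (∑-cong xs e)

∑-+ : ∀ (f g : 𝔸 → ℕ) xs → ∑ (λ x → f x + g x) xs ≡ ∑ f xs + ∑ g xs
∑-+ f g []       = refl
∑-+ f g (x ∷ xs) = trans (cong (f x + g x +_) (∑-+ f g xs)) (interchange +-commutativeSemigroup (f x) (g x) _ _)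

∑-zero : ∀ (xs : List 𝔸) → ∑ (λ _ → 0) xs ≡ 0
∑-zero []       = refl
∑-zero (_ ∷ xs) = ∑-zero xs

∑-const : ∀ c (xs : List 𝔸) → ∑ (λ _ → c) xs ≡ length xs * c
∑-const c []       = refl
∑-const c (_ ∷ xs) = cong (c +_) (∑-const c xs)

∑-swap : ∀ (h : 𝔸 → 𝔹 → ℕ) xs ys → ∑ (λ x → ∑ (h x) ys) xs ≡ ∑ (λ y → ∑ (λ x → h x y) xs) ys
∑-swap h []       ys = sym (∑-zero ys)
∑-swap h (x ∷ xs) ys = trans (cong (∑ (h x) ys +_) (∑-swap h xs ys)) (sym (∑-+ (h x) (λ y → ∑ (λ x → h x y) xs) ys))

term≤∑ : ∀ (f : 𝔸 → ℕ) {x xs} → x ∈ xs → f x ≤ ∑ f xs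
term≤∑ f {xs = _ ∷ xs} (here refl) = m≤m+n _ (∑ f xs)
term≤∑ f {xs = y ∷ _}  (there x∈) = ≤-trans (term≤∑ f x∈) (m≤n+m _ (f y))

length-filterᵇ : ∀ (p : 𝔸 → Bool) xs → length (filterᵇ p xs) ≡ ∑ (𝟙 ∘ p) xs
length-filterᵇ p []       = refl
length-filterᵇ p (x ∷ xs) with p x
... | true  = cong suc (length-filterᵇ p xs)
... | false = length-filterᵇ p xs

module _ {k : ℕ} where

  elements : (Fin k → Bool) → List (Fin k)
  elements p = filterᵇ p (allFin k)

  count : (Fin k → Bool) → ℕ
  count p = length (elements p)

  ∈-elements⁺ : ∀ p {x} → p x ≡ true → x ∈ elements p
  ∈-elements⁺ p {x} px = ∈-filterᵇ⁺ p (∈-allFin x) px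

  ∈-elements⁻ : ∀ p {x} → x ∈ elements p → p x ≡ true
  ∈-elements⁻ p x∈ = proj₂ (∈-filterᵇ⁻ p (allFin k) x∈)

  elements-unique : ∀ p → Unique (elements p)
  elements-unique p = Uₚ.filter⁺ (Bool.T? ∘ p) (Uₚ.allFin⁺ k)

  count≡∑ : ∀ p → count p ≡ ∑ (𝟙 ∘ p) (allFin k)
  count≡∑ p = length-filterᵇ p (allFin k)

  count≤1 : ∀ p → (∀ x y → p x ≡ true → p y ≡ true → x ≡ y) → ∑ (𝟙 ∘ p) (allFin k) ≤ 1
  count≤1 p eq = subst (_≤ 1) (count≡∑ p) (go (elements p) (elements-unique p) (∈-elements⁻ p))
    where
    go : ∀ xs → Unique xs → (∀ {x} → x ∈ xs → p x ≡ true) → length xs ≤ 1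
    go []           _            _  = z≤n
    go (_ ∷ [])     _            _  = s≤s z≤n
    go (x ∷ y ∷ xs) ((n ∷ _) ∷ _) px = ⊥-elim (n (eq x y (px (here refl)) (px (there (here refl)))))

-- Counting by colour classes

module _ {k : ℕ} (φ : Fin k → ℕ) where

  palette : List ℕ
  palette = deduplicate _≟_ (map φ (allFin k))

  inClass : ℕ → Fin k → Bool
  inClass κ X = isYes (φ X ≟ κ)

  ∈-palette : ∀ X → φ X ∈ palette
  ∈-palette X = ∈-deduplicate⁺ _≟_ (∈-map⁺ φ (∈-allFin X))

  palette-unique : Unique palette
  palette-unique = deduplicate-! _

  -- This inequality and its converse serve opposite ends of one estimate: the first spreads weight
  -- over the classes, the second collects what the classes save. They rest on `palette` listing
  -- every colour and listing none twice, respectively.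
  ∑≤∑∑classes : ∀ f → ∑ f (allFin k) ≤ ∑ (λ κ → ∑ (λ X → 𝟙 (inClass κ X) * f X) (allFin k)) palette
  ∑≤∑∑classes f = begin
    ∑ f (allFin k)
      ≤⟨ ∑-mono (allFin k) pt ⟩
    ∑ (λ X → ∑ (λ κ → 𝟙 (inClass κ X) * f X) palette) (allFin k)
      ≡⟨ ∑-swap (λ X κ → 𝟙 (inClass κ X) * f X) (allFin k) palette ⟩
    ∑ (λ κ → ∑ (λ X → 𝟙 (inClass κ X) * f X) (allFin k)) palette ∎
    where
    open ≤-Reasoning
    pt : ∀ X → f X ≤ ∑ (λ κ → 𝟙 (inClass κ X) * f X) palette
    pt X = begin
      f X                             ≡⟨ *-identityˡ (f X) ⟨
      1 * f X                         ≡⟨ cong (λ b → 𝟙 b * f X) (isYes⁺ (φ X ≟ φ X) refl) ⟨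
      𝟙 (inClass (φ X) X) * f X       ≤⟨ term≤∑ (λ κ → 𝟙 (inClass κ X) * f X) (∈-palette X) ⟩
      ∑ (λ κ → 𝟙 (inClass κ X) * f X) palette ∎

  ∑∑classes≤∑ : ∀ f → ∑ (λ κ → ∑ (λ X → 𝟙 (inClass κ X) * f X) (allFin k)) palette ≤ ∑ f (allFin k)
  ∑∑classes≤∑ f = begin
    ∑ (λ κ → ∑ (λ X → 𝟙 (inClass κ X) * f X) (allFin k)) palette
      ≡⟨ ∑-swap (λ X κ → 𝟙 (inClass κ X) * f X) (allFin k) palette ⟨
    ∑ (λ X → ∑ (λ κ → 𝟙 (inClass κ X) * f X) palette) (allFin k)
      ≤⟨ ∑-mono (allFin k) (λ X → pt X palette-unique) ⟩
    ∑ f (allFin k) ∎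
    where
    open ≤-Reasoning
    zeros : ∀ X κs → All (φ X ≢_) κs → ∑ (λ κ → 𝟙 (inClass κ X) * f X) κs ≡ 0
    zeros X [] [] = refl
    zeros X (κ ∷ κs) (n ∷ ns) rewrite isYes-no (φ X ≟ κ) n = zeros X κs ns
    pt : ∀ X {κs} → Unique κs → ∑ (λ κ → 𝟙 (inClass κ X) * f X) κs ≤ f X
    pt X [] = z≤n
    pt X {κ ∷ κs} (n ∷ u) with φ X ≟ κ
    ... | yes refl = ≤-reflexive (trans (cong (1 * f X +_) (zeros X κs n)) (trans (+-identityʳ _) (*-identityˡ (f X))))
    ... | no _     = pt X u

mapMaybe⁻ : ∀ (f : 𝔸 → Maybe 𝔹) xs {y} → y ∈ mapMaybe f xs → ∃ λ x → x ∈ xs × f x ≡ just y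
mapMaybe⁻ f (x ∷ xs) y∈ with f x in fx
... | nothing = let a , a∈ , e = mapMaybe⁻ f xs y∈ in a , there a∈ , e
mapMaybe⁻ f (x ∷ xs) (here refl) | just _ = x , here refl , fx
mapMaybe⁻ f (x ∷ xs) (there y∈)  | just _ = let a , a∈ , e = mapMaybe⁻ f xs y∈ in a , there a∈ , e

mapMaybe⁺ : ∀ (f : 𝔸 → Maybe 𝔹) {xs x y} → x ∈ xs → f x ≡ just y → y ∈ mapMaybe f xs
mapMaybe⁺ f {x ∷ _} (here refl) e with just _ ← f x | refl ← e = here refl
mapMaybe⁺ f {a ∷ _} (there x∈)  e with f a
... | nothing = mapMaybe⁺ f x∈ e
... | just _  = there (mapMaybe⁺ f x∈ e)

length-mapMaybe : ∀ (f : 𝔸 → Maybe 𝔹) xs → length (mapMaybe f xs) ≡ ∑ (𝟙 ∘ is-just ∘ f) xs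
length-mapMaybe f []       = refl
length-mapMaybe f (x ∷ xs) with f x
... | nothing = length-mapMaybe f xs
... | just _  = cong suc (length-mapMaybe f xs)

-- Lists of disjoint pairs

module Pairs {n k : ℕ} (T : Graph n) (ℛ : Fin k → DiGraph n) where

  open Greedy T ℛ using (endpoints)

  Meets : Fin k → Fin k × Fin k → Set
  Meets X (a , b) = (X ≡ a) ⊎ (X ≡ b)

  ∈-endpoints⁻ : ∀ M {X} → X ∈ endpoints M → ∃ λ e → e ∈ M × Meets X e
  ∈-endpoints⁻ (e ∷ M) (here p)         = e , here refl , inj₁ p
  ∈-endpoints⁻ (e ∷ M) (there (here p)) = e , here refl , inj₂ p
  ∈-endpoints⁻ (e ∷ M) (there (there X∈)) with ∈-endpoints⁻ M X∈
  ... | e' , e'∈ , m = e' , there e'∈ , m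

  ∈-endpoints⁺ : ∀ {M e X} → e ∈ M → Meets X e → X ∈ endpoints M
  ∈-endpoints⁺ (here refl) (inj₁ refl) = here refl
  ∈-endpoints⁺ (here refl) (inj₂ refl) = there (here refl)
  ∈-endpoints⁺ (there e∈)  m           = there (there (∈-endpoints⁺ e∈ m))

  length-endpoints : ∀ M → length (endpoints M) ≡ length M + length M
  length-endpoints []      = refl
  length-endpoints (_ ∷ M) = cong suc (trans (cong suc (length-endpoints M)) (sym (+-suc (length M) (length M))))

  endpoints-++ : ∀ M N → endpoints (M ++ N) ≡ endpoints M ++ endpoints N
  endpoints-++ []      N = refl
  endpoints-++ (e ∷ M) N = cong (λ xs → proj₁ e ∷ proj₂ e ∷ xs) (endpoints-++ M N)

  Disjoint₂ : Fin k × Fin k → Fin k × Fin k → Set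
  Disjoint₂ e e' = ∀ X → Meets X e → Meets X e' → ⊥

  endpoints-unique-mapMaybe : ∀ {𝔸 : Set} (f : 𝔸 → Maybe (Fin k × Fin k)) {xs} → Unique xs →
    (∀ a X Y → f a ≡ just (X , Y) → X ≢ Y) →
    (∀ a b e e' → a ≢ b → f a ≡ just e → f b ≡ just e' → Disjoint₂ e e') →
    Unique (endpoints (mapMaybe f xs))
  endpoints-unique-mapMaybe f [] _ _ = []
  endpoints-unique-mapMaybe f {a ∷ as} (a∉ ∷ u) ne dis with f a in fa
  ... | nothing      = endpoints-unique-mapMaybe f u ne dis
  ... | just (X , Y) = (ne a X Y fa ∷ All.tabulate (apart (inj₁ refl))) ∷ All.tabulate (apart (inj₂ refl)) ∷ endpoints-unique-mapMaybe f u ne dis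
    where
    apart : ∀ {Z} → Meets Z (X , Y) → ∀ {W} → W ∈ endpoints (mapMaybe f as) → Z ≢ W
    apart mZ W∈ refl with ∈-endpoints⁻ (mapMaybe f as) W∈
    ... | e , e∈ , mW with mapMaybe⁻ f as e∈
    ...   | b , b∈ , fb = dis a b (X , Y) e (All.lookup a∉ b∈) fa fb _ mZ mW

-- Walks and simple paths

module _ {n : ℕ} where

  data Path (E : Fin n → Fin n → Set) : Fin n → Fin n → List (Fin n) → Set where
    []  : ∀ {a} → Path E a a (a ∷ [])
    _∷_ : ∀ {a c b xs} → E a c → Path E c b xs → Path E a b (a ∷ xs)

  suffixFrom : ∀ {E c b a xs} → Path E c b xs → Unique xs → a ∈ xs → ∃ λ ys → Path E a b ys × Unique ys
  suffixFrom []      u       (here refl) = _ , [] , u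
  suffixFrom (e ∷ p) u       (here refl) = _ , e ∷ p , u
  suffixFrom (e ∷ p) (_ ∷ u) (there a∈)  = suffixFrom p u a∈

  simplePath : ∀ {E a b} → Star E a b → ∃ λ xs → Path E a b xs × Unique xs
  simplePath ε = _ , [] , [] ∷ []
  simplePath {a = a} (e ◅ s) with simplePath s
  ... | xs , p , u with Any.any? (a ≟F_) xs
  ...   | yes a∈ = suffixFrom p u a∈
  ...   | no a∉  = _ , e ∷ p , Allₚ.¬Any⇒All¬ xs a∉ ∷ u

  Path⇒Chain : ∀ {E adj a b z xs} → (∀ {x y} → E x y → adj x y ≡ true) → adj b z ≡ true →
               Path E a b xs → Chain adj (xs ++ [ z ])
  Path⇒Chain E⊆ bz []            = cons bz one
  Path⇒Chain E⊆ bz (e ∷ [])      = cons (E⊆ e) (cons bz one)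
  Path⇒Chain E⊆ bz (e ∷ (f ∷ p)) = cons (E⊆ e) (Path⇒Chain E⊆ bz (f ∷ p))

  Path-head : ∀ {E a b xs} → Path E a b xs → ∃ λ vs → xs ≡ a ∷ vs
  Path-head []      = _ , refl
  Path-head (_ ∷ _) = _ , refl

  Walk⇒Star : ∀ {V adj u v} → Walk {n} V adj u v → Star (λ x y → adj x y ≡ true) u v
  Walk⇒Star (here _)     = ε
  Walk⇒Star (step _ e w) = e ◅ Walk⇒Star w

  -- The walk is cut at its first visit of `u`. The part before it avoids every edge at `u`, which
  -- makes it usable in a bypass.
  firstHit : ∀ {E : Fin n → Fin n → Set} {p u} → Star E p u → p ≢ u →
             ∃ λ z → E z u × Star (λ x y → E x y × x ≢ u × y ≢ u) p z
  firstHit ε p≢u = ⊥-elim (p≢u refl)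
  firstHit {u = u} (_◅_ {j = q} e s) p≢u with q ≟F u
  ... | yes refl = _ , e , ε
  ... | no q≢u with firstHit s q≢u
  ...   | z , zu , t = z , zu , (e , p≢u , q≢u) ◅ t

  EdgeIn : List (Fin n × Fin n) → Fin n → Fin n → Set
  EdgeIn es a b = ((a , b) ∈ es) ⊎ ((b , a) ∈ es)

  AvoidEdge : Graph n → Fin n → Fin n → Fin n → Fin n → Set
  AvoidEdge T a b x y = T x y ≡ true × ¬ (x ≡ a × y ≡ b) × ¬ (x ≡ b × y ≡ a)

-- Subtrees and explored edges of a tree

module TreeFacts {n : ℕ} (T : Graph n) (isTree : IsTree T) where

  T-sym : ∀ {a b} → T a b ≡ true → T b a ≡ true
  T-sym {a} {b} e = trans (sym (proj₁ isTree a b)) e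

  T-irrefl : ∀ {a b} → T a b ≡ true → a ≢ b
  T-irrefl {a} e refl = true≢false e (proj₁ (proj₂ isTree) a)

  -- A simple path that avoids the edge has at least two edges, as a single one would be the
  -- forbidden edge; `ab` closes it to a cycle.
  noBypass : ∀ {a b} → T a b ≡ true → ¬ Star (AvoidEdge T a b) a b
  noBypass {a} {b} ab s with simplePath s
  ... | _ , [] , _ = T-irrefl ab refl
  ... | _ , (_ , ¬ab , _) ∷ [] , _ = ¬ab (refl , refl)
  ... | _ , e ∷ (f ∷ p) , u with Path-head p
  ...   | vs , refl = proj₂ (proj₂ (proj₂ (proj₂ (proj₂ isTree))))
          (a , _ , s≤s (s≤s z≤n) , u , All.tabulate (λ _ → refl) , Path⇒Chain proj₁ (T-sym ab) (e ∷ (f ∷ p)))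

  module Subtree (S : DiGraph n) (isS : IsRootedSubtree T S) where

    und-T : ∀ {a b} → und S a b ≡ true → T a b ≡ true
    und-T {a} {b} e with ∨-true {A S a b} e
    ... | inj₁ ab = proj₂ (proj₂ (proj₁ isS a b ab))
    ... | inj₂ ba = T-sym (proj₂ (proj₂ (proj₁ isS b a ba)))

    und-V : ∀ {a b} → und S a b ≡ true → V S a ≡ true × V S b ≡ true
    und-V {a} {b} e = proj₁ (proj₁ (proj₂ (proj₂ isS))) a b e

    und-sym : ∀ {a b} → und S a b ≡ true → und S b a ≡ true
    und-sym {a} {b} e = trans (∨-comm (A S b a) (A S a b)) e

    walk : ∀ {a b} → V S a ≡ true → V S b ≡ true → Star (λ x y → und S x y ≡ true) a b
    walk {a} {b} Va Vb = Walk⇒Star (proj₁ (proj₂ (proj₂ (proj₁ (proj₂ (proj₂ isS))))) a b Va Vb)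

    avoid : ∀ {a b x y} → und S a b ≡ false → und S x y ≡ true → AvoidEdge T a b x y
    avoid ∉S e = und-T e , (λ { (refl , refl) → true≢false e ∉S }) , (λ { (refl , refl) → true≢false (und-sym e) ∉S })

  avoid-u : ∀ {z u x y} → T x y ≡ true → x ≢ u → y ≢ u → AvoidEdge T z u y x
  avoid-u e x≢u y≢u = T-sym e , (λ { (refl , refl) → x≢u refl }) , (λ { (refl , refl) → y≢u refl })

  module Explored (pre : List (Fin n × Fin n)) (u : Fin n)
    (pre-T : ∀ {a b} → EdgeIn pre a b → T a b ≡ true)
    (pre-conn : ∀ {a b} → EdgeIn pre a b → Star (EdgeIn pre) a u) where

    module _ (S : DiGraph n) (isS : IsRootedSubtree T S) where
      open Subtree S isS

      -- The explored route from `a` enters `u` by an edge `zu`. If `S` missed it, going back from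
      -- `z` to `a` along that route and then from `a` to `u` inside `S` would bypass `zu`.
      exploredEdgeAt : ∀ {a b} → EdgeIn pre a b → und S a b ≡ true → V S u ≡ true →
                       ∃ λ z → EdgeIn pre z u × und S z u ≡ true
      exploredEdgeAt {a} {b} ab Sab Vu with a ≟F u
      ... | yes refl = b , Sum.swap ab , und-sym Sab
      ... | no a≢u with firstHit (pre-conn ab) a≢u
      ...   | z , zu , t with und S z u in Szu
      ...     | true  = z , zu , Szu
      ...     | false = ⊥-elim (noBypass (pre-T zu)
                 (Star.reverse id (Star.map (λ (e , x≢ , y≢) → avoid-u (pre-T e) x≢ y≢) t) ◅◅
                  Star.map (avoid Szu) (walk (proj₁ (und-V Sab)) Vu)))

      -- The candidate is the edge `yu` by which `R` reaches `u` from the shared edge. If `S` missed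
      -- it, a bypass would run from `y` inside `R` to the shared edge, inside `S` to an explored
      -- edge, and along explored edges to `u`. The last part avoids `yu` because `R` contains no
      -- explored edge.
      sharedEdgeAt : (R : DiGraph n) (isR : IsRootedSubtree T R) →
        (∀ {a b} → EdgeIn pre a b → und R a b ≡ false) → V R u ≡ true →
        ∀ {a b} → EdgeIn pre a b → und S a b ≡ true →
        ∀ {c d} → und R c d ≡ true → und S c d ≡ true →
        ∃ λ y → und R y u ≡ true × und S y u ≡ true
      sharedEdgeAt R isR R∩pre Vu {a} {b} ab Sab {c} {d} Rcd Scd with c ≟F u
      ... | yes refl = d , Subtree.und-sym R isR Rcd , und-sym Scd
      ... | no c≢u with firstHit (Subtree.walk R isR (proj₁ (Subtree.und-V R isR Rcd)) Vu) c≢u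
      ...   | y , yu , t with und S y u in Syu
      ...     | true  = y , yu , Syu
      ...     | false = ⊥-elim (noBypass (Subtree.und-T R isR yu)
                 (Star.reverse id (Star.map (λ (e , x≢ , y≢) → avoid-u (Subtree.und-T R isR e) x≢ y≢) t) ◅◅
                  Star.map (avoid Syu) (walk (proj₁ (und-V Scd)) (proj₁ (und-V Sab))) ◅◅
                  Star.map preAvoid (pre-conn ab)))
        where
        preAvoid : ∀ {x z} → EdgeIn pre x z → AvoidEdge T y u x z
        preAvoid e = pre-T e , (λ { (refl , refl) → true≢false yu (R∩pre e) })
                             , (λ { (refl , refl) → true≢false yu (R∩pre (Sum.swap e)) })

-- Search orders

  -- What the analysis keeps of a BFS run: an edge leads from a known vertex to a fresh one.
  data Search : List (Fin n) → List (Fin n × Fin n) → Set where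
    []  : ∀ {vs} → Search vs []
    new : ∀ {vs u v es} → u ∈ vs → v ∉ vs → T u v ≡ true → Search (v ∷ vs) es → Search vs ((u , v) ∷ es)

  Search-fresh : ∀ {vs es a b} → Search vs es → (a , b) ∈ es → b ∉ vs
  Search-fresh (new _ v∉ _ _) (here refl) = v∉
  Search-fresh (new _ _ _ s)  (there e∈)  = Search-fresh s e∈ ∘ there

  private
    neighbours : ∀ v (D : Fin n → Bool) → List (Fin n)
    neighbours v D = filterᵇ (λ w → T v w ∧ not (D w)) (allFin n)

    not-true : ∀ {b} → not b ≡ true → b ≡ false
    not-true {false} _ = refl

  record Layer (v : Fin n) (D : Fin n → Bool) (ns : List (Fin n)) : Set where
    field
      unique : Unique ns
      sound  : ∀ {w} → w ∈ ns → T v w ≡ true × D w ≡ false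
      full   : ∀ {w} → T v w ≡ true → D w ≡ false → w ∈ ns

  layer : ∀ {v D ns} → ns ↭ neighbours v D → Layer v D ns
  layer {v} {D} {ns} perm = record
    { unique = ↭ₛ.Unique-resp-↭ (setoid (Fin n)) (↭⇒↭ₛ (↭-sym perm)) (Uₚ.filter⁺ _ (Uₚ.allFin⁺ n))
    ; sound  = λ w∈ → let tv , nd = ∧-true (proj₂ (∈-filterᵇ⁻ p (allFin n) (∈-resp-↭ perm w∈))) in tv , not-true nd
    ; full   = λ {w} tv nd → ∈-resp-↭ (↭-sym perm) (∈-filterᵇ⁺ p (∈-allFin w) (cong₂ _∧_ tv (cong not nd)))
    }
    where p = λ w → T v w ∧ not (D w)

  -- A BFS step marks all new neighbours of `v` at once, a search marks one at a time. In `go`, `ds`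
  -- are the neighbours already passed and `ms` those still to come.
  BFS⇒Search : ∀ {q D es vs} → BFSRun T q D es →
    (∀ {w} → w ∈ vs → D w ≡ true) → (∀ {w} → D w ≡ true → w ∈ vs) → (∀ {w} → w ∈ q → w ∈ vs) → Search vs es
  BFS⇒Search done _ _ _ = []
  BFS⇒Search {vs = vs₀} (step {v} {q} {D} {ns} {es} perm run) vs⊆ ⊆vs q⊆ =
    go ns [] (Layer.unique L) (λ ()) (λ w∈ → inj₂ w∈) (λ w∈ → w∈) fresh
    where
    L = layer perm
    fresh : ∀ {w} → w ∈ ns → w ∉ vs₀
    fresh w∈ w∈vs = true≢false (vs⊆ w∈vs) (proj₂ (Layer.sound L w∈))
    go : ∀ ms ds → Unique ms → (∀ {w} → w ∈ ds → w ∈ ns × w ∉ ms) →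
         (∀ {w} → w ∈ ns → (w ∈ ds) ⊎ (w ∈ ms)) → (∀ {w} → w ∈ ms → w ∈ ns) → (∀ {w} → w ∈ ns → w ∉ vs₀) →
         Search (ds ++ vs₀) (map (v ,_) ms ++ es)
    go [] ds _ ds⊆ split _ _ = BFS⇒Search run
      (λ {w} w∈ → [ (λ w∈ds → ∨-introʳ (D w) (proj₁ (Layer.sound L (proj₁ (ds⊆ w∈ds)))))
              , (λ w∈vs → ∨-introˡ _ (vs⊆ w∈vs)) ]′ (∈-++⁻ ds w∈))
      covered
      (λ w∈ → [ (λ w∈q → ∈-++⁺ʳ ds (q⊆ (there w∈q))) , (λ w∈ns → ∈-++⁺ˡ (unsplit (split w∈ns))) ]′ (∈-++⁻ q w∈))
      where
      unsplit : ∀ {w} → (w ∈ ds) ⊎ (w ∈ []) → w ∈ ds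
      unsplit (inj₁ w∈) = w∈
      covered : ∀ {w} → D w ∨ T v w ≡ true → w ∈ ds ++ vs₀
      covered {w} D'w with D w in eq
      ... | true  = ∈-++⁺ʳ ds (⊆vs eq)
      ... | false = ∈-++⁺ˡ (unsplit (split (Layer.full L D'w eq)))
    go (m ∷ ms) ds (m∉ ∷ u) ds⊆ split ms⊆ ns∉ = new
      (∈-++⁺ʳ ds (q⊆ (here refl)))
      (λ m∈ → [ (λ m∈ds → proj₂ (ds⊆ m∈ds) (here refl)) , ns∉ (ms⊆ (here refl)) ]′ (∈-++⁻ ds m∈))
      (proj₁ (Layer.sound L (ms⊆ (here refl))))
      (go ms (m ∷ ds) u
        (λ { (here refl) → ms⊆ (here refl) , λ m∈ → All.lookup m∉ m∈ refl
           ; (there w∈)  → proj₁ (ds⊆ w∈) , λ w∈ms → proj₂ (ds⊆ w∈) (there w∈ms) })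
        (λ w∈ → case split w∈ of λ where
          (inj₁ w∈ds)       → inj₁ (there w∈ds)
          (inj₂ (here e))   → inj₁ (here e)
          (inj₂ (there w∈)) → inj₂ w∈)
        (ms⊆ ∘ there) ns∉)

  Reached : (Fin n → Bool) → List (Fin n × Fin n) → Fin n → Set
  Reached D es w = (D w ≡ true) ⊎ (w ∈ map proj₂ es)

  -- The hypothesis on `D` is the queue invariant: a discovered vertex waits in the queue or has
  -- only discovered neighbours. With an empty queue it becomes closedness.
  BFS-closed : ∀ {q D es} → BFSRun T q D es →
    (∀ {a} → D a ≡ true → (a ∈ q) ⊎ (∀ {b} → T a b ≡ true → D b ≡ true)) →
    ∀ {a b} → Reached D es a → T a b ≡ true → Reached D es b
  BFS-closed done inv (inj₁ Da) ab = case inv Da of λ where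
    (inj₂ f) → inj₁ (f ab)
  BFS-closed (step {v} {q} {D} {ns} {es} perm run) inv {a} {b} ra ab = back (BFS-closed run inv' (forth ra) ab)
    where
    L = layer perm
    D' = λ w → D w ∨ T v w
    inj-ns : ∀ {w} → w ∈ ns → w ∈ map proj₂ (map (v ,_) ns ++ es)
    inj-ns w∈ = ∈-map⁺ proj₂ (∈-++⁺ˡ (∈-map⁺ (v ,_) w∈))
    back : ∀ {w} → Reached D' es w → Reached D (map (v ,_) ns ++ es) w
    back {w} (inj₁ D'w) with D w in eq
    ... | true  = inj₁ refl
    ... | false = inj₂ (inj-ns (Layer.full L D'w eq))
    back (inj₂ w∈) with ∈-map⁻ proj₂ w∈
    ... | e , e∈ , refl = inj₂ (∈-map⁺ proj₂ (∈-++⁺ʳ (map (v ,_) ns) e∈))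
    forth : ∀ {w} → Reached D (map (v ,_) ns ++ es) w → Reached D' es w
    forth (inj₁ Dw) = inj₁ (∨-introˡ _ Dw)
    forth {w} (inj₂ w∈) with ∈-map⁻ proj₂ w∈
    ... | e , e∈ , refl with ∈-++⁻ (map (v ,_) ns) e∈
    ...   | inj₂ e∈es = inj₂ (∈-map⁺ proj₂ e∈es)
    ...   | inj₁ e∈ns with ∈-map⁻ (v ,_) e∈ns
    ...     | x , x∈ , refl = inj₁ (∨-introʳ (D x) (proj₁ (Layer.sound L x∈)))
    inv' : ∀ {a} → D' a ≡ true → (a ∈ q ++ ns) ⊎ (∀ {b} → T a b ≡ true → D' b ≡ true)
    inv' {a} D'a with D a in eq
    ... | false = inj₁ (∈-++⁺ʳ q (Layer.full L D'a eq))
    ... | true with inv eq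
    ...   | inj₁ (here refl) = inj₂ λ {b} ab → ∨-introʳ (D b) ab
    ...   | inj₁ (there a∈)  = inj₁ (∈-++⁺ˡ a∈)
    ...   | inj₂ f           = inj₂ λ ab → ∨-introˡ _ (f ab)

  Search-connected : ∀ {E : Fin n → Fin n → Set} {r vs es} → (∀ {a b} → E a b → E b a) →
    Search vs es → (∀ {a b} → (a , b) ∈ es → E a b) →
    (∀ {d} → d ∈ vs → Star E d r) → ∀ {d} → (d ∈ vs) ⊎ (d ∈ map proj₂ es) → Star E d r
  Search-connected _ _ _ conn (inj₁ d∈) = conn d∈
  Search-connected E-sym (new {vs} {u} {v} u∈ _ _ s) es⊆ conn (inj₂ d∈) =
    Search-connected E-sym s (es⊆ ∘ there)
      (λ { (here refl) → E-sym (es⊆ (here refl)) ◅ conn u∈ ; (there d∈) → conn d∈ })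
      (case d∈ of λ { (here e) → inj₁ (here e) ; (there d∈) → inj₂ d∈ })

  Search-T : ∀ {vs es a b} → Search vs es → (a , b) ∈ es → T a b ≡ true
  Search-T (new _ _ t _) (here refl) = t
  Search-T (new _ _ _ s) (there e∈)  = Search-T s e∈

  edgeIn? : ∀ es (a b : Fin n) → Dec (EdgeIn es a b)
  edgeIn? es a b = ((a , b) ∈? es) ⊎-dec ((b , a) ∈? es)
    where
    open MembershipDec (≡-dec (_≟F_ {n}) _≟F_) using (_∈?_)

  BFS-search : ∀ {r es} → BFS T r es → Search (r ∷ []) es
  BFS-search {r} run = BFS⇒Search run
    (λ { (here refl) → isYes⁺ (r ≟F r) refl })
    (λ {w} e → here (isYes⁻ (w ≟F r) e)) id

  -- Every vertex is discovered, and listed edges join it to the root. Were `ab` not listed, these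
  -- routes would avoid it and still join `a` to `b`.
  BFS-covers : ∀ {r es} → BFS T r es → ∀ {a b} → T a b ≡ true → EdgeIn es a b
  BFS-covers {r} {es} run {a} {b} ab with edgeIn? es a b
  ... | yes e = e
  ... | no ¬e = ⊥-elim (noBypass ab (toRoot a ◅◅ Star.reverse flipA (toRoot b)))
    where
    search = BFS-search run
    Off = AvoidEdge T a b
    flipA : ∀ {x y} → Off x y → Off y x
    flipA (t , p , q) = T-sym t , (λ (x , y) → q (y , x)) , (λ (x , y) → p (y , x))
    es⊆ : ∀ {x y} → (x , y) ∈ es → Off x y
    es⊆ e∈ = Search-T search e∈ , (λ { (refl , refl) → ¬e (inj₁ e∈) }) , (λ { (refl , refl) → ¬e (inj₂ e∈) })
    reached : ∀ {w} → Star (λ x y → T x y ≡ true) r w → Reached (λ w → isYes (w ≟F r)) es w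
    reached s = go (inj₁ (isYes⁺ (r ≟F r) refl)) s
      where
      closed = BFS-closed run (λ {a} e → inj₁ (here (isYes⁻ (a ≟F r) e)))
      go : ∀ {x w} → Reached (λ w → isYes (w ≟F r)) es x → Star (λ x y → T x y ≡ true) x w → Reached (λ w → isYes (w ≟F r)) es w
      go rx ε       = rx
      go rx (e ◅ s) = go (closed rx e) s
    toRoot : ∀ w → Star Off w r
    toRoot w = Search-connected flipA search es⊆ (λ { (here refl) → ε })
      (Sum.map (λ e → here (isYes⁻ (w ≟F r) e)) id
        (reached (Walk⇒Star (proj₁ (proj₂ (proj₂ (proj₂ (proj₂ isTree)))) r w refl refl))))

-- Partial colourings and the existence of runs

is-just⁻ : ∀ {E : Set} {c : Maybe E} → is-just c ≡ true → ∃ λ m → c ≡ just m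
is-just⁻ {c = just m} _ = m , refl

is-just⁺ : ∀ {E : Set} {c : Maybe E} {m} → c ≡ just m → is-just c ≡ true
is-just⁺ refl = refl

is-nothing⁻ : ∀ {E : Set} {c : Maybe E} → is-nothing c ≡ true → c ≡ nothing
is-nothing⁻ {c = nothing} _ = refl

is-nothing⁺ : ∀ {E : Set} {c : Maybe E} → c ≡ nothing → is-nothing c ≡ true
is-nothing⁺ refl = refl

just≢nothing : ∀ {E : Set} {c : Maybe E} {m} → c ≡ just m → c ≡ nothing → ⊥
just≢nothing refl ()

-- The fuel bounds undiscovered vertices plus queue length: a step moves vertices from the former to
-- the latter and dequeues one.
BFSRun-exists : ∀ {n} (T : Graph n) fuel q D → count (not ∘ D) + length q ≤ fuel → ∃ (BFSRun T q D)
BFSRun-exists T fuel []      D _ = _ , done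
BFSRun-exists T zero (v ∷ q) D le = case trans (sym (+-suc (count (not ∘ D)) (length q))) (n≤0⇒n≡0 le) of λ ()
BFSRun-exists {n} T (suc fuel) (v ∷ q) D le with BFSRun-exists T fuel (q ++ ns) D' decrease
  where
  ns = filterᵇ (λ w → T v w ∧ not (D w)) (allFin n)
  D' = λ w → D w ∨ T v w
  undiscovered' = elements (not ∘ D')
  shrink : count (not ∘ D') + length ns ≤ count (not ∘ D)
  shrink = subst (_≤ count (not ∘ D)) (length-++ undiscovered')
    (Unique-⊆⇒length≤
      (Uₚ.++⁺ (elements-unique (not ∘ D')) (elements-unique (λ w → T v w ∧ not (D w))) disjoint)
      λ x∈ → [ inUndiscovered , (λ x∈ns → ∈-elements⁺ (not ∘ D) (proj₂ (∧-true (∈-elements⁻ (λ w → T v w ∧ not (D w)) x∈ns)))) ]′ (∈-++⁻ undiscovered' x∈))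
    where
    inUndiscovered : ∀ {x} → x ∈ undiscovered' → x ∈ elements (not ∘ D)
    inUndiscovered {x} x∈ with D x in eq | ∈-elements⁻ (not ∘ D') x∈
    ... | false | _ = ∈-elements⁺ (not ∘ D) (cong not eq)
    disjoint : ∀ {x} → ¬ (x ∈ undiscovered' × x ∈ ns)
    disjoint {x} (x∈ , x∈ns) with D x | T v x | ∈-elements⁻ (not ∘ D') x∈ | ∈-elements⁻ (λ w → T v w ∧ not (D w)) x∈ns
    ... | false | true  | () | _
    ... | false | false | _  | ()
  decrease : count (not ∘ D') + length (q ++ ns) ≤ fuel
  decrease = s≤s⁻¹ (begin
    suc (count (not ∘ D') + length (q ++ ns))        ≡⟨ cong (λ l → suc (count (not ∘ D') + l)) (length-++ q) ⟩
    suc (count (not ∘ D') + (length q + length ns))  ≡⟨ cong (λ l → suc (count (not ∘ D') + l)) (+-comm (length q) _) ⟩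
    suc (count (not ∘ D') + (length ns + length q))  ≡⟨ cong suc (+-assoc (count (not ∘ D')) _ _) ⟨
    suc (count (not ∘ D') + length ns + length q)    ≤⟨ s≤s (+-monoˡ-≤ (length q) shrink) ⟩
    suc (count (not ∘ D) + length q)                 ≡⟨ +-suc _ (length q) ⟨
    count (not ∘ D) + suc (length q)                 ≤⟨ le ⟩
    suc fuel                                         ∎)
    where open ≤-Reasoning
... | es , run = _ , step ↭-refl run

leastGap : ∀ {P : ℕ → Set} → (∀ m → Dec (P m)) → ∀ b → ¬ P b → 1 ≤ b →
           ∃ λ m → 1 ≤ m × ¬ P m × (∀ j → 1 ≤ j → j < m → P j)
leastGap {P} P? b ¬Pb 1≤b = go 1 b (m≤n+m b 1) (s≤s z≤n) λ j 1≤j j<1 → ⊥-elim (<⇒≱ j<1 1≤j)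
  where
  go : ∀ m fuel → b ≤ m + fuel → 1 ≤ m → (∀ j → 1 ≤ j → j < m → P j) →
       ∃ λ m → 1 ≤ m × ¬ P m × (∀ j → 1 ≤ j → j < m → P j)
  go m fuel le 1≤m below with P? m
  ... | no ¬Pm = m , 1≤m , ¬Pm , below
  go m zero le 1≤m below | yes Pm = case m≤n⇒m<n∨m≡n (subst (b ≤_) (+-identityʳ m) le) of λ where
    (inj₁ b<m)  → ⊥-elim (¬Pb (below b 1≤b b<m))
    (inj₂ refl) → ⊥-elim (¬Pb Pm)
  go m (suc fuel) le 1≤m below | yes Pm = go (suc m) fuel (subst (b ≤_) (+-suc m fuel) le) (s≤s z≤n)
    λ j 1≤j j<1+m → case m≤n⇒m<n∨m≡n (s≤s⁻¹ j<1+m) of λ where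
      (inj₁ j<m)  → below j 1≤j j<m
      (inj₂ refl) → Pm

greatest : ∀ {P : ℕ → Set} → (∀ m → Dec (P m)) → P 0 → ∀ b → (∀ m → P m → m ≤ b) →
           ∃ λ m → P m × (∀ j → P j → j ≤ m)
greatest P? P0 zero    bound = 0 , P0 , bound
greatest P? P0 (suc b) bound with P? (suc b)
... | yes Pb = suc b , Pb , bound
... | no ¬Pb = greatest P? P0 b λ m Pm → case m≤n⇒m<n∨m≡n (bound m Pm) of λ where
  (inj₁ m<1+b) → s≤s⁻¹ m<1+b
  (inj₂ refl)  → ⊥-elim (¬Pb Pm)

-- Fixing the length makes the search finite; `greatest` then finds the largest size of a matching.
listOfLength? : ∀ {k} l {P : List (Fin k × Fin k) → Set} → (∀ M → Dec (P M)) → Dec (∃ λ M → length M ≡ l × P M)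
listOfLength? zero P? = map′ (λ p → [] , refl , p) (λ { ([] , _ , p) → p }) (P? [])
listOfLength? (suc l) P? = map′
  (λ { (a , b , M , e , p) → (a , b) ∷ M , cong suc e , p })
  (λ { ((a , b) ∷ M , e , p) → a , b , M , suc-injective e , p })
  (any? λ a → any? λ b → listOfLength? l λ M → P? ((a , b) ∷ M))

upd-cases : ∀ {k} (c : PCol k) R m X → (X ≡ R × upd c R m X ≡ just m) ⊎ (X ≢ R × upd c R m X ≡ c X)
upd-cases c R m X with X ≟F R
... | yes e = inj₁ (e , refl)
... | no ne = inj₂ (ne , refl)

module Decisions {n k : ℕ} (T : Graph n) (ℛ : Fin k → DiGraph n) where
  open Greedy T ℛ
  open Pairs T ℛ

  collide? : ∀ X Y → Dec (Collide ℛ X Y)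
  collide? X Y = any? λ a → any? λ b → (A (ℛ X) a b Bool.≟ true) ×-dec (A (ℛ Y) a b Bool.≟ true)

  collide-sym : ∀ {X Y} → Collide ℛ X Y → Collide ℛ Y X
  collide-sym (a , b , p , q) = a , b , q , p

  used? : ∀ c {S : Fin k → Set} → (∀ X → Dec (S X)) → ∀ m → Dec (Used c S m)
  used? c S? m = any? λ Y → Maybe-≡-dec _≟_ (c Y) (just m) ×-dec any? λ X → S? X ×-dec collide? X Y

  pair∈? : ∀ (e : Fin k × Fin k) M → Dec (e ∈ M)
  pair∈? = MembershipDec._∈?_ (≡-dec _≟F_ _≟F_)

  matched? : ∀ M R S → Dec (Matched M R S)
  matched? M R S = pair∈? (R , S) M ⊎-dec pair∈? (S , R) M

  coEdge? : ∀ c Vp Vq R S → Dec (CoEdge c Vp Vq R S)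
  coEdge? c Vp Vq R S = ((Vp R ∨ Vq R) Bool.≟ true) ×-dec ((Vp S ∨ Vq S) Bool.≟ true) ×-dec ¬? (R ≟F S) ×-dec
    ¬? (collide? R S ⊎-dec
        ((Vp R Bool.≟ true) ×-dec (Vp S Bool.≟ true) ×-dec ¬? (Maybe-≡-dec _≟_ (c R) (c S))) ⊎-dec
        cross? R S ⊎-dec cross? S R)
    where
    cross? : ∀ R S → Dec (Cross c Vp Vq R S)
    cross? R S = (Vq R Bool.≟ true) ×-dec (Vp S Bool.≟ true) ×-dec
      any? λ U → Maybe-≡-dec _≟_ (c U) (c S) ×-dec collide? U R

  samePair : ∀ {M X e e'} → Unique (endpoints M) → e ∈ M → e' ∈ M → Meets X e → Meets X e' → e ≡ e'
  samePair _ (here refl) (here refl) _ _ = refl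
  samePair ((a∉ ∷ b∉ ∷ _)) (here refl) (there e'∈) m m' = ⊥-elim (apart a∉ b∉ m (∈-endpoints⁺ e'∈ m'))
    where
    apart : ∀ {a b xs X} → All (a ≢_) (b ∷ xs) → All (b ≢_) xs → Meets X (a , b) → X ∈ xs → ⊥
    apart (_ ∷ a∉) _  (inj₁ refl) X∈ = All.lookup a∉ X∈ refl
    apart _        b∉ (inj₂ refl) X∈ = All.lookup b∉ X∈ refl
  samePair u@(_ ∷ _ ∷ _) (there e∈) (here refl) m m' = sym (samePair u (here refl) (there e∈) m' m)
  samePair (_ ∷ _ ∷ u) (there e∈) (there e'∈) m m' = samePair u e∈ e'∈ m m'

  matched-functional : ∀ {M} → Unique (endpoints M) → ∀ {R S S'} → Matched M R S → Matched M R S' → S ≡ S'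
  matched-functional u (inj₁ p) (inj₁ q) with samePair u p q (inj₁ refl) (inj₁ refl)
  ... | refl = refl
  matched-functional u (inj₁ p) (inj₂ q) with samePair u p q (inj₁ refl) (inj₂ refl)
  ... | refl = refl
  matched-functional u (inj₂ p) (inj₁ q) with samePair u p q (inj₂ refl) (inj₁ refl)
  ... | refl = refl
  matched-functional u (inj₂ p) (inj₂ q) with samePair u p q (inj₂ refl) (inj₂ refl)
  ... | refl = refl

module Existence {n k : ℕ} (T : Graph n) (ℛ : Fin k → DiGraph n) where
  open Greedy T ℛ
  open Pairs T ℛ
  open Decisions T ℛ

  smallestFree-exists : ∀ c {S : Fin k → Set} → (∀ X → Dec (S X)) → ∃ (SmallestFree c S)
  smallestFree-exists c {S} S? = leastGap (used? c S?) (suc N) unused (s≤s z≤n)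
    where
    -- Each colour in use is at most this sum, so the next number is free.
    N = ∑ (fromMaybe 0 ∘ c) (allFin k)
    unused : ¬ Used c S (suc N)
    unused (Y , cY , _) = 1+n≰n (subst (λ t → fromMaybe 0 t ≤ N) cY (term≤∑ (fromMaybe 0 ∘ c) (∈-allFin Y)))

  uncolored : (Fin k → Bool) → PCol k → Fin k → Bool
  uncolored Vq c X = Vq X ∧ is-nothing (c X)

  upd-uncolored : ∀ (c : PCol k) R m X → upd c R m X ≡ nothing → X ≢ R × c X ≡ nothing
  upd-uncolored c R m X e with upd-cases c R m X
  ... | inj₁ (_ , i)  = ⊥-elim (just≢nothing i e)
  ... | inj₂ (ne , i) = ne , trans (sym i) e

  uncolored-decreases : ∀ Vq (c d : PCol k) R {fuel} → Vq R ≡ true → c R ≡ nothing →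
    (∀ X → d X ≡ nothing → X ≢ R × c X ≡ nothing) →
    count (uncolored Vq c) ≤ suc fuel → count (uncolored Vq d) ≤ fuel
  uncolored-decreases Vq c d R VR R∅ drop le = s≤s⁻¹ (≤-trans (Unique-⊆⇒length≤
    (All.tabulate (λ X∈ e → proj₁ (drop _ (proj₂ (inspect∈ X∈))) (sym e)) ∷ elements-unique (uncolored Vq d))
    λ { (here refl) → ∈-elements⁺ (uncolored Vq c) (cong₂ _∧_ VR (is-nothing⁺ R∅))
      ; (there X∈) → let VX , X∅ = inspect∈ X∈
                     in ∈-elements⁺ (uncolored Vq c) (cong₂ _∧_ VX (is-nothing⁺ (proj₂ (drop _ X∅)))) }) le)
    where
    inspect∈ : ∀ {X} → X ∈ elements (uncolored Vq d) → Vq X ≡ true × d X ≡ nothing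
    inspect∈ X∈ = let VX , X∅ = ∧-true (∈-elements⁻ (uncolored Vq d) X∈) in VX , is-nothing⁻ X∅

  Loop-exists′ : ∀ Vq M fuel c → count (uncolored Vq c) ≤ fuel → ∃ (Loop Vq M c)
  Loop-exists′ Vq M fuel c le with any? (λ X → (Vq X Bool.≟ true) ×-dec (is-nothing (c X) Bool.≟ true))
  ... | no none = c , stop λ R VR → colored R VR
    where
    colored : ∀ R → Vq R ≡ true → ∃ λ m → c R ≡ just m
    colored R VR with c R in eq
    ... | just m  = m , refl
    ... | nothing = ⊥-elim (none (R , VR , is-nothing⁺ eq))
  Loop-exists′ Vq M zero c le | yes (R , VR , R∅) = ⊥-elim (<⇒≱ (Unique-⊆⇒length≤ {xs = R ∷ []} ([] ∷ [])
    λ { (here refl) → ∈-elements⁺ (uncolored Vq c) (cong₂ _∧_ VR R∅) }) le)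
  Loop-exists′ Vq M (suc fuel) c le | yes (R , VR , R∅) with any? (matched? M R)
  ... | yes (S , RS) =
    let m , free = smallestFree-exists c (λ X → (X ≟F R) ⊎-dec (X ≟F S))
        c' , loop = Loop-exists′ Vq M fuel _ (uncolored-decreases Vq c _ R VR (is-nothing⁻ R∅)
          (λ X e → upd-uncolored c R m X (proj₂ (upd-uncolored (upd c R m) S m X e))) le)
    in c' , pair VR (is-nothing⁻ R∅) RS free loop
  ... | no none =
    let m , free = smallestFree-exists c (λ X → X ≟F R)
        c' , loop = Loop-exists′ Vq M fuel _ (uncolored-decreases Vq c _ R VR (is-nothing⁻ R∅) (upd-uncolored c R m) le)
    in c' , single VR (is-nothing⁻ R∅) none free loop

  Loop-exists : ∀ Vq M c → ∃ (Loop Vq M c)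
  Loop-exists Vq M c = Loop-exists′ Vq M _ c ≤-refl

  maxMatching-exists : ∀ c Vp Vq → ∃ (IsMaxMatching c Vp Vq)
  maxMatching-exists c Vp Vq
    with l , (M , refl , isM) , max ← greatest
           (λ l → listOfLength? l λ M → All.all? (λ e → coEdge? c Vp Vq (proj₁ e) (proj₂ e)) M ×-dec UniqueDec.unique? _≟F_ (endpoints M))
           ([] , refl , [] , []) k
           (λ { _ (M , refl , _ , u) → ≤-trans (m≤m+n (length M) (length M)) (subst₂ _≤_ (length-endpoints M) (length-tabulate id) (Unique-⊆⇒length≤ u λ {x} _ → ∈-allFin x)) })
    = M , isM , λ M' isM' → max _ (M' , refl , isM')

  Assign-exists : ∀ {M} Vp Vq c → Unique (endpoints M) → ∃ (Assign M Vp Vq c)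
  Assign-exists {M} Vp Vq c u = c1 , λ R → assigned R , kept R
    where
    mate? : ∀ R → Dec (∃ λ S → Vp S ≡ true × Matched M R S)
    mate? R = any? λ S → (Vp S Bool.≟ true) ×-dec matched? M R S
    c1 : PCol k
    c1 R with Vq R | mate? R
    ... | true  | yes (S , _) = c S
    ... | true  | no _        = c R
    ... | false | _           = c R
    assigned : ∀ R → Vq R ≡ true → ∀ S → Vp S ≡ true → Matched M R S → c1 R ≡ c S
    assigned R VR S VS RS with Vq R | mate? R
    ... | true | yes (S' , _ , RS') = cong c (matched-functional u RS' RS)
    ... | true | no none            = ⊥-elim (none (S , VS , RS))
    kept : ∀ R → (Vq R ≡ false ⊎ ¬ (∃ λ S → Vp S ≡ true × Matched M R S)) → c1 R ≡ c R
    kept R p with Vq R | mate? R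
    kept R (inj₂ none) | true  | yes m = ⊥-elim (none m)
    kept R _           | true  | no _  = refl
    kept R _           | false | _     = refl

  ProcessEdge-exists : ∀ Vp Vq Qall c → ∃ (ProcessEdge Vp Vq Qall c)
  ProcessEdge-exists Vp Vq Qall c =
    let M , isMax = maxMatching-exists c Vp Vq
        c1 , asg  = Assign-exists Vp Vq c (proj₂ (proj₁ isMax))
        c2 , l₁   = Loop-exists Vq M c1
        c' , l₂   = Loop-exists Qall [] c2
    in c' , M , isMax , c1 , asg , c2 , l₁ , l₂

  type4? : ∀ pre u post → Dec (∃ λ x → Type4 pre u post x)
  type4? pre u post = any? λ x → (deg T u ≟ 3) ×-dec
    Any.any? (λ e → (proj₁ e ≟F u) ⊎-dec (proj₂ e ≟F u)) pre ×-dec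
    (edge∈? (u , x) post ⊎-dec edge∈? (x , u) post)
    where
    edge∈? : ∀ (e : Fin n × Fin n) es → Dec (e ∈ es)
    edge∈? = MembershipDec._∈?_ (≡-dec _≟F_ _≟F_)

  StepE-exists : ∀ pre u v post c → ∃ (StepE pre u v post c)
  StepE-exists pre u v post c with type4? pre u post
  ... | no none = let c' , l = Loop-exists (Qset c u v) [] c in c' , notType4 none l
  ... | yes (x , t4) =
    let c1 , p1 = ProcessEdge-exists _ _ _ c
        c2 , p2 = ProcessEdge-exists _ _ _ c
    in _ , type4 t4 p1 p2

  Run-exists : ∀ pre es c → ∃ (Run pre es c)
  Run-exists pre [] c = c , end
  Run-exists pre ((u , v) ∷ post) c =
    let c' , s = StepE-exists pre u v post c
        c'' , r = Run-exists (pre ++ [ (u , v) ]) post c'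
    in c'' , next s r

  GreedyCol-exists : Fin n → ∃ GreedyCol
  GreedyCol-exists r with BFSRun-exists T _ (r ∷ []) (λ w → isYes (w ≟F r)) ≤-refl
  ... | es , bfs with Run-exists [] es (λ _ → nothing)
  ...   | c , run with Loop-exists (λ _ → true) [] c
  ...     | c' , loop = ψ , r , es , bfs , c , run , c' , loop , λ X → proj₂ (total loop X)
    where
    total : ∀ {d d'} → Loop (λ _ → true) [] d d' → ∀ X → ∃ λ m → d' X ≡ just m
    total (stop all)         X = all X refl
    total (pair _ _ _ _ l)   X = total l X
    total (single _ _ _ _ l) X = total l X
    ψ : Fin k → ℕ
    ψ X = proj₁ (total loop X)

-- What the colouring loops guarantee

module Coloring {n k : ℕ} (T : Graph n) (ℛ : Fin k → DiGraph n) where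
  open Greedy T ℛ
  open Pairs T ℛ
  open Decisions T ℛ

  Proper : PCol k → Set
  Proper c = ∀ {X Y m} → X ≢ Y → Collide ℛ X Y → c X ≡ just m → c Y ≢ just m

  Positive : PCol k → Set
  Positive c = ∀ {X m} → c X ≡ just m → 1 ≤ m

  Extends : PCol k → PCol k → Set
  Extends c c' = ∀ {X m} → c X ≡ just m → c' X ≡ just m

  colored? : ∀ (c : PCol k) X → (∃ λ m → c X ≡ just m) ⊎ c X ≡ nothing
  colored? c X with c X
  ... | just m  = inj₁ (m , refl)
  ... | nothing = inj₂ refl

  -- The two directions of an edge are two pigeonholes.
  three-collide : ∀ {a b X Y Z} → has X a b ≡ true → has Y a b ≡ true → has Z a b ≡ true →
    Collide ℛ X Y ⊎ Collide ℛ X Z ⊎ Collide ℛ Y Z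
  three-collide {a} {b} {X} {Y} {Z} hX hY hZ with ∨-true {A (ℛ X) a b} hX | ∨-true {A (ℛ Y) a b} hY | ∨-true {A (ℛ Z) a b} hZ
  ... | inj₁ x | inj₁ y | _      = inj₁ (a , b , x , y)
  ... | inj₂ x | inj₂ y | _      = inj₁ (b , a , x , y)
  ... | inj₁ x | inj₂ y | inj₁ z = inj₂ (inj₁ (a , b , x , z))
  ... | inj₁ x | inj₂ y | inj₂ z = inj₂ (inj₂ (b , a , y , z))
  ... | inj₂ x | inj₁ y | inj₁ z = inj₂ (inj₂ (a , b , y , z))
  ... | inj₂ x | inj₁ y | inj₂ z = inj₂ (inj₁ (b , a , x , z))

  -- Ensures that colouring a pair jointly never overwrites a colour of the partner.
  Closed : (Fin k → Bool) → List (Fin k × Fin k) → PCol k → Set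
  Closed Vq M c = ∀ {R S} → Matched M R S → Vq R ≡ true → c R ≡ nothing → Vq S ≡ true × c S ≡ nothing

  -- `below` refers to the final colouring and to some `Z` uncoloured at the start, so that it
  -- composes over iterations. The colliders `Y` are what gets counted later; `Z` limits where they
  -- can lie.
  record LoopResult (Vq : Fin k → Bool) (M : List (Fin k × Fin k)) (c c' : PCol k) : Set where
    field
      ext    : Extends c c'
      new∈   : ∀ {X m} → c X ≡ nothing → c' X ≡ just m → Vq X ≡ true
      total  : ∀ {X} → Vq X ≡ true → ∃ λ m → c' X ≡ just m
      proper : Proper c'
      pos    : Positive c'
      below  : ∀ {X m} → c X ≡ nothing → c' X ≡ just m → ∀ j → 1 ≤ j → j < m →
               ∃ λ Z → ∃ λ Y → (Vq Z ≡ true × c Z ≡ nothing) × Collide ℛ Z Y × c' Y ≡ just j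
      mates  : ∀ {R S} → Matched M R S → Vq R ≡ true → c R ≡ nothing → c' R ≡ c' S

  module _ (Vq : Fin k → Bool) (M : List (Fin k × Fin k))
    (functional : ∀ {R S S'} → Matched M R S → Matched M R S' → S ≡ S')
    (independent : ∀ {R S} → Matched M R S → ¬ Collide ℛ R S) where

    -- One iteration of the loop, for a pair and a single member alike: an independent set closed
    -- under mates receives its smallest free colour.
    record ColorsGroup (G : Fin k → Set) (m : ℕ) (c d : PCol k) : Set where
      field
        G?     : ∀ X → Dec (G X)
        hit    : ∀ {X} → G X → Vq X ≡ true × c X ≡ nothing × d X ≡ just m
        miss   : ∀ {X} → ¬ G X → d X ≡ c X
        indep  : ∀ {X Y} → G X → G Y → X ≢ Y → ¬ Collide ℛ X Y
        mate   : ∀ {X Y} → Matched M X Y → G X → G Y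
        free   : SmallestFree c G m

    module _ {G : Fin k → Set} {m₀ : ℕ} {c d : PCol k} (g : ColorsGroup G m₀ c d) where
      open ColorsGroup g

      colored∉G : ∀ {X m} → c X ≡ just m → ¬ G X
      colored∉G cX GX = just≢nothing cX (proj₁ (proj₂ (hit GX)))

      uncolored∉G : ∀ {X} → d X ≡ nothing → ¬ G X
      uncolored∉G dX GX = just≢nothing (proj₂ (proj₂ (hit GX))) dX

      group-proper : Proper c → Proper d
      group-proper val {X} {Y} ne col dX dY with G? X | G? Y
      ... | yes GX | yes GY = indep GX GY ne col
      ... | no ¬GX | no ¬GY = val ne col (trans (sym (miss ¬GX)) dX) (trans (sym (miss ¬GY)) dY)
      ... | yes GX | no ¬GY with just-injective (trans (sym (proj₂ (proj₂ (hit GX)))) dX)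
      ...   | refl = proj₁ (proj₂ free) (Y , trans (sym (miss ¬GY)) dY , X , GX , col)
      group-proper val {X} {Y} ne col dX dY | no ¬GX | yes GY with just-injective (trans (sym (proj₂ (proj₂ (hit GY)))) dY)
      ...   | refl = proj₁ (proj₂ free) (X , trans (sym (miss ¬GX)) dX , Y , GY , collide-sym col)

      group-pos : Positive c → Positive d
      group-pos pos {X} dX with G? X
      ... | no ¬GX = pos (trans (sym (miss ¬GX)) dX)
      ... | yes GX with just-injective (trans (sym (proj₂ (proj₂ (hit GX)))) dX)
      ...   | refl = proj₁ free

      group-closed : Closed Vq M c → Closed Vq M d
      group-closed cl {R} {S} RS VR dR =
        let ¬GR = uncolored∉G dR
            VS , cS = cl RS VR (trans (sym (miss ¬GR)) dR)
        in VS , trans (miss (λ GS → ¬GR (mate (Sum.swap RS) GS))) cS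

      group-then : ∀ {c'} → LoopResult Vq M d c' → LoopResult Vq M c c'
      group-then {c'} r = record
        { ext    = ext'
        ; new∈   = new∈'
        ; total  = total
        ; proper = proper
        ; pos    = pos
        ; below  = below'
        ; mates  = mates'
        }
        where
        open LoopResult r
        ext' : Extends c c'
        ext' cX = ext (trans (miss (colored∉G cX)) cX)
        new∈' : ∀ {X m} → c X ≡ nothing → c' X ≡ just m → Vq X ≡ true
        new∈' {X} cX c'X with G? X
        ... | yes GX = proj₁ (hit GX)
        ... | no ¬GX = new∈ (trans (miss ¬GX) cX) c'X
        below' : ∀ {X m} → c X ≡ nothing → c' X ≡ just m → ∀ j → 1 ≤ j → j < m →
                 ∃ λ Z → ∃ λ Y → (Vq Z ≡ true × c Z ≡ nothing) × Collide ℛ Z Y × c' Y ≡ just j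
        below' {X} cX c'X j 1≤j j<m with G? X
        ... | yes GX with just-injective (trans (sym (ext (proj₂ (proj₂ (hit GX))))) c'X)
        ...   | refl = let Y , cY , Z , GZ , col = proj₂ (proj₂ free) j 1≤j j<m
                           VZ , cZ , _ = hit GZ
                       in Z , Y , (VZ , cZ) , col , ext' cY
        below' {X} cX c'X j 1≤j j<m | no ¬GX =
          let Z , Y , (VZ , dZ) , col , c'Y = below (trans (miss ¬GX) cX) c'X j 1≤j j<m
          in Z , Y , (VZ , trans (sym (miss (uncolored∉G dZ))) dZ) , col , c'Y
        mates' : ∀ {R S} → Matched M R S → Vq R ≡ true → c R ≡ nothing → c' R ≡ c' S
        mates' {R} RS VR cR with G? R
        ... | yes GR = trans (ext (proj₂ (proj₂ (hit GR)))) (sym (ext (proj₂ (proj₂ (hit (mate RS GR))))))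
        ... | no ¬GR = mates RS VR (trans (miss ¬GR) cR)

    pairGroup : ∀ {c R S m} → Closed Vq M c → Vq R ≡ true → c R ≡ nothing → Matched M R S →
      SmallestFree c (λ X → (X ≡ R) ⊎ (X ≡ S)) m →
      ColorsGroup (λ X → (X ≡ R) ⊎ (X ≡ S)) m c (upd (upd c R m) S m)
    pairGroup {c} {R} {S} {m} cl VR cR RS free = record
      { G?    = λ X → (X ≟F R) ⊎-dec (X ≟F S)
      ; hit   = λ { (inj₁ refl) → VR , cR , hitR ; (inj₂ refl) → proj₁ (cl RS VR cR) , proj₂ (cl RS VR cR) , hitS }
      ; miss  = miss
      ; indep = λ { (inj₁ refl) (inj₁ refl) ne → ⊥-elim (ne refl)
                  ; (inj₂ refl) (inj₂ refl) ne → ⊥-elim (ne refl)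
                  ; (inj₁ refl) (inj₂ refl) ne → independent RS
                  ; (inj₂ refl) (inj₁ refl) ne → independent (Sum.swap RS) }
      ; mate  = λ { XY (inj₁ refl) → inj₂ (functional XY RS) ; XY (inj₂ refl) → inj₁ (functional XY (Sum.swap RS)) }
      ; free  = free
      }
      where
      hitS : upd (upd c R m) S m S ≡ just m
      hitS with upd-cases (upd c R m) S m S
      ... | inj₁ (_ , e)  = e
      ... | inj₂ (ne , _) = ⊥-elim (ne refl)
      hitR : upd (upd c R m) S m R ≡ just m
      hitR with upd-cases (upd c R m) S m R | upd-cases c R m R
      ... | inj₁ (_ , e) | _             = e
      ... | inj₂ (_ , e) | inj₁ (_ , f)  = trans e f
      ... | inj₂ _       | inj₂ (ne , _) = ⊥-elim (ne refl)
      miss : ∀ {X} → ¬ ((X ≡ R) ⊎ (X ≡ S)) → upd (upd c R m) S m X ≡ c X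
      miss {X} ∉G with upd-cases (upd c R m) S m X | upd-cases c R m X
      ... | inj₁ (e , _) | _            = ⊥-elim (∉G (inj₂ e))
      ... | inj₂ _       | inj₁ (e , _) = ⊥-elim (∉G (inj₁ e))
      ... | inj₂ (_ , e) | inj₂ (_ , f) = trans e f

    singleGroup : ∀ {c R m} → Vq R ≡ true → c R ≡ nothing → ¬ (∃ λ S → Matched M R S) →
      SmallestFree c (λ X → X ≡ R) m → ColorsGroup (λ X → X ≡ R) m c (upd c R m)
    singleGroup {c} {R} {m} VR cR none free = record
      { G?    = λ X → X ≟F R
      ; hit   = λ { refl → VR , cR , hitR }
      ; miss  = miss
      ; indep = λ { refl refl ne → ⊥-elim (ne refl) }
      ; mate  = λ { XY refl → ⊥-elim (none (_ , XY)) }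
      ; free  = free
      }
      where
      hitR : upd c R m R ≡ just m
      hitR with upd-cases c R m R
      ... | inj₁ (_ , e)  = e
      ... | inj₂ (ne , _) = ⊥-elim (ne refl)
      miss : ∀ {X} → X ≢ R → upd c R m X ≡ c X
      miss {X} ne with upd-cases c R m X
      ... | inj₁ (e , _) = ⊥-elim (ne e)
      ... | inj₂ (_ , e) = e

    loopResult : ∀ {c c'} → Loop Vq M c c' → Proper c → Positive c → Closed Vq M c → LoopResult Vq M c c'
    loopResult (stop all) val pos cl = record
      { ext = id ; new∈ = λ cX c'X → ⊥-elim (just≢nothing c'X cX) ; total = λ {X} → all X
      ; proper = val ; pos = pos ; below = λ cX c'X → ⊥-elim (just≢nothing c'X cX)
      ; mates = λ {R} _ VR cR → ⊥-elim (just≢nothing (proj₂ (all R VR)) cR) }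
    loopResult (pair VR cR RS free l) val pos cl =
      let g = pairGroup cl VR cR RS free
      in group-then g (loopResult l (group-proper g val) (λ {X} → group-pos g pos {X}) (group-closed g cl))
    loopResult (single VR cR none free l) val pos cl =
      let g = singleGroup VR cR none free
      in group-then g (loopResult l (group-proper g val) (group-pos g pos) (group-closed g cl))

  firstFitResult : ∀ {Vq c c'} → Loop Vq [] c c' → Proper c → Positive c → LoopResult Vq [] c c'
  firstFitResult {Vq} l val pos = loopResult Vq [] (λ { (inj₁ ()) ; (inj₂ ()) }) (λ { (inj₁ ()) ; (inj₂ ()) }) l val pos
    (λ { (inj₁ ()) ; (inj₂ ()) })

  -- `c₂` is the colouring after the loop over `Vq`. `origin` sorts the new colours by stage: copied
  -- from a coloured mate, given in that loop, or given in the final first-fit. In the last case `Z`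
  -- lies outside `Vq`, which is finished by then.
  record ProcessResult (Vp Vq Qall : Fin k → Bool) (c c' : PCol k) : Set where
    field
      M      : List (Fin k × Fin k)
      isMax  : IsMaxMatching c Vp Vq M
      c₂     : PCol k
      ext₂   : Extends c c₂
      ext    : Extends c₂ c'
      new∈₂  : ∀ {X m} → c X ≡ nothing → c₂ X ≡ just m → Vq X ≡ true
      new∈   : ∀ {X m} → c X ≡ nothing → c' X ≡ just m → Qall X ≡ true
      total  : ∀ {X} → Qall X ≡ true → ∃ λ m → c' X ≡ just m
      proper : Proper c'
      pos    : Positive c'
      mates  : ∀ {R S} → (R , S) ∈ M → c₂ R ≡ c₂ S
      origin : ∀ {X m} → c X ≡ nothing → c' X ≡ just m →
        (∃ λ Y → c Y ≡ just m)
        ⊎ (Vq X ≡ true × c₂ X ≡ just m × ∀ j → 1 ≤ j → j < m →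
             ∃ λ Z → ∃ λ Y → Vq Z ≡ true × Collide ℛ Z Y × c₂ Y ≡ just j)
        ⊎ (∀ j → 1 ≤ j → j < m →
             ∃ λ Z → ∃ λ Y → (Qall Z ≡ true × Vq Z ≡ false) × Collide ℛ Z Y × c' Y ≡ just j)

  coEdge-sym : ∀ {c Vp Vq R S} → CoEdge c Vp Vq R S → CoEdge c Vp Vq S R
  coEdge-sym (vR , vS , ne , ¬b) = vS , vR , ne ∘ sym , λ where
    (inj₁ col)                        → ¬b (inj₁ (collide-sym col))
    (inj₂ (inj₁ (pS , pR , c≢)))      → ¬b (inj₂ (inj₁ (pR , pS , c≢ ∘ sym)))
    (inj₂ (inj₂ (inj₁ cr)))           → ¬b (inj₂ (inj₂ (inj₂ cr)))
    (inj₂ (inj₂ (inj₂ cr)))           → ¬b (inj₂ (inj₂ (inj₁ cr)))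

  processResult : ∀ {Vp Vq Qall c c' a b} →
    (∀ {X} → Vp X ≡ true → (∃ λ m → c X ≡ just m) × has X a b ≡ true) →
    (∀ {X} → Vq X ≡ true → c X ≡ nothing × has X a b ≡ true) →
    (∀ {X} → Vq X ≡ true → Qall X ≡ true) →
    Proper c → Positive c → ProcessEdge Vp Vq Qall c c' → ProcessResult Vp Vq Qall c c'
  processResult {Vp} {Vq} {Qall} {c} {c'} {a} {b} hp hq Vq⊆ val pos (M , isMax , c₁ , asg , c₂ , l₁ , l₂) = record
    { M = M ; isMax = isMax ; c₂ = c₂
    ; ext₂ = L₁.ext ∘ ext₁
    ; ext = L₂.ext
    ; new∈₂ = new∈₂
    ; new∈ = new∈
    ; total = L₂.total
    ; proper = L₂.proper
    ; pos = L₂.pos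
    ; mates = mates
    ; origin = origin
    }
    where
    uniq = proj₂ (proj₁ isMax)
    functional : ∀ {R S S'} → Matched M R S → Matched M R S' → S ≡ S'
    functional = matched-functional uniq
    coEdge : ∀ {R S} → Matched M R S → CoEdge c Vp Vq R S
    coEdge (inj₁ RS∈) = All.lookup (proj₁ (proj₁ isMax)) RS∈
    coEdge (inj₂ SR∈) = coEdge-sym (All.lookup (proj₁ (proj₁ isMax)) SR∈)
    ¬bEdge : ∀ {R S} → Matched M R S → ¬ BEdge c Vp Vq R S
    ¬bEdge RS = proj₂ (proj₂ (proj₂ (coEdge RS)))

    noMate : ∀ {R S} → Matched M R S → Vq S ≡ true → ¬ (∃ λ S' → Vp S' ≡ true × Matched M R S')
    noMate RS VS (S' , VS' , RS') with functional RS RS'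
    ... | refl = just≢nothing (proj₂ (proj₁ (hp VS'))) (proj₁ (hq VS))

    view₁ : ∀ {X m} → c₁ X ≡ just m → c X ≡ just m ⊎
            (Vq X ≡ true × ∃ λ S → Vp S ≡ true × Matched M X S × c S ≡ just m)
    view₁ {X} c₁X with Vq X in VX | any? (λ S → (Vp S Bool.≟ true) ×-dec matched? M X S)
    ... | false | _                = inj₁ (trans (sym (proj₂ (asg X) (inj₁ VX))) c₁X)
    ... | true  | no none          = inj₁ (trans (sym (proj₂ (asg X) (inj₂ none))) c₁X)
    ... | true  | yes (S , VS , m) = inj₂ (refl , S , VS , m , trans (sym (proj₁ (asg X) VX S VS m)) c₁X)

    ext₁ : Extends c c₁
    ext₁ {X} cX = trans (proj₂ (asg X) (inj₁ (¬true⇒false λ VX → just≢nothing cX (proj₁ (hq VX))))) cX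

    proper₁ : Proper c₁
    proper₁ {X} {Y} ne col c₁X c₁Y with view₁ c₁X | view₁ c₁Y
    ... | inj₁ cX | inj₁ cY = val ne col cX cY
    -- A copied colour against an old one: the collider `Y` would be the witness of a `Cross` edge
    -- between `X` and its mate.
    ... | inj₂ (VX , S , VS , XS , cS) | inj₁ cY =
      ¬bEdge XS (inj₂ (inj₂ (inj₁ (VX , VS , Y , trans cY (sym cS) , collide-sym col))))
    ... | inj₁ cX | inj₂ (VY , S , VS , YS , cS) =
      ¬bEdge YS (inj₂ (inj₂ (inj₁ (VY , VS , X , trans cX (sym cS) , col))))
    -- Two copied colours: `X` and both mates contain the edge `ab`, so two of the three collide.
    -- Each case contradicts the matching edge at `X` or the properness of `c`.
    ... | inj₂ (VX , S , VS , XS , cS) | inj₂ (VY , S' , VS' , YS' , cS')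
      with three-collide {a} {b} (proj₂ (hq VX)) (proj₂ (hp VS)) (proj₂ (hp VS'))
    ...   | inj₁ XcS         = ¬bEdge XS (inj₁ XcS)
    ...   | inj₂ (inj₁ XcS') = ¬bEdge XS (inj₂ (inj₂ (inj₁ (VX , VS , S' , trans cS' (sym cS) , collide-sym XcS'))))
    ...   | inj₂ (inj₂ ScS') = val S≢S' ScS' cS cS'
      where
      S≢S' : S ≢ S'
      S≢S' refl = ne (functional (Sum.swap XS) (Sum.swap YS'))

    pos₁ : Positive c₁
    pos₁ c₁X with view₁ c₁X
    ... | inj₁ cX                     = pos cX
    ... | inj₂ (_ , _ , _ , _ , cS) = pos cS

    closed₁ : Closed Vq M c₁
    closed₁ {R} {S} RS VR c₁R with ∨-true (proj₁ (proj₂ (coEdge RS)))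
    ... | inj₁ VS = ⊥-elim (just≢nothing (trans (proj₁ (asg R) VR S VS RS) (proj₂ (proj₁ (hp VS)))) c₁R)
    ... | inj₂ VS = VS , trans (proj₂ (asg S) (inj₂ (noMate (Sum.swap RS) VR))) (proj₁ (hq VS))

    module L₁ = LoopResult (loopResult Vq M functional (λ RS col → ¬bEdge RS (inj₁ col)) l₁ proper₁ pos₁ closed₁)
    module L₂ = LoopResult (firstFitResult l₂ L₁.proper L₁.pos)

    new∈₂ : ∀ {X m} → c X ≡ nothing → c₂ X ≡ just m → Vq X ≡ true
    new∈₂ {X} cX c₂X with colored? c₁ X
    ... | inj₂ c₁X = L₁.new∈ c₁X c₂X
    ... | inj₁ (_ , c₁X) with view₁ c₁X
    ...   | inj₁ cX'      = ⊥-elim (just≢nothing cX' cX)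
    ...   | inj₂ (VX , _) = VX

    new∈ : ∀ {X m} → c X ≡ nothing → c' X ≡ just m → Qall X ≡ true
    new∈ {X} cX c'X with colored? c₂ X
    ... | inj₂ c₂X       = L₂.new∈ c₂X c'X
    ... | inj₁ (_ , c₂X) = Vq⊆ (new∈₂ cX c₂X)

    mates : ∀ {R S} → (R , S) ∈ M → c₂ R ≡ c₂ S
    mates {R} {S} RS∈ with coEdge (inj₁ RS∈)
    ... | vR , vS , _ , ¬b with ∨-true {Vp R} vR | ∨-true {Vp S} vS
    ...   | inj₁ pR | inj₁ pS = let (m , cS) , _ = hp pS in
      trans (L₁.ext (ext₁ (trans (decidable-stable (Maybe-≡-dec _≟_ (c R) (c S)) (λ c≢ → ¬b (inj₂ (inj₁ (pR , pS , c≢))))) cS)))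
            (sym (L₁.ext (ext₁ cS)))
    ...   | inj₂ qR | inj₁ pS = let (m , cS) , _ = hp pS in
      trans (L₁.ext (trans (proj₁ (asg R) qR S pS (inj₁ RS∈)) cS)) (sym (L₁.ext (ext₁ cS)))
    ...   | inj₁ pR | inj₂ qS = let (m , cR) , _ = hp pR in
      trans (L₁.ext (ext₁ cR)) (sym (L₁.ext (trans (proj₁ (asg S) qS R pR (inj₂ RS∈)) cR)))
    ...   | inj₂ qR | inj₂ qS =
      L₁.mates (inj₁ RS∈) qR (trans (proj₂ (asg R) (inj₂ (noMate (inj₁ RS∈) qS))) (proj₁ (hq qR)))

    origin : ∀ {X m} → c X ≡ nothing → c' X ≡ just m →
        (∃ λ Y → c Y ≡ just m)
        ⊎ (Vq X ≡ true × c₂ X ≡ just m × ∀ j → 1 ≤ j → j < m →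
             ∃ λ Z → ∃ λ Y → Vq Z ≡ true × Collide ℛ Z Y × c₂ Y ≡ just j)
        ⊎ (∀ j → 1 ≤ j → j < m →
             ∃ λ Z → ∃ λ Y → (Qall Z ≡ true × Vq Z ≡ false) × Collide ℛ Z Y × c' Y ≡ just j)
    origin {X} cX c'X with colored? c₂ X
    ... | inj₂ c₂X = inj₂ (inj₂ λ j 1≤j j<m →
      let Z , Y , (QZ , c₂Z) , col , c'Y = L₂.below c₂X c'X j 1≤j j<m
      in Z , Y , (QZ , ¬true⇒false (λ VZ → just≢nothing (proj₂ (L₁.total VZ)) c₂Z)) , col , c'Y)
    ... | inj₁ (m , c₂X) with just-injective (trans (sym (L₂.ext c₂X)) c'X) | colored? c₁ X
    ...   | refl | inj₂ c₁X = inj₂ (inj₁ (new∈₂ cX c₂X , c₂X , λ j 1≤j j<m →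
      let Z , Y , (VZ , _) , col , c₂Y = L₁.below c₁X c₂X j 1≤j j<m in Z , Y , VZ , col , c₂Y))
    ...   | refl | inj₁ (_ , c₁X) with just-injective (trans (sym (L₁.ext c₁X)) c₂X) | view₁ c₁X
    ...     | refl | inj₁ cX'                    = ⊥-elim (just≢nothing cX' cX)
    ...     | refl | inj₂ (_ , S , _ , _ , cS) = inj₁ (S , cS)

-- Savings from members that share a colour

module Savings {n k : ℕ} (T : Graph n) (ℛ : Fin k → DiGraph n) where
  open Greedy T ℛ
  open Pairs T ℛ
  open Decisions T ℛ

  pair-distinct : ∀ {M X Y} → Unique (endpoints M) → (X , Y) ∈ M → X ≢ Y
  pair-distinct ((ne ∷ _) ∷ _) (here refl) = ne
  pair-distinct (_ ∷ _ ∷ u)    (there e∈)  = pair-distinct u e∈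

  first-not-second : ∀ {M X Y Z} → Unique (endpoints M) → (X , Y) ∈ M → (Y , Z) ∈ M → ⊥
  first-not-second u XY YZ = pair-distinct u XY (cong proj₁ (samePair u XY YZ (inj₂ refl) (inj₁ refl)))

  ∈-firsts⁻ : ∀ {M : List (Fin k × Fin k)} {X} → X ∈ map proj₁ M → ∃ λ Y → (X , Y) ∈ M
  ∈-firsts⁻ X∈ with ∈-map⁻ proj₁ X∈
  ... | (_ , Y) , e∈ , refl = Y , e∈

  firsts-unique : ∀ {M} → Unique (endpoints M) → Unique (map proj₁ M)
  firsts-unique {[]}          _             = []
  firsts-unique {(a , b) ∷ M} ((_ ∷ a∉) ∷ _ ∷ u) =
    All.tabulate (λ x∈ → All.lookup a∉ (∈-endpoints⁺ (proj₂ (∈-firsts⁻ x∈)) (inj₁ refl))) ∷ firsts-unique u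

  swap-endpoints-unique : ∀ {M} → Unique (endpoints M) → Unique (endpoints (map swap M))
  swap-endpoints-unique {[]}    _ = []
  swap-endpoints-unique {e ∷ M} ((ab ∷ a∉) ∷ b∉ ∷ u) =
    ((ab ∘ sym) ∷ All.tabulate (All.lookup b∉ ∘ back)) ∷ All.tabulate (All.lookup a∉ ∘ back) ∷ swap-endpoints-unique u
    where
    back : ∀ {X} → X ∈ endpoints (map swap M) → X ∈ endpoints M
    back X∈ with ∈-endpoints⁻ (map swap M) X∈
    ... | e , e∈ , m with ∈-map⁻ swap e∈
    ...   | e' , e'∈ , refl = ∈-endpoints⁺ e'∈ (Sum.swap m)

  _∪_ : (Fin k → Bool) → (Fin k → Bool) → Fin k → Bool
  (p ∪ q) X = p X ∨ q X

  count-∪ : ∀ p q → count (p ∪ q) ≤ count p + count q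
  count-∪ p q = subst (count (p ∪ q) ≤_) (length-++ (elements p))
    (Unique-⊆⇒length≤ (elements-unique (p ∪ q)) λ {X} X∈ →
      [ (λ pX → ∈-++⁺ˡ (∈-elements⁺ p pX)) , (λ qX → ∈-++⁺ʳ (elements p) (∈-elements⁺ q qX)) ]′
        (∨-true {p X} (∈-elements⁻ (p ∪ q) X∈)))

  -- The members in `F` are redundant: their colours survive outside `F`, so the kept members alone
  -- still show all `m` colours.
  colors+dropped≤ : ∀ {U : Fin k → Bool} {F : List (Fin k)} (col : PCol k) m → Unique F →
    (∀ {X} → X ∈ F → U X ≡ true) →
    (∀ {X} → U X ≡ true → ∃ λ Y → U Y ≡ true × Y ∉ F × col X ≡ col Y) →
    (∀ j → 1 ≤ j → j ≤ m → ∃ λ X → U X ≡ true × col X ≡ just j) →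
    m + length F ≤ count U
  colors+dropped≤ {U} {F} col m uF F⊆ rep cov = begin
    m + length F                      ≤⟨ +-monoˡ-≤ (length F) (covers⇒≤ m (elements kept) col covKept) ⟩
    count kept + length F             ≡⟨ length-++ (elements kept) ⟨
    length (elements kept ++ F)       ≤⟨ Unique-⊆⇒length≤ (Uₚ.++⁺ (elements-unique kept) uF disjoint) sub ⟩
    count U                           ∎
    where
    open ≤-Reasoning
    ∈F? : ∀ X → Dec (X ∈ F)
    ∈F? X = Any.any? (X ≟F_) F
    kept : Fin k → Bool
    kept X = U X ∧ not (isYes (∈F? X))
    kept⁻ : ∀ {X} → kept X ≡ true → U X ≡ true × X ∉ F
    kept⁻ {X} e with U X | ∈F? X
    ... | true | no X∉ = refl , X∉
    covKept : ∀ j → 1 ≤ j → j ≤ m → ∃ λ X → X ∈ elements kept × col X ≡ just j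
    covKept j 1≤j j≤m = let X , UX , cX = cov j 1≤j j≤m
                            Y , UY , Y∉ , eq = rep UX
                        in Y , ∈-elements⁺ kept (cong₂ _∧_ UY (cong not (isYes-no (∈F? Y) Y∉))) , trans (sym eq) cX
    disjoint : ∀ {X} → ¬ (X ∈ elements kept × X ∈ F)
    disjoint (X∈ , X∈F) = proj₂ (kept⁻ (∈-elements⁻ kept X∈)) X∈F
    sub : ∀ {X} → X ∈ elements kept ++ F → X ∈ elements U
    sub X∈ = ∈-elements⁺ U ([ (λ X∈ → proj₁ (kept⁻ (∈-elements⁻ kept X∈))) , F⊆ ]′ (∈-++⁻ (elements kept) X∈))

  -- The first member of each pair is dropped. Cross pairs `Lc` point from `W` into `V`; their
  -- second member may itself be dropped through `M`, and then its mate takes over. With this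
  -- orientation a surviving representative is at most two moves away.
  colors+pairs≤ : ∀ (V W : Fin k → Bool) (M Lc Li : List (Fin k × Fin k)) (col : PCol k) m →
    (∀ {X} → V X ≡ true → W X ≡ true → ⊥) →
    Unique (endpoints M) → Unique (endpoints Lc) → Unique (endpoints Li) →
    (∀ {X Y} → (X , Y) ∈ M → (V X ≡ true × V Y ≡ true) × col X ≡ col Y) →
    (∀ {X Y} → (X , Y) ∈ Lc → (W X ≡ true × V Y ≡ true) × col X ≡ col Y) →
    (∀ {X Y} → (X , Y) ∈ Li → (W X ≡ true × W Y ≡ true) × col X ≡ col Y) →
    (∀ {X} → X ∈ endpoints Lc → X ∈ endpoints Li → ⊥) →
    (∀ j → 1 ≤ j → j ≤ m → ∃ λ X → (V ∪ W) X ≡ true × col X ≡ just j) →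
    m + (length M + (length Lc + length Li)) ≤ count V + count W
  colors+pairs≤ V W M Lc Li col m dis uM uc ui hM hc hi ci cov = begin
    m + (length M + (length Lc + length Li)) ≡⟨ cong (m +_) lengthF ⟨
    m + length F                             ≤⟨ colors+dropped≤ col m uF F⊆ rep cov ⟩
    count (V ∪ W)                            ≤⟨ count-∪ V W ⟩
    count V + count W                        ∎
    where
    open ≤-Reasoning
    F = map proj₁ M ++ (map proj₁ Lc ++ map proj₁ Li)
    lengthF : length F ≡ length M + (length Lc + length Li)
    lengthF = trans (length-++ (map proj₁ M)) (cong₂ _+_ (length-map proj₁ M)
      (trans (length-++ (map proj₁ Lc)) (cong₂ _+_ (length-map proj₁ Lc) (length-map proj₁ Li))))
    split : ∀ {X} → X ∈ F → (∃ λ Y → (X , Y) ∈ M) ⊎ (∃ λ Y → (X , Y) ∈ Lc) ⊎ (∃ λ Y → (X , Y) ∈ Li)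
    split X∈ = Sum.map ∈-firsts⁻ (Sum.map ∈-firsts⁻ ∈-firsts⁻ ∘ ∈-++⁻ (map proj₁ Lc)) (∈-++⁻ (map proj₁ M) X∈)
    splitW : ∀ {X} → X ∈ map proj₁ Lc ++ map proj₁ Li → W X ≡ true
    splitW X∈ = [ (λ X∈ → proj₁ (proj₁ (hc (proj₂ (∈-firsts⁻ X∈))))) , (λ X∈ → proj₁ (proj₁ (hi (proj₂ (∈-firsts⁻ X∈))))) ]′ (∈-++⁻ (map proj₁ Lc) X∈)
    uF : Unique F
    uF = Uₚ.++⁺ (firsts-unique uM)
      (Uₚ.++⁺ (firsts-unique uc) (firsts-unique ui)
        λ (X∈c , X∈i) → ci (∈-endpoints⁺ (proj₂ (∈-firsts⁻ X∈c)) (inj₁ refl)) (∈-endpoints⁺ (proj₂ (∈-firsts⁻ X∈i)) (inj₁ refl)))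
      λ (X∈M , X∈) → dis (proj₁ (proj₁ (hM (proj₂ (∈-firsts⁻ X∈M))))) (splitW X∈)
    inV : ∀ {X} → V X ≡ true → (V ∪ W) X ≡ true
    inV = ∨-introˡ _
    inW : ∀ {X} → W X ≡ true → (V ∪ W) X ≡ true
    inW {X} = ∨-introʳ (V X)
    F⊆ : ∀ {X} → X ∈ F → (V ∪ W) X ≡ true
    F⊆ {X} X∈ with ∈-++⁻ (map proj₁ M) X∈
    ... | inj₁ X∈M = inV {X} (proj₁ (proj₁ (hM (proj₂ (∈-firsts⁻ X∈M)))))
    ... | inj₂ X∈W = inW {X} (splitW X∈W)
    Rep : Fin k → Set
    Rep X = ∃ λ Y → (V ∪ W) Y ≡ true × Y ∉ F × col X ≡ col Y
    repV : ∀ {X} → V X ≡ true → Rep X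
    repV {X} VX with Any.any? (X ≟F_) F
    ... | no X∉ = X , inV {X} VX , X∉ , refl
    ... | yes X∈ with split X∈
    ...   | inj₂ (inj₁ (_ , e∈)) = ⊥-elim (dis VX (proj₁ (proj₁ (hc e∈))))
    ...   | inj₂ (inj₂ (_ , e∈)) = ⊥-elim (dis VX (proj₁ (proj₁ (hi e∈))))
    ...   | inj₁ (Y , XY) = Y , inV {Y} VY , Y∉ , proj₂ (hM XY)
      where
      VY = proj₂ (proj₁ (hM XY))
      Y∉ : Y ∉ F
      Y∉ Y∈ with split Y∈
      ... | inj₁ (_ , YZ)        = first-not-second uM XY YZ
      ... | inj₂ (inj₁ (_ , e∈)) = dis VY (proj₁ (proj₁ (hc e∈)))
      ... | inj₂ (inj₂ (_ , e∈)) = dis VY (proj₁ (proj₁ (hi e∈)))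
    repW : ∀ {X} → W X ≡ true → Rep X
    repW {X} WX with Any.any? (X ≟F_) F
    ... | no X∉ = X , inW {X} WX , X∉ , refl
    ... | yes X∈ with split X∈
    ...   | inj₁ (_ , e∈) = ⊥-elim (dis (proj₁ (proj₁ (hM e∈))) WX)
    ...   | inj₂ (inj₁ (Y , XY)) = let Z , UZ , Z∉ , eq = repV (proj₂ (proj₁ (hc XY)))
                                   in Z , UZ , Z∉ , trans (proj₂ (hc XY)) eq
    ...   | inj₂ (inj₂ (Y , XY)) = Y , inW {Y} WY , Y∉ , proj₂ (hi XY)
      where
      WY = proj₂ (proj₁ (hi XY))
      Y∉ : Y ∉ F
      Y∉ Y∈ with split Y∈
      ... | inj₁ (_ , e∈)        = dis (proj₁ (proj₁ (hM e∈))) WY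
      ... | inj₂ (inj₁ (_ , YZ)) = ci (∈-endpoints⁺ YZ (inj₁ refl)) (∈-endpoints⁺ XY (inj₂ refl))
      ... | inj₂ (inj₂ (_ , YZ)) = first-not-second ui XY YZ
    rep : ∀ {X} → (V ∪ W) X ≡ true → Rep X
    rep {X} e = [ repV , repW ]′ (∨-true {V X} e)

  -- Pairs are indexed by their first member. `no-path` prevents a member from being first in one
  -- pair and second in another, and `injective` prevents two pairs with the same second member.
  module PairList (Rel : Fin k → Fin k → Set) (Rel? : ∀ X Y → Dec (Rel X Y))
    (distinct : ∀ {X Y} → Rel X Y → X ≢ Y)
    (functional : ∀ {X Y Z} → Rel X Y → Rel X Z → Y ≡ Z)
    (injective : ∀ {X Y Z} → Rel X Z → Rel Y Z → X ≡ Y)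
    (no-path : ∀ {X Y Z} → Rel X Y → Rel Y Z → ⊥) where

    pick : Fin k → Maybe (Fin k × Fin k)
    pick X with any? (Rel? X)
    ... | yes (Y , _) = just (X , Y)
    ... | no _        = nothing

    pick⁻ : ∀ {X Y Z} → pick X ≡ just (Y , Z) → X ≡ Y × Rel Y Z
    pick⁻ {X} e with any? (Rel? X)
    pick⁻ refl | yes (_ , r) = refl , r

    pick⁺ : ∀ {X Y} → Rel X Y → pick X ≡ just (X , Y)
    pick⁺ {X} r with any? (Rel? X)
    ... | yes (_ , r') = cong (λ Y → just (X , Y)) (functional r' r)
    ... | no none      = ⊥-elim (none (_ , r))

    pairs : List (Fin k × Fin k)
    pairs = mapMaybe pick (allFin k)

    ∈-pairs⁻ : ∀ {X Y} → (X , Y) ∈ pairs → Rel X Y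
    ∈-pairs⁻ e∈ with mapMaybe⁻ pick (allFin k) e∈
    ... | Z , _ , e = proj₂ (pick⁻ e)

    ∈-pairs⁺ : ∀ {X Y} → Rel X Y → (X , Y) ∈ pairs
    ∈-pairs⁺ {X} r = mapMaybe⁺ pick (∈-allFin X) (pick⁺ r)

    pairs-unique : Unique (endpoints pairs)
    pairs-unique = endpoints-unique-mapMaybe pick (Uₚ.allFin⁺ k)
      (λ _ _ _ e → distinct (proj₂ (pick⁻ e)))
      apart
      where
      apart : ∀ a b e e' → a ≢ b → pick a ≡ just e → pick b ≡ just e' → Disjoint₂ e e'
      apart a b (_ , Y) (_ , Y') ne pa pb with pick⁻ pa | pick⁻ pb
      ... | refl , r | refl , r' = λ where
        X (inj₁ refl) (inj₁ refl) → ne refl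
        X (inj₁ refl) (inj₂ refl) → no-path r' r
        X (inj₂ refl) (inj₁ refl) → no-path r r'
        X (inj₂ refl) (inj₂ refl) → ne (injective r r')

-- Loads of an edge

module Loads {n k : ℕ} (T : Graph n) (ℛ : Fin k → DiGraph n) (φ : Fin k → ℕ) (validφ : Valid ℛ φ) where
  open Greedy T ℛ
  open Coloring T ℛ

  class : ℕ → (Fin k → ℕ) → ℕ
  class κ f = ∑ (λ X → 𝟙 (inClass φ κ X) * f X) (allFin k)

  InClass : ℕ → Fin k → Set
  InClass κ X = φ X ≡ κ

  class-independent : ∀ {κ X Y} → InClass κ X → InClass κ Y → Collide ℛ X Y → X ≡ Y
  class-independent {κ} {X} {Y} X∈ Y∈ col = decidable-stable (X ≟F Y) λ ne → proj₂ validφ X Y ne col (trans X∈ (sym Y∈))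

  𝟙-* : ∀ p q → 𝟙 p * 𝟙 q ≡ 𝟙 (p ∧ q)
  𝟙-* true  true  = refl
  𝟙-* true  false = refl
  𝟙-* false _     = refl

  class≤1 : ∀ κ p → (∀ {X Y} → InClass κ X → InClass κ Y → p X ≡ true → p Y ≡ true → X ≡ Y) → class κ (𝟙 ∘ p) ≤ 1
  class≤1 κ p eq = subst (_≤ 1) (∑-cong (allFin k) λ X → sym (𝟙-* (inClass φ κ X) (p X)))
    (count≤1 (λ X → inClass φ κ X ∧ p X) λ X Y eX eY →
      let cX , pX = ∧-true {inClass φ κ X} eX
          cY , pY = ∧-true {inClass φ κ Y} eY
      in eq (isYes⁻ (φ X ≟ κ) cX) (isYes⁻ (φ Y ≟ κ) cY) pX pY)

  class-+ : ∀ κ f g → class κ (λ X → f X + g X) ≡ class κ f + class κ g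
  class-+ κ f g = trans (∑-cong (allFin k) λ X → *-distribˡ-+ (𝟙 (inClass φ κ X)) (f X) (g X))
    (∑-+ (λ X → 𝟙 (inClass φ κ X) * f X) (λ X → 𝟙 (inClass φ κ X) * g X) (allFin k))

  class-mono : ∀ κ {f g} → (∀ X → f X ≤ g X) → class κ f ≤ class κ g
  class-mono κ le = ∑-mono (allFin k) λ X → *-monoʳ-≤ (𝟙 (inClass φ κ X)) (le X)

  class-mono-< : ∀ {κ f g Z} → (∀ X → f X ≤ g X) → InClass κ Z → f Z < g Z → class κ f < class κ g
  class-mono-< {κ} {f} {g} {Z} le Z∈ lt = ∑-mono-< (λ X → *-monoʳ-≤ (𝟙 (inClass φ κ X)) (le X)) (∈-allFin Z) strict
    where
    strict : 𝟙 (inClass φ κ Z) * f Z < 𝟙 (inClass φ κ Z) * g Z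
    strict rewrite isYes⁺ (φ Z ≟ κ) Z∈ | +-identityʳ (f Z) | +-identityʳ (g Z) = lt

  term≤class : ∀ {κ} f {Z} → InClass κ Z → f Z ≤ class κ f
  term≤class {κ} f {Z} Z∈ = subst (_≤ class κ f) eq (term≤∑ (λ X → 𝟙 (inClass φ κ X) * f X) (∈-allFin Z))
    where
    eq : 𝟙 (inClass φ κ Z) * f Z ≡ f Z
    eq rewrite isYes⁺ (φ Z ≟ κ) Z∈ = +-identityʳ (f Z)

  class-load : ∀ κ a b → class κ (λ X → 𝟙 (has X a b)) ≤ 2
  class-load κ a b = begin
    class κ (λ X → 𝟙 (has X a b))
      ≤⟨ class-mono κ (λ X → 𝟙-∨ (A (ℛ X) a b) (A (ℛ X) b a)) ⟩
    class κ (λ X → 𝟙 (A (ℛ X) a b) + 𝟙 (A (ℛ X) b a))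
      ≡⟨ class-+ κ (λ X → 𝟙 (A (ℛ X) a b)) (λ X → 𝟙 (A (ℛ X) b a)) ⟩
    class κ (λ X → 𝟙 (A (ℛ X) a b)) + class κ (λ X → 𝟙 (A (ℛ X) b a))
      ≤⟨ +-mono-≤ (class≤1 κ (λ X → A (ℛ X) a b) (λ X∈ Y∈ p q → class-independent X∈ Y∈ (a , b , p , q)))
                  (class≤1 κ (λ X → A (ℛ X) b a) (λ X∈ Y∈ p q → class-independent X∈ Y∈ (b , a , p , q))) ⟩
    2 ∎
    where
    open ≤-Reasoning
    𝟙-∨ : ∀ p q → 𝟙 (p ∨ q) ≤ 𝟙 p + 𝟙 q
    𝟙-∨ true  _ = s≤s z≤n
    𝟙-∨ false _ = ≤-refl

  load≤ : ∀ a b → count (λ X → has X a b) ≤ numColors φ * 2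
  load≤ a b = begin
    count (λ X → has X a b)                            ≡⟨ count≡∑ (λ X → has X a b) ⟩
    ∑ (λ X → 𝟙 (has X a b)) (allFin k)                 ≤⟨ ∑≤∑∑classes φ (λ X → 𝟙 (has X a b)) ⟩
    ∑ (λ κ → class κ (λ X → 𝟙 (has X a b))) (palette φ) ≤⟨ ∑-mono (palette φ) (λ κ → class-load κ a b) ⟩
    ∑ (λ _ → 2) (palette φ)                            ≡⟨ ∑-const 2 (palette φ) ⟩
    numColors φ * 2                                    ∎
    where open ≤-Reasoning

-- Counting at an edge of type 4

module Type4Count {n k : ℕ} (T : Graph n) (ℛ : Fin k → DiGraph n) (φ : Fin k → ℕ) (validφ : Valid ℛ φ)
  (c : PCol k) (u v w x : Fin n)
  (properc : Coloring.Proper T ℛ c)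
  (anchor : ∀ {X m} → c X ≡ just m → (Greedy.has T ℛ X u v ≡ true) ⊎ (Greedy.has T ℛ X u x ≡ true) → Greedy.has T ℛ X u w ≡ true)
  (local : ∀ {R S m} → c R ≡ nothing → Greedy.has T ℛ R u v ≡ true → c S ≡ just m → Collide ℛ R S →
    (Greedy.has T ℛ S u v ≡ true) ⊎ (Greedy.has T ℛ R u x ≡ true × Greedy.has T ℛ S u x ≡ true)) where
  open Greedy T ℛ
  open Pairs T ℛ
  open Decisions T ℛ
  open Coloring T ℛ
  open Savings T ℛ
  open Loads T ℛ φ validφ

  -- `V₁` and `V₂` are the vertex sets of the graphs of the two processes. Any colour that obstructs
  -- the loop over `Q` sits in `V₁` or `B`; any that obstructs the loop over `C` sits in `V₂` or
  -- `P`.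
  P Q B C V₁ V₂ W : Fin k → Bool
  P X = is-just (c X) ∧ has X u v
  Q X = Qset c u v X
  B X = is-just (c X) ∧ has X u x ∧ not (has X u v)
  C X = Qset c u v X ∧ has X u x
  V₁ = P ∪ Q
  V₂ = B ∪ C
  W = P ∪ B

  P⁻ : ∀ {X} → P X ≡ true → (∃ λ m → c X ≡ just m) × has X u v ≡ true
  P⁻ e = let j , h = ∧-true e in is-just⁻ j , h

  Q⁻ : ∀ {X} → Q X ≡ true → c X ≡ nothing × has X u v ≡ true
  Q⁻ e = let j , h = ∧-true e in is-nothing⁻ j , h

  B⁻ : ∀ {X} → B X ≡ true → (∃ λ m → c X ≡ just m) × has X u x ≡ true × has X u v ≡ false
  B⁻ {X} e with c X | has X u x | has X u v
  ... | just m | true | false = (m , refl) , refl , refl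

  C⁻ : ∀ {X} → C X ≡ true → Q X ≡ true × has X u x ≡ true
  C⁻ e = ∧-true e

  P⁺ : ∀ {X m} → c X ≡ just m → has X u v ≡ true → P X ≡ true
  P⁺ cX h = cong₂ _∧_ (is-just⁺ cX) h

  Q⁺ : ∀ {X} → c X ≡ nothing → has X u v ≡ true → Q X ≡ true
  Q⁺ cX h = cong₂ _∧_ (is-nothing⁺ cX) h

  W⁺ : ∀ {X m} → c X ≡ just m → (has X u v ≡ true) ⊎ (has X u x ≡ true) → W X ≡ true
  W⁺ {X} {m} cX h with has X u v in ev | has X u x | h
  ... | true  | _    | _        rewrite is-just⁺ cX = refl
  ... | false | true | _        rewrite is-just⁺ cX = refl
  ... | false | false | inj₁ ()
  ... | false | false | inj₂ ()

  W⁻ : ∀ {X} → W X ≡ true → (∃ λ m → c X ≡ just m) × has X u w ≡ true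
  W⁻ {X} e with ∨-true {P X} e
  ... | inj₁ pX = let (m , cX) , h = P⁻ pX in (m , cX) , anchor cX (inj₁ h)
  ... | inj₂ bX = let (m , cX) , h , _ = B⁻ bX in (m , cX) , anchor cX (inj₂ h)

  P⇒W : ∀ {X} → P X ≡ true → W X ≡ true
  P⇒W = ∨-introˡ _

  ¬P∧B : ∀ {X} → P X ≡ true → B X ≡ true → ⊥
  ¬P∧B p b = true≢false (proj₂ (P⁻ p)) (proj₂ (proj₂ (B⁻ b)))

  ¬P∧Q : ∀ {X} → P X ≡ true → Q X ≡ true → ⊥
  ¬P∧Q p q = just≢nothing (proj₂ (proj₁ (P⁻ p))) (proj₁ (Q⁻ q))

  ¬B∧Q : ∀ {X} → B X ≡ true → Q X ≡ true → ⊥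
  ¬B∧Q b q = just≢nothing (proj₂ (proj₁ (B⁻ b))) (proj₁ (Q⁻ q))

  record Twins (X Y : Fin k) : Set where
    constructor twins
    field
      left  : W X ≡ true
      right : W Y ≡ true
      apart : X ≢ Y
      same  : c X ≡ c Y
  open Twins

  twins-sym : ∀ {X Y} → Twins X Y → Twins Y X
  twins-sym (twins l r a s) = twins r l (a ∘ sym) (sym s)

  twins? : ∀ X Y → Dec (Twins X Y)
  twins? X Y = map′ (λ (l , r , a , s) → twins l r a s) (λ (twins l r a s) → l , r , a , s)
    ((W X Bool.≟ true) ×-dec (W Y Bool.≟ true) ×-dec ¬? (X ≟F Y) ×-dec Maybe-≡-dec _≟_ (c X) (c Y))

  same-color-independent : ∀ {X Y m} → X ≢ Y → c X ≡ just m → c X ≡ c Y → ¬ Collide ℛ X Y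
  same-color-independent ne cX s col = properc ne col cX (trans (sym s) cX)

  -- All of W contains {u,w}, whose two directions leave room for at most two members of one colour.
  twin-unique : ∀ {X Y Z} → Twins X Y → Twins X Z → Y ≡ Z
  twin-unique {X} {Y} {Z} XY XZ = decidable-stable (Y ≟F Z) λ ne →
    let (m , cX) , hX = W⁻ (left XY)
        (_ , cY) , hY = W⁻ (right XY)
        _ , hZ = W⁻ (right XZ)
    in [ same-color-independent (apart XY) cX (same XY)
       , [ same-color-independent (apart XZ) cX (same XZ)
         , same-color-independent ne cY (trans (sym (same XY)) (same XZ)) ]′ ]′ (three-collide {u} {w} hX hY hZ)

  twin-unique′ : ∀ {X Y Z} → Twins X Z → Twins Y Z → X ≡ Y
  twin-unique′ XZ YZ = twin-unique (twins-sym XZ) (twins-sym YZ)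

  -- The order of indices lists a twin pair inside `P` or inside `B` once; mixed pairs are oriented
  -- from `B` to `P`.
  RelPP RelBB RelBP : Fin k → Fin k → Set
  RelPP X Y = (P X ≡ true × P Y ≡ true × X Fin.< Y) × Twins X Y
  RelBB X Y = (B X ≡ true × B Y ≡ true × X Fin.< Y) × Twins X Y
  RelBP X Y = (B X ≡ true × P Y ≡ true) × Twins X Y

  no-increasing-path : ∀ {X Y Z} → X Fin.< Y → Twins X Y → Y Fin.< Z → Twins Y Z → ⊥
  no-increasing-path X<Y XY Y<Z YZ with twin-unique (twins-sym XY) YZ
  ... | refl = <-asym X<Y Y<Z

  module PP = PairList RelPP
    (λ X Y → ((P X Bool.≟ true) ×-dec (P Y Bool.≟ true) ×-dec (X Finₚ.<? Y)) ×-dec twins? X Y)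
    (λ r → apart (proj₂ r)) (λ r s → twin-unique (proj₂ r) (proj₂ s)) (λ r s → twin-unique′ (proj₂ r) (proj₂ s))
    (λ ((_ , _ , lt) , t) ((_ , _ , lt') , t') → no-increasing-path lt t lt' t')

  module BB = PairList RelBB
    (λ X Y → ((B X Bool.≟ true) ×-dec (B Y Bool.≟ true) ×-dec (X Finₚ.<? Y)) ×-dec twins? X Y)
    (λ r → apart (proj₂ r)) (λ r s → twin-unique (proj₂ r) (proj₂ s)) (λ r s → twin-unique′ (proj₂ r) (proj₂ s))
    (λ ((_ , _ , lt) , t) ((_ , _ , lt') , t') → no-increasing-path lt t lt' t')

  module BP = PairList RelBP
    (λ X Y → ((B X Bool.≟ true) ×-dec (P Y Bool.≟ true)) ×-dec twins? X Y)
    (λ r → apart (proj₂ r)) (λ r s → twin-unique (proj₂ r) (proj₂ s)) (λ r s → twin-unique′ (proj₂ r) (proj₂ s))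
    (λ ((_ , pY) , _) ((bY , _) , _) → ¬P∧B pY bY)

  Paired : Fin k → Set
  Paired X = ∃ λ Y → Twins X Y

  paired? : ∀ X → Dec (Paired X)
  paired? X = any? (twins? X)

  paired : Fin k → Bool
  paired X = isYes (paired? X)

  pairedMembers≤ : count paired ≤ (length PP.pairs + length PP.pairs) + ((length BP.pairs + length BP.pairs) + (length BB.pairs + length BB.pairs))
  pairedMembers≤ = subst (count paired ≤_) lengths (Unique-⊆⇒length≤ (elements-unique paired) sub)
    where
    ends = endpoints PP.pairs ++ (endpoints BP.pairs ++ endpoints BB.pairs)
    lengths : length ends ≡ _
    lengths = trans (length-++ (endpoints PP.pairs)) (cong₂ _+_ (length-endpoints PP.pairs)
      (trans (length-++ (endpoints BP.pairs)) (cong₂ _+_ (length-endpoints BP.pairs) (length-endpoints BB.pairs))))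
    inPP : ∀ {X} → X ∈ endpoints PP.pairs → X ∈ ends
    inPP = ∈-++⁺ˡ
    inBP : ∀ {X} → X ∈ endpoints BP.pairs → X ∈ ends
    inBP X∈ = ∈-++⁺ʳ (endpoints PP.pairs) (∈-++⁺ˡ X∈)
    inBB : ∀ {X} → X ∈ endpoints BB.pairs → X ∈ ends
    inBB X∈ = ∈-++⁺ʳ (endpoints PP.pairs) (∈-++⁺ʳ (endpoints BP.pairs) X∈)
    ordered : ∀ {X Y} → X ≢ Y → (X Fin.< Y) ⊎ (Y Fin.< X)
    ordered {X} {Y} ne with Finₚ.<-cmp X Y
    ... | Tri.tri< lt _ _ = inj₁ lt
    ... | Tri.tri≈ _ e _  = ⊥-elim (ne e)
    ... | Tri.tri> _ _ gt = inj₂ gt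
    sub : ∀ {X} → X ∈ elements paired → X ∈ ends
    sub {X} X∈ with isYes⁻ (paired? X) (∈-elements⁻ paired X∈)
    ... | Y , t with ∨-true {P X} (left t) | ∨-true {P Y} (right t) | ordered (apart t)
    ...   | inj₁ pX | inj₁ pY | inj₁ lt = inPP (∈-endpoints⁺ (PP.∈-pairs⁺ ((pX , pY , lt) , t)) (inj₁ refl))
    ...   | inj₁ pX | inj₁ pY | inj₂ gt = inPP (∈-endpoints⁺ (PP.∈-pairs⁺ ((pY , pX , gt) , twins-sym t)) (inj₂ refl))
    ...   | inj₁ pX | inj₂ bY | _       = inBP (∈-endpoints⁺ (BP.∈-pairs⁺ ((bY , pX) , twins-sym t)) (inj₂ refl))
    ...   | inj₂ bX | inj₁ pY | _       = inBP (∈-endpoints⁺ (BP.∈-pairs⁺ ((bX , pY) , t)) (inj₁ refl))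
    ...   | inj₂ bX | inj₂ bY | inj₁ lt = inBB (∈-endpoints⁺ (BB.∈-pairs⁺ ((bX , bY , lt) , t)) (inj₁ refl))
    ...   | inj₂ bX | inj₂ bY | inj₂ gt = inBB (∈-endpoints⁺ (BB.∈-pairs⁺ ((bY , bX , gt) , twins-sym t)) (inj₂ refl))

  -- A pair that can enlarge the first matching. A coloured end with a twin is excluded for two
  -- reasons: the twin might block the pair, or it might already be matched with that end.
  record Good (κ : ℕ) (R S : Fin k) : Set where
    constructor good
    field
      R∈    : InClass κ R
      S∈    : InClass κ S
      R≢S   : R ≢ S
      R-new : Q R ≡ true
      S-ok  : (Q S ≡ true) ⊎ (P S ≡ true × ¬ Paired S)
  open Good

  good? : ∀ κ R S → Dec (Good κ R S)
  good? κ R S = map′ (λ (a , b , c , d , e) → good a b c d e) (λ (good a b c d e) → a , b , c , d , e)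
    ((φ R ≟ κ) ×-dec (φ S ≟ κ) ×-dec ¬? (R ≟F S) ×-dec (Q R Bool.≟ true) ×-dec
      ((Q S Bool.≟ true) ⊎-dec ((P S Bool.≟ true) ×-dec ¬? (paired? S))))

  anyGood? : ∀ κ → Dec (∃ λ R → ∃ λ S → Good κ R S)
  anyGood? κ = any? λ R → any? λ S → good? κ R S

  -- One pair per class is enough, because the weight of a class exceeds 5 by at most one; pairs
  -- from different classes are disjoint.
  pickGood : ℕ → Maybe (Fin k × Fin k)
  pickGood κ with anyGood? κ
  ... | yes (R , S , _) = just (R , S)
  ... | no _            = nothing

  pickGood⁻ : ∀ {κ R S} → pickGood κ ≡ just (R , S) → Good κ R S
  pickGood⁻ {κ} e with anyGood? κ
  pickGood⁻ refl | yes (_ , _ , g) = g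

  goodPairs : List (Fin k × Fin k)
  goodPairs = mapMaybe pickGood (palette φ)

  ∈-goodPairs⁻ : ∀ {R S} → (R , S) ∈ goodPairs → ∃ λ κ → Good κ R S
  ∈-goodPairs⁻ e∈ with mapMaybe⁻ pickGood (palette φ) e∈
  ... | κ , _ , e = κ , pickGood⁻ e

  goodPairs-unique : Unique (endpoints goodPairs)
  goodPairs-unique = endpoints-unique-mapMaybe pickGood (palette-unique φ)
    (λ _ _ _ e → R≢S (pickGood⁻ e)) apart'
    where
    inPair : ∀ {κ X e} → pickGood κ ≡ just e → Meets X e → InClass κ X
    inPair e (inj₁ refl) = R∈ (pickGood⁻ e)
    inPair e (inj₂ refl) = S∈ (pickGood⁻ e)
    apart' : ∀ κ κ' e e' → κ ≢ κ' → pickGood κ ≡ just e → pickGood κ' ≡ just e' → Disjoint₂ e e'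
    apart' κ κ' e e' ne eκ eκ' X m m' = ne (trans (sym (inPair eκ m)) (inPair eκ' m'))

  collider∈W : ∀ {Z Y m} → Q Z ≡ true → c Y ≡ just m → Collide ℛ Z Y → W Y ≡ true
  collider∈W qZ cY col = W⁺ cY (Sum.map id proj₂ (local (proj₁ (Q⁻ qZ)) (proj₂ (Q⁻ qZ)) cY col))

  -- A coloured U of the colour of S that collides with R lies in W, hence would be a twin of S.
  goodCoEdge : ∀ {κ R S} → Good κ R S → CoEdge c P Q R S
  goodCoEdge {κ} {R} {S} (good R∈ S∈ ne qR okS) = ∨-introʳ (P R) qR , S∈V okS , ne ,
    λ { (inj₁ col)                                  → indep col
      ; (inj₂ (inj₁ (pR , _)))                      → ¬P∧Q pR qR
      ; (inj₂ (inj₂ (inj₁ (_ , pS , U , s , col)))) → blocked okS pS s col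
      ; (inj₂ (inj₂ (inj₂ (_ , pR , _))))           → ¬P∧Q pR qR }
    where
    indep : ¬ Collide ℛ R S
    indep col = ne (class-independent R∈ S∈ col)
    S∈V : (Q S ≡ true) ⊎ (P S ≡ true × ¬ Paired S) → P S ∨ Q S ≡ true
    S∈V (inj₁ qS)       = ∨-introʳ (P S) qS
    S∈V (inj₂ (pS , _)) = ∨-introˡ _ pS
    blocked : (Q S ≡ true) ⊎ (P S ≡ true × ¬ Paired S) → P S ≡ true → ∀ {U} → c U ≡ c S → Collide ℛ U R → ⊥
    blocked (inj₁ qS) pS _ _ = ¬P∧Q pS qS
    blocked (inj₂ (_ , ¬tw)) pS {U} s col =
      let (m , cS) , _ = P⁻ pS
          cU = trans s cS
          WU = collider∈W qR cU (collide-sym col)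
      in ¬tw (U , twins (P⇒W pS) WU (λ { refl → indep (collide-sym col) }) (sym s))

  twinsCoEdge : ∀ {Vp Vq X Y} → Vp X ≡ true → Vp Y ≡ true → (∀ {Z} → W Z ≡ true → Vq Z ≡ true → ⊥) → Twins X Y → CoEdge c Vp Vq X Y
  twinsCoEdge vX vY dis t = ∨-introˡ _ vX , ∨-introˡ _ vY , apart t , λ where
    (inj₁ col)                        → same-color-independent (apart t) (proj₂ (proj₁ (W⁻ (left t)))) (same t) col
    (inj₂ (inj₁ (_ , _ , c≢)))        → c≢ (same t)
    (inj₂ (inj₂ (inj₁ (qX , _))))     → dis (left t) qX
    (inj₂ (inj₂ (inj₂ (qY , _))))     → dis (right t) qY

  ¬W∧Q : ∀ {Z} → W Z ≡ true → Q Z ≡ true → ⊥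
  ¬W∧Q wZ qZ = just≢nothing (proj₂ (proj₁ (W⁻ wZ))) (proj₁ (Q⁻ qZ))

  -- Twin pairs inside `P` and good pairs form one matching, since the coloured end of a good pair
  -- has no twin.
  M₁-large : ∀ {M} → IsMaxMatching c P Q M → length PP.pairs + length goodPairs ≤ length M
  M₁-large (_ , max) = subst (_≤ _) (length-++ PP.pairs) (max (PP.pairs ++ goodPairs)
    ( All.tabulate (λ {e} e∈ → [ (λ e∈ → let (pX , pY , _) , t = PP.∈-pairs⁻ e∈ in twinsCoEdge {P} {Q} pX pY ¬W∧Q t)
                               , (λ e∈ → goodCoEdge (proj₂ (∈-goodPairs⁻ e∈))) ]′ (∈-++⁻ PP.pairs e∈))
    , subst Unique (sym (endpoints-++ PP.pairs goodPairs)) (Uₚ.++⁺ PP.pairs-unique goodPairs-unique disjoint)))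
    where
    fromPP : ∀ {X} → X ∈ endpoints PP.pairs → P X ≡ true × Paired X
    fromPP X∈ with ∈-endpoints⁻ PP.pairs X∈
    ... | (Y , Z) , e∈ , inj₁ refl = let (pX , _) , t = PP.∈-pairs⁻ e∈ in pX , _ , t
    ... | (Y , Z) , e∈ , inj₂ refl = let (_ , pX , _) , t = PP.∈-pairs⁻ e∈ in pX , _ , twins-sym t
    fromGood : ∀ {X} → X ∈ endpoints goodPairs → (Q X ≡ true) ⊎ (P X ≡ true × ¬ Paired X)
    fromGood X∈ with ∈-endpoints⁻ goodPairs X∈
    ... | (R , S) , e∈ , inj₁ refl = inj₁ (R-new (proj₂ (∈-goodPairs⁻ e∈)))
    ... | (R , S) , e∈ , inj₂ refl = S-ok (proj₂ (∈-goodPairs⁻ e∈))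
    disjoint : ∀ {X} → ¬ (X ∈ endpoints PP.pairs × X ∈ endpoints goodPairs)
    disjoint (X∈ , X∈') with fromPP X∈ | fromGood X∈'
    ... | pX , _  | inj₁ qX       = ¬P∧Q pX qX
    ... | _  , tw | inj₂ (_ , ¬t) = ¬t tw

  M₂-large : ∀ {M} → IsMaxMatching c B C M → length BB.pairs ≤ length M
  M₂-large (_ , max) = max BB.pairs
    ( All.tabulate (λ e∈ → let (bX , bY , _) , t = BB.∈-pairs⁻ e∈ in twinsCoEdge {B} {C} bX bY (λ wZ cZ → ¬W∧Q wZ (proj₁ (C⁻ cZ))) t)
    , BB.pairs-unique)

  -- `weight` collects the cardinalities on the right of the two process bounds.
  weight edges : Fin k → ℕ
  weight X = (𝟙 (V₁ X) + 𝟙 (B X)) + (𝟙 (V₂ X) + 𝟙 (P X))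
  edges X = (𝟙 (has X u w) + 𝟙 (has X u v)) + 𝟙 (has X u x)

  -- A member of `W` counts once in each bound, and `anchor` supplies {u,w} as its second edge. A
  -- new member counts once for {u,v}, and once more if it contains {u,x}.
  weight≤edges : ∀ X → weight X ≤ edges X
  weight≤edges X with c X | has X u w | has X u v | has X u x | anchor {X}
  ... | just _  | false | false | false | _ = z≤n
  ... | just _  | false | true  | _     | f = case f refl (inj₁ refl) of λ ()
  ... | just _  | false | false | true  | f = case f refl (inj₂ refl) of λ ()
  ... | just _  | true  | true  | true  | _ = s≤s (s≤s z≤n)
  ... | just _  | true  | true  | false | _ = s≤s (s≤s z≤n)
  ... | just _  | true  | false | true  | _ = s≤s (s≤s z≤n)
  ... | just _  | true  | false | false | _ = z≤n
  ... | nothing | true  | true  | true  | _ = s≤s (s≤s z≤n)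
  ... | nothing | true  | true  | false | _ = s≤s z≤n
  ... | nothing | true  | false | _     | _ = z≤n
  ... | nothing | false | true  | true  | _ = s≤s (s≤s z≤n)
  ... | nothing | false | true  | false | _ = s≤s z≤n
  ... | nothing | false | false | _     | _ = z≤n

  class-edges : ∀ κ → class κ edges ≡ (class κ (λ X → 𝟙 (has X u w)) + class κ (λ X → 𝟙 (has X u v))) + class κ (λ X → 𝟙 (has X u x))
  class-edges κ = trans (class-+ κ (λ X → 𝟙 (has X u w) + 𝟙 (has X u v)) (λ X → 𝟙 (has X u x)))
    (cong (_+ class κ (λ X → 𝟙 (has X u x))) (class-+ κ (λ X → 𝟙 (has X u w)) (λ X → 𝟙 (has X u v))))

  class-weight : ∀ κ {a b d} → class κ (λ X → 𝟙 (has X u w)) ≤ a → class κ (λ X → 𝟙 (has X u v)) ≤ b →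
                 class κ (λ X → 𝟙 (has X u x)) ≤ d → class κ weight ≤ (a + b) + d
  class-weight κ ha hb hd = ≤-trans (class-mono κ weight≤edges)
    (subst (_≤ _) (sym (class-edges κ)) (+-mono-≤ (+-mono-≤ ha hb) hd))

  -- Weight 6 forces all three edges at u to be used twice, by members with weight equal to their number of edges.
  class-bound : ∀ κ → class κ weight ≤ 5 + (class κ (𝟙 ∘ paired) + 𝟙 (is-just (pickGood κ)))
  class-bound κ with any? (λ X → (φ X ≟ κ) ×-dec paired? X)
  ... | yes (X , X∈ , tw) = ≤-trans (class-weight κ (class-load κ u w) (class-load κ u v) (class-load κ u x))
          (+-monoʳ-≤ 5 (≤-trans (subst (λ b → 𝟙 b ≤ class κ (𝟙 ∘ paired)) (isYes⁺ (paired? X) tw) (term≤class (𝟙 ∘ paired) X∈))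
                                (m≤m+n _ _)))
  ... | no ¬tw with anyGood? κ
  ...   | yes _ = ≤-trans (class-weight κ (class-load κ u w) (class-load κ u v) (class-load κ u x))
                          (+-monoʳ-≤ 5 (m≤n+m 1 (class κ (𝟙 ∘ paired))))
  ...   | no ¬good = ≤-trans five (m≤m+n 5 _)
    where
    -- A new member beside another one on {u,v} would give a good pair, as no member of this class
    -- has a twin.
    bothOld : ∀ {X Y} → X ≢ Y → InClass κ X → InClass κ Y → has X u v ≡ true → has Y u v ≡ true → ∃ λ m → c X ≡ just m
    bothOld {X} {Y} ne X∈ Y∈ hX hY with colored? c X
    ... | inj₁ cX = cX
    ... | inj₂ cX with colored? c Y
    ...   | inj₁ (m , cY) = ⊥-elim (¬good (X , Y , good X∈ Y∈ ne (Q⁺ cX hX) (inj₂ (P⁺ cY hY , λ tw → ¬tw (Y , Y∈ , tw)))))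
    ...   | inj₂ cY       = ⊥-elim (¬good (X , Y , good X∈ Y∈ ne (Q⁺ cX hX) (inj₁ (Q⁺ cY hY))))

    no-three : ∀ {a b X Y Z} → InClass κ X → InClass κ Y → InClass κ Z → X ≢ Y → Z ≢ X → Z ≢ Y →
               has X a b ≡ true → has Y a b ≡ true → has Z a b ≡ false
    no-three {a} {b} X∈ Y∈ Z∈ X≢Y Z≢X Z≢Y hX hY = ¬true⇒false λ hZ →
      [ X≢Y ∘ class-independent X∈ Y∈ , [ Z≢X ∘ sym ∘ class-independent X∈ Z∈ , Z≢Y ∘ sym ∘ class-independent Y∈ Z∈ ]′ ]′
        (three-collide {a} {b} hX hY hZ)

    -- Such a member lies in `P` and not in `B`, so it has weight 2 against three edges.
    all-three-slack : ∀ {Z m} → c Z ≡ just m → has Z u v ≡ true → has Z u x ≡ true → weight Z < edges Z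
    all-three-slack {Z} cZ hv hx rewrite anchor cZ (inj₁ hv) | cZ | hv | hx = ≤-refl

    -- If coloured, `Z` would contain {u,w}; if new, {u,v}. So its weight is 0 against one edge.
    x-only-slack : ∀ {Z} → has Z u w ≡ false → has Z u v ≡ false → has Z u x ≡ true → weight Z < edges Z
    x-only-slack {Z} hw hv hx with colored? c Z
    ... | inj₁ (_ , cZ) = ⊥-elim (true≢false (anchor cZ (inj₂ hx)) hw)
    ... | inj₂ cZ rewrite hw | cZ | hv | hx = ≤-refl

    slack⇒five : ∀ {Z} → InClass κ Z → weight Z < edges Z → class κ weight ≤ 5
    slack⇒five Z∈ lt = s≤s⁻¹ (≤-trans (class-mono-< weight≤edges Z∈ lt)
      (subst (_≤ 6) (sym (class-edges κ)) (+-mono-≤ (+-mono-≤ (class-load κ u w) (class-load κ u v)) (class-load κ u x))))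

    five : class κ weight ≤ 5
    five with any? (λ X → any? λ Y → ¬? (X ≟F Y) ×-dec (φ X ≟ κ) ×-dec (φ Y ≟ κ) ×-dec (has X u v Bool.≟ true) ×-dec (has Y u v Bool.≟ true))
            | any? (λ Z → (φ Z ≟ κ) ×-dec (has Z u x Bool.≟ true))
    ... | no none | _ = class-weight κ (class-load κ u w)
            (class≤1 κ (λ X → has X u v) λ {X} {Y} X∈ Y∈ hX hY → decidable-stable (X ≟F Y) λ ne → none (X , Y , ne , X∈ , Y∈ , hX , hY))
            (class-load κ u x)
    ... | yes _ | no none = class-weight κ (class-load κ u w) (class-load κ u v)
            (class≤1 κ (λ X → has X u x) λ X∈ _ hX _ → ⊥-elim (none (_ , X∈ , hX)))
    -- `X` and `Y` are coloured, so they fill {u,w} as well as {u,v}. A member on {u,x} is therefore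
    -- one of them, with all three edges, or has {u,x} as its only edge at `u`.
    ... | yes (X , Y , ne , X∈ , Y∈ , hX , hY) | yes (Z , Z∈ , hZ) with Z ≟F X | Z ≟F Y
    ...   | yes refl | _        = slack⇒five X∈ (all-three-slack (proj₂ (bothOld ne X∈ Y∈ hX hY)) hX hZ)
    ...   | no _     | yes refl = slack⇒five Y∈ (all-three-slack (proj₂ (bothOld (ne ∘ sym) Y∈ X∈ hY hX)) hY hZ)
    ...   | no Z≢X   | no Z≢Y   = slack⇒five Z∈ (x-only-slack
              (no-three X∈ Y∈ Z∈ ne Z≢X Z≢Y (anchor (proj₂ (bothOld ne X∈ Y∈ hX hY)) (inj₁ hX))
                                            (anchor (proj₂ (bothOld (ne ∘ sym) Y∈ X∈ hY hX)) (inj₁ hY)))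
              (no-three X∈ Y∈ Z∈ ne Z≢X Z≢Y hX hY) hZ)

  total-bound : (count V₁ + count B) + (count V₂ + count P) ≤ numColors φ * 5 + (count paired + length goodPairs)
  total-bound = begin
    (count V₁ + count B) + (count V₂ + count P)
      ≡⟨ cong₂ _+_ (cong₂ _+_ (count≡∑ V₁) (count≡∑ B)) (cong₂ _+_ (count≡∑ V₂) (count≡∑ P)) ⟩
    (∑ (𝟙 ∘ V₁) xs + ∑ (𝟙 ∘ B) xs) + (∑ (𝟙 ∘ V₂) xs + ∑ (𝟙 ∘ P) xs)
      ≡⟨ cong₂ _+_ (∑-+ (𝟙 ∘ V₁) (𝟙 ∘ B) xs) (∑-+ (𝟙 ∘ V₂) (𝟙 ∘ P) xs) ⟨
    ∑ (λ X → 𝟙 (V₁ X) + 𝟙 (B X)) xs + ∑ (λ X → 𝟙 (V₂ X) + 𝟙 (P X)) xs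
      ≡⟨ ∑-+ (λ X → 𝟙 (V₁ X) + 𝟙 (B X)) (λ X → 𝟙 (V₂ X) + 𝟙 (P X)) xs ⟨
    ∑ weight xs
      ≤⟨ ∑≤∑∑classes φ weight ⟩
    ∑ (λ κ → class κ weight) (palette φ)
      ≤⟨ ∑-mono (palette φ) class-bound ⟩
    ∑ (λ κ → 5 + (class κ (𝟙 ∘ paired) + 𝟙 (is-just (pickGood κ)))) (palette φ)
      ≡⟨ ∑-+ (λ _ → 5) (λ κ → class κ (𝟙 ∘ paired) + 𝟙 (is-just (pickGood κ))) (palette φ) ⟩
    ∑ (λ _ → 5) (palette φ) + ∑ (λ κ → class κ (𝟙 ∘ paired) + 𝟙 (is-just (pickGood κ))) (palette φ)
      ≡⟨ cong₂ _+_ (∑-const 5 (palette φ)) (∑-+ (λ κ → class κ (𝟙 ∘ paired)) (𝟙 ∘ is-just ∘ pickGood) (palette φ)) ⟩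
    numColors φ * 5 + (∑ (λ κ → class κ (𝟙 ∘ paired)) (palette φ) + ∑ (𝟙 ∘ is-just ∘ pickGood) (palette φ))
      ≤⟨ +-monoʳ-≤ (numColors φ * 5) (+-monoˡ-≤ (∑ (𝟙 ∘ is-just ∘ pickGood) (palette φ)) (∑∑classes≤∑ φ (𝟙 ∘ paired))) ⟩
    numColors φ * 5 + (∑ (𝟙 ∘ paired) xs + ∑ (𝟙 ∘ is-just ∘ pickGood) (palette φ))
      ≡⟨ cong (numColors φ * 5 +_) (cong₂ _+_ (count≡∑ paired) (length-mapMaybe pickGood (palette φ))) ⟨
    numColors φ * 5 + (count paired + length goodPairs) ∎
    where
    open ≤-Reasoning
    xs = allFin k

  loaded⇒≤ : ∀ {m} (col : PCol k) →
    (∀ j → 1 ≤ j → j ≤ m → ∃ λ X → has X u v ≡ true × col X ≡ just j) → m ≤ numColors φ * 2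
  loaded⇒≤ {m} col cov = ≤-trans (covers⇒≤ m (elements (λ X → has X u v)) col
    λ j 1≤j j≤m → let X , h , cX = cov j 1≤j j≤m in X , ∈-elements⁺ (λ X → has X u v) h , cX)
    (load≤ u v)

  extendCover : ∀ {U : Fin k → Set} {col : PCol k} {X m} → U X → col X ≡ just m →
    (∀ j → 1 ≤ j → j < m → ∃ λ Y → U Y × col Y ≡ just j) →
    ∀ j → 1 ≤ j → j ≤ m → ∃ λ Y → U Y × col Y ≡ just j
  extendCover UX cX cov j 1≤j j≤m with m≤n⇒m<n∨m≡n j≤m
  ... | inj₁ j<m  = cov j 1≤j j<m
  ... | inj₂ refl = _ , UX , cX

  twins-extended : ∀ {col X Y} → Extends c col → Twins X Y → col X ≡ col Y
  twins-extended ext t = let (m , cX) , _ = W⁻ (left t)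
    in trans (ext cX) (sym (ext (trans (sym (same t)) cX)))

  process₁-bound : ∀ {c'} (r : ProcessResult P Q Q c c') → ∀ {X m} → c X ≡ nothing → c' X ≡ just m →
    (∃ λ Y → c Y ≡ just m)
    ⊎ (m + (length (ProcessResult.M r) + (length BP.pairs + length BB.pairs)) ≤ count V₁ + count B)
    ⊎ (m ≤ numColors φ * 2)
  process₁-bound {c'} r {X} {m} cX c'X with ProcessResult.origin r cX c'X
  ... | inj₁ old = inj₁ old
  -- Here `Vq` is all of `Q`, so nothing is left for the final first-fit and the witness `Z` is
  -- contradictory.
  ... | inj₂ (inj₂ f) = inj₂ (inj₂ (loaded⇒≤ c' (extendCover (proj₂ (Q⁻ {X} (ProcessResult.new∈ r cX c'X))) c'X
          λ j 1≤j j<m → let Z , Y , (qZ , ¬qZ) , _ = f j 1≤j j<m in ⊥-elim (true≢false qZ ¬qZ))))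
  ... | inj₂ (inj₁ (qX , c₂X , f)) = inj₂ (inj₁ (colors+pairs≤ V₁ B M BP.pairs BB.pairs c₂ m
          (λ {X} v b → [ (λ p → ¬P∧B p b) , (λ q → ¬B∧Q b q) ]′ (∨-true {P X} v))
          (proj₂ (proj₁ isMax)) BP.pairs-unique BB.pairs-unique
          (λ e∈ → let vX , vY , _ = All.lookup (proj₁ (proj₁ isMax)) e∈ in (vX , vY) , mates e∈)
          (λ e∈ → let (bX , pY) , t = BP.∈-pairs⁻ e∈ in (bX , ∨-introˡ _ pY) , twins-extended ext₂ t)
          (λ e∈ → let (bX , bY , _) , t = BB.∈-pairs⁻ e∈ in (bX , bY) , twins-extended ext₂ t)
          BP∩BB
          (extendCover {U = λ X → (V₁ ∪ B) X ≡ true} (∨-introˡ _ (∨-introʳ (P X) qX)) c₂X λ j 1≤j j<m →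
            let Z , Y , qZ , col , c₂Y = f j 1≤j j<m in Y , inside qZ col c₂Y , c₂Y)))
    where
    open ProcessResult r
    BP∩BB : ∀ {X} → X ∈ endpoints BP.pairs → X ∈ endpoints BB.pairs → ⊥
    BP∩BB X∈ X∈' with ∈-endpoints⁻ BP.pairs X∈ | ∈-endpoints⁻ BB.pairs X∈'
    ... | _ , e∈ , inj₂ refl | _ , e'∈ , inj₁ refl = ¬P∧B (proj₂ (proj₁ (BP.∈-pairs⁻ e∈))) (proj₁ (proj₁ (BB.∈-pairs⁻ e'∈)))
    ... | _ , e∈ , inj₂ refl | _ , e'∈ , inj₂ refl = ¬P∧B (proj₂ (proj₁ (BP.∈-pairs⁻ e∈))) (proj₁ (proj₂ (proj₁ (BB.∈-pairs⁻ e'∈))))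
    ... | _ , e∈ , inj₁ refl | _ , e'∈ , inj₁ refl with BP.∈-pairs⁻ e∈ | BB.∈-pairs⁻ e'∈
    ...   | (_ , pY) , t | (_ , bY , _) , t' with twin-unique t t'
    ...     | refl = ¬P∧B pY bY
    BP∩BB X∈ X∈' | _ , e∈ , inj₁ refl | _ , e'∈ , inj₂ refl with BP.∈-pairs⁻ e∈ | BB.∈-pairs⁻ e'∈
    ...   | (_ , pY) , t | (bY , _) , t' with twin-unique t (twins-sym t')
    ...     | refl = ¬P∧B pY bY
    inside : ∀ {Z Y j} → Q Z ≡ true → Collide ℛ Z Y → c₂ Y ≡ just j → (V₁ ∪ B) Y ≡ true
    inside {Z} {Y} qZ col c₂Y with colored? c Y
    ... | inj₂ cY = ∨-introˡ _ (∨-introʳ (P Y) (new∈₂ cY c₂Y))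
    ... | inj₁ (_ , cY) = [ (λ p → ∨-introˡ _ (∨-introˡ _ p)) , ∨-introʳ (V₁ Y) ]′ (∨-true {P Y} (collider∈W qZ cY col))

  process₂-bound : ∀ {c'} (r : ProcessResult B C Q c c') → ∀ {X m} → c X ≡ nothing → c' X ≡ just m →
    (∃ λ Y → c Y ≡ just m)
    ⊎ (m + (length (ProcessResult.M r) + (length BP.pairs + length PP.pairs)) ≤ count V₂ + count P)
    ⊎ (m ≤ numColors φ * 2)
  process₂-bound {c'} r {X} {m} cX c'X with ProcessResult.origin r cX c'X
  ... | inj₁ old = inj₁ old
  -- A member of `Q` outside `C` misses {u,x}, so by `local` it collides only with coloured members
  -- on {u,v}. The final first-fit thus stays within the load of that edge.
  ... | inj₂ (inj₂ f) = inj₂ (inj₂ (loaded⇒≤ c' (extendCover (proj₂ (Q⁻ {X} (ProcessResult.new∈ r cX c'X))) c'X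
          λ j 1≤j j<m → let Z , Y , (qZ , ¬cZ) , col , c'Y = f j 1≤j j<m in Y , outside qZ ¬cZ col c'Y , c'Y)))
    where
    outside : ∀ {Z Y j} → Q Z ≡ true → C Z ≡ false → Collide ℛ Z Y → c' Y ≡ just j → has Y u v ≡ true
    outside {Z} {Y} qZ ¬cZ col c'Y with colored? c Y
    ... | inj₂ cY = proj₂ (Q⁻ {Y} (ProcessResult.new∈ r cY c'Y))
    ... | inj₁ (_ , cY) with local (proj₁ (Q⁻ qZ)) (proj₂ (Q⁻ qZ)) cY col
    ...   | inj₁ h       = h
    ...   | inj₂ (h , _) = ⊥-elim (true≢false (cong₂ _∧_ qZ h) ¬cZ)
  -- Now `P` is the outer set, so mixed pairs are reversed to point from `P` into `V₂`.
  ... | inj₂ (inj₁ (cX∈ , c₂X , f)) = inj₂ (inj₁ (subst (λ l → m + (length M + (l + length PP.pairs)) ≤ count V₂ + count P) (length-map swap BP.pairs)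
          (colors+pairs≤ V₂ P M (map swap BP.pairs) PP.pairs c₂ m
          (λ {X} v p → [ ¬P∧B p , (λ c∈ → ¬P∧Q p (proj₁ (C⁻ c∈))) ]′ (∨-true {B X} v))
          (proj₂ (proj₁ isMax)) (swap-endpoints-unique BP.pairs-unique) PP.pairs-unique
          (λ e∈ → let vX , vY , _ = All.lookup (proj₁ (proj₁ isMax)) e∈ in (vX , vY) , mates e∈)
          (λ e∈ → let (bY , pX) , t = swapped e∈ in (pX , ∨-introˡ _ bY) , sym (twins-extended ext₂ t))
          (λ e∈ → let (pX , pY , _) , t = PP.∈-pairs⁻ e∈ in (pX , pY) , twins-extended ext₂ t)
          PB∩PP
          (extendCover {U = λ X → (V₂ ∪ P) X ≡ true} (∨-introˡ _ (∨-introʳ (B X) cX∈)) c₂X λ j 1≤j j<m →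
            let Z , Y , cZ , col , c₂Y = f j 1≤j j<m in Y , inside cZ col c₂Y , c₂Y))))
    where
    open ProcessResult r
    swapped : ∀ {X Y} → (X , Y) ∈ map swap BP.pairs → RelBP Y X
    swapped e∈ with ∈-map⁻ swap e∈
    ... | _ , e'∈ , refl = BP.∈-pairs⁻ e'∈
    PB∩PP : ∀ {X} → X ∈ endpoints (map swap BP.pairs) → X ∈ endpoints PP.pairs → ⊥
    PB∩PP X∈ X∈' with ∈-endpoints⁻ (map swap BP.pairs) X∈ | ∈-endpoints⁻ PP.pairs X∈'
    ... | _ , e∈ , inj₂ refl | _ , e'∈ , inj₁ refl = ¬P∧B (proj₁ (proj₁ (PP.∈-pairs⁻ e'∈))) (proj₁ (proj₁ (swapped e∈)))
    ... | _ , e∈ , inj₂ refl | _ , e'∈ , inj₂ refl = ¬P∧B (proj₁ (proj₂ (proj₁ (PP.∈-pairs⁻ e'∈)))) (proj₁ (proj₁ (swapped e∈)))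
    ... | _ , e∈ , inj₁ refl | _ , e'∈ , inj₁ refl with swapped e∈ | PP.∈-pairs⁻ e'∈
    ...   | (bY , _) , t | (_ , pY , _) , t' with twin-unique (twins-sym t) t'
    ...     | refl = ¬P∧B pY bY
    PB∩PP X∈ X∈' | _ , e∈ , inj₁ refl | _ , e'∈ , inj₂ refl with swapped e∈ | PP.∈-pairs⁻ e'∈
    ...   | (bY , _) , t | (pY , _) , t' with twin-unique (twins-sym t) (twins-sym t')
    ...     | refl = ¬P∧B pY bY
    inside : ∀ {Z Y j} → C Z ≡ true → Collide ℛ Z Y → c₂ Y ≡ just j → (V₂ ∪ P) Y ≡ true
    inside {Z} {Y} cZ col c₂Y with colored? c Y
    ... | inj₂ cY = ∨-introˡ _ (∨-introʳ (B Y) (new∈₂ cY c₂Y))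
    ... | inj₁ (_ , cY) = [ ∨-introʳ (V₂ Y) , (λ b → ∨-introˡ _ (∨-introˡ _ b)) ]′ (∨-true {P Y} (collider∈W (proj₁ (C⁻ cZ)) cY col))

  -- Twin pairs inside `P` are subtracted through `M₁` and in the second bound, those inside `B` in
  -- the first bound and through `M₂`, mixed ones explicitly in both. This cancels the two members
  -- per pair in `total-bound`; the good pairs in `M₁` cancel the remainder.
  two-bounds : ∀ {m₁ m₂ M₁ M₂} → IsMaxMatching c P Q M₁ → IsMaxMatching c B C M₂ →
    m₁ + (length M₁ + (length BP.pairs + length BB.pairs)) ≤ count V₁ + count B →
    m₂ + (length M₂ + (length BP.pairs + length PP.pairs)) ≤ count V₂ + count P →
    m₁ + m₂ ≤ numColors φ * 5
  two-bounds {m₁} {m₂} {M₁} {M₂} max₁ max₂ h₁ h₂ = +-cancelʳ-≤ saved _ _ (begin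
    (m₁ + m₂) + saved
      ≡⟨ solve 6 (λ m₁ m₂ pp bp bb g → (m₁ :+ m₂) :+ (((pp :+ pp) :+ ((bp :+ bp) :+ (bb :+ bb))) :+ g) :=
           (m₁ :+ ((pp :+ g) :+ (bp :+ bb))) :+ (m₂ :+ (bb :+ (bp :+ pp)))) refl m₁ m₂ pp bp bb g ⟩
    (m₁ + ((pp + g) + (bp + bb))) + (m₂ + (bb + (bp + pp)))
      ≤⟨ +-mono-≤ (+-monoʳ-≤ m₁ (+-monoˡ-≤ (bp + bb) (M₁-large max₁))) (+-monoʳ-≤ m₂ (+-monoˡ-≤ (bp + pp) (M₂-large max₂))) ⟩
    (m₁ + (length M₁ + (bp + bb))) + (m₂ + (length M₂ + (bp + pp)))
      ≤⟨ +-mono-≤ h₁ h₂ ⟩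
    (count V₁ + count B) + (count V₂ + count P)
      ≤⟨ total-bound ⟩
    numColors φ * 5 + (count paired + g)
      ≤⟨ +-monoʳ-≤ (numColors φ * 5) (+-monoˡ-≤ g pairedMembers≤) ⟩
    numColors φ * 5 + saved ∎)
    where
    open ≤-Reasoning
    open +-*-Solver
    pp = length PP.pairs
    bp = length BP.pairs
    bb = length BB.pairs
    g = length goodPairs
    saved = ((pp + pp) + ((bp + bp) + (bb + bb))) + g

-- Invariants along a run and the ratio

distinct≤ : ∀ {N} xs → (∀ {m} → m ∈ xs → 1 ≤ m × m ≤ N) → distinct xs ≤ N
distinct≤ {N} xs range = begin
  distinct xs                ≤⟨ Unique-⊆⇒length≤ (deduplicate-! xs) sub ⟩
  length (map suc (upTo N))  ≡⟨ length-map suc (upTo N) ⟩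
  length (upTo N)            ≡⟨ length-upTo N ⟩
  N                          ∎
  where
  open ≤-Reasoning
  sub : ∀ {m} → m ∈ deduplicate _≟_ xs → m ∈ map suc (upTo N)
  sub m∈ with range (∈-deduplicate⁻ _≟_ xs m∈)
  ... | s≤s z≤n , le = ∈-map⁺ suc (∈-upTo⁺ le)

numColorsP≤ : ∀ {k N} (c : PCol k) → (∀ {X m} → c X ≡ just m → 1 ≤ m × m ≤ N) → numColorsP c ≤ N
numColorsP≤ {k} c range = distinct≤ (mapMaybe c (allFin k)) λ m∈ → range (proj₂ (proj₂ (mapMaybe⁻ c (allFin k) m∈)))

module Analysis {n k : ℕ} (T : Graph n) (isTree : IsTree T) (maxDeg : MaxDeg≤3 T)
  (ℛ : Fin k → DiGraph n) (isSub : ∀ i → IsRootedSubtree T (ℛ i)) (φ : Fin k → ℕ) (validφ : Valid ℛ φ) where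
  open Greedy T ℛ
  open Decisions T ℛ
  open Coloring T ℛ
  open TreeFacts T isTree
  open Loads T ℛ φ validφ

  K limit : ℕ
  K = numColors φ
  limit = (K * 5) / 2

  2K≤limit : K * 2 ≤ limit
  2K≤limit = ≤-trans (≤-reflexive (sym (m*n/n≡m (K * 2) 2))) (/-monoˡ-≤ 2 (begin
    K * 2 * 2   ≡⟨ *-assoc K 2 2 ⟩
    K * 4       ≤⟨ *-monoʳ-≤ K (n≤1+n 4) ⟩
    K * 5       ∎))
    where
    open ≤-Reasoning

  -- For members without arcs, which receive colour 1 at the end.
  1≤limit : Fin k → 1 ≤ limit
  1≤limit X = ≤-trans (s≤s z≤n) (≤-trans (*-monoˡ-≤ 2 1≤K) 2K≤limit)
    where
    1≤K : 1 ≤ K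
    1≤K with palette φ | ∈-palette φ X
    ... | _ ∷ _ | _ = s≤s z≤n

  -- Rounding down loses at most one half: 5K is at most twice `limit` plus 1, while two larger
  -- numbers sum to at least twice `limit` plus 2.
  two-over-limit : ∀ {m₁ m₂} → limit < m₁ → limit < m₂ → m₁ + m₂ ≤ K * 5 → ⊥
  two-over-limit {m₁} {m₂} h₁ h₂ le = <⇒≱ over (≤-trans (+-mono-≤ h₁ h₂) le)
    where
    open ≤-Reasoning
    over : K * 5 < suc limit + suc limit
    over = begin-strict
      K * 5                        ≡⟨ m≡m%n+[m/n]*n (K * 5) 2 ⟩
      (K * 5) % 2 + limit * 2      <⟨ +-monoˡ-< (limit * 2) (m%n<n (K * 5) 2) ⟩
      2 + limit * 2                ≡⟨ cong (2 +_) (trans (*-comm limit 2) (cong (limit +_) (+-identityʳ limit))) ⟩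
      2 + (limit + limit)          ≡⟨ cong suc (+-suc limit limit) ⟨
      suc limit + suc limit        ∎

  has-sym : ∀ {X a b} → has X a b ≡ true → has X b a ≡ true
  has-sym {X} {a} {b} h = trans (∨-comm (A (ℛ X) b a) (A (ℛ X) a b)) h

  Segment : PCol k → Set
  Segment c = ∀ {X m} → c X ≡ just m → ∀ j → 1 ≤ j → j ≤ m → ∃ λ Y → c Y ≡ just j

  Below : ℕ → PCol k → Set
  Below N c = ∀ {X m} → c X ≡ just m → m ≤ N

  segment⇒≤numColors : ∀ {c} → Segment c → Below (numColorsP c) c
  segment⇒≤numColors {c} seg {m = m} cX = covers⇒≤ m (deduplicate _≟_ (mapMaybe c (allFin k))) just λ j 1≤j j≤m →
    let Y , cY = seg cX j 1≤j j≤m in j , ∈-deduplicate⁺ _≟_ (mapMaybe⁺ c (∈-allFin Y) cY) , refl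

  overflow? : ∀ N c → (∃ λ X → ∃ λ m → c X ≡ just m × N < m) ⊎ Below N c
  overflow? N c with any? (λ X → N <? fromMaybe 0 (c X))
  ... | no none = inj₂ λ {X} {m} cX → ≮⇒≥ λ lt → none (X , subst (λ o → N < fromMaybe 0 o) (sym cX) lt)
  ... | yes (X , lt) with c X in cX
  ...   | just m = inj₁ (X , m , cX , lt)

  record Extension (u v : Fin n) (c c' : PCol k) : Set where
    field
      ext    : Extends c c'
      new∈   : ∀ {X m} → c X ≡ nothing → c' X ≡ just m → Qset c u v X ≡ true
      total  : ∀ {X} → Qset c u v X ≡ true → ∃ λ m → c' X ≡ just m
      proper : Proper c'
      pos    : Positive c'
      seg    : Segment c'

  Extension-resp : ∀ {u v c c' d} → (∀ X → d X ≡ c' X) → Extension u v c c' → Extension u v c d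
  Extension-resp {c = c} {c'} {d} d≗ e = record
    { ext    = λ cX → trans (d≗ _) (ext cX)
    ; new∈   = λ cX dX → new∈ cX (at dX)
    ; total  = λ {X} q → let m , c'X = total q in m , trans (d≗ X) c'X
    ; proper = λ ne col dX dY → proper ne col (at dX) (at dY)
    ; pos    = λ dX → pos (at dX)
    ; seg    = λ dX j 1≤j j≤m → let Y , c'Y = seg (at dX) j 1≤j j≤m in Y , trans (d≗ Y) c'Y
    }
    where
    open Extension e
    at : ∀ {X m} → d X ≡ just m → c' X ≡ just m
    at {X} dX = trans (sym (d≗ X)) dX

  -- Outside the new members an extension agrees with `c`, even in leaving members uncoloured. Hence
  -- `choose` returns one of the two extensions as a whole.
  outside-new : ∀ {u v c d} → Extension u v c d → ∀ X → (if Qset c u v X then d X else c X) ≡ d X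
  outside-new {u} {v} {c} {d} e X with Qset c u v X in q
  ... | true  = refl
  ... | false with colored? c X
  ...   | inj₁ (_ , cX) = trans cX (sym (Extension.ext e cX))
  ...   | inj₂ cX with colored? d X
  ...     | inj₁ (_ , dX) = ⊥-elim (true≢false (Extension.new∈ e cX dX) q)
  ...     | inj₂ dX       = trans cX (sym dX)

  choose-cases : ∀ {u v c c₁ c₂} → Extension u v c c₁ → Extension u v c c₂ →
    (numColorsP c₁ ≤ numColorsP c₂ × (∀ X → choose c u v c₁ c₂ X ≡ c₁ X))
    ⊎ (numColorsP c₂ ≤ numColorsP c₁ × (∀ X → choose c u v c₁ c₂ X ≡ c₂ X))
  choose-cases {c₁ = c₁} {c₂} e₁ e₂ with numColorsP c₁ ≤ᵇ numColorsP c₂ in eq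
  ... | true  = inj₁ (≤ᵇ⇒≤ _ _ (subst Bool.T (sym eq) _) , outside-new e₁)
  ... | false = inj₂ (<⇒≤ (≰⇒> λ le → subst Bool.T eq (≤⇒≤ᵇ le)) , outside-new e₂)

  extendSegment : ∀ {c c'} → Segment c → Extends c c' →
    (∀ {X m} → c X ≡ nothing → c' X ≡ just m →
       (∃ λ Y → c Y ≡ just m) ⊎ (∀ j → 1 ≤ j → j < m → ∃ λ Y → c' Y ≡ just j)) →
    Segment c'
  extendSegment {c} seg ext f {X} c'X j 1≤j j≤m with colored? c X
  ... | inj₁ (_ , cX) with just-injective (trans (sym (ext cX)) c'X)
  ...   | refl = let Y , cY = seg cX j 1≤j j≤m in Y , ext cY
  extendSegment {c} seg ext f {X} c'X j 1≤j j≤m | inj₂ cX with f cX c'X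
  ... | inj₁ (Y , cY) = let Z , cZ = seg cY j 1≤j j≤m in Z , ext cZ
  ... | inj₂ g with m≤n⇒m<n∨m≡n j≤m
  ...   | inj₁ j<m  = g j 1≤j j<m
  ...   | inj₂ refl = X , c'X

  process-extension : ∀ {Vp Vq u v c c'} → Segment c → ProcessResult Vp Vq (Qset c u v) c c' → Extension u v c c'
  process-extension seg r = record
    { ext = ext ∘ ext₂ ; new∈ = new∈ ; total = total ; proper = proper ; pos = pos
    ; seg = extendSegment seg (ext ∘ ext₂) λ cX c'X → case origin cX c'X of λ where
        (inj₁ old)                 → inj₁ old
        (inj₂ (inj₁ (_ , _ , f))) → inj₂ λ j 1≤j j<m → let _ , Y , _ , _ , c₂Y = f j 1≤j j<m in Y , ext c₂Y
        (inj₂ (inj₂ f))            → inj₂ λ j 1≤j j<m → let _ , Y , _ , _ , c'Y = f j 1≤j j<m in Y , c'Y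
    }
    where open ProcessResult r

  firstFit-extension : ∀ {u v c c'} → Segment c → LoopResult (Qset c u v) [] c c' → Extension u v c c'
  firstFit-extension seg r = record
    { ext = ext ; new∈ = new∈ ; total = total ; proper = proper ; pos = pos
    ; seg = extendSegment seg ext λ cX c'X → inj₂ λ j 1≤j j<m →
        let _ , Y , _ , _ , c'Y = below cX c'X j 1≤j j<m in Y , c'Y
    }
    where open LoopResult r

  -- `explored` and `colored` say that being coloured means containing an explored edge. The bypass
  -- arguments use both: old members reach the explored part, new ones miss it.
  record Invariant (pre : List (Fin n × Fin n)) (c : PCol k) : Set where
    field
      explored : ∀ {X m} → c X ≡ just m → ∃ λ a → ∃ λ b → EdgeIn pre a b × has X a b ≡ true
      colored  : ∀ {X a b} → EdgeIn pre a b → has X a b ≡ true → ∃ λ m → c X ≡ just m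
      proper   : Proper c
      pos      : Positive c
      seg      : Segment c
      bound    : Below limit c

  EdgeIn-++ : ∀ pre {es : List (Fin n × Fin n)} {a b} → EdgeIn pre a b → EdgeIn (pre ++ es) a b
  EdgeIn-++ pre = Sum.map ∈-++⁺ˡ ∈-++⁺ˡ

  Invariant-step : ∀ {pre u v c c'} → Invariant pre c → Extension u v c c' → Below limit c' →
                   Invariant (pre ++ [ (u , v) ]) c'
  Invariant-step {pre} {u} {v} {c} {c'} inv e bnd = record
    { explored = explored'
    ; colored  = λ ab h → colored' (split ab) h
    ; proper = proper ; pos = pos ; seg = seg ; bound = bnd }
    where
    open Extension e
    explored' : ∀ {X m} → c' X ≡ just m → ∃ λ a → ∃ λ b → EdgeIn (pre ++ [ (u , v) ]) a b × has X a b ≡ true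
    explored' {X} c'X with colored? c X
    ... | inj₁ (_ , cX) = let a , b , ab , h = Invariant.explored inv cX in a , b , EdgeIn-++ pre ab , h
    ... | inj₂ cX       = u , v , inj₁ (∈-++⁺ʳ pre (here refl)) , proj₂ (∧-true (new∈ cX c'X))
    split : ∀ {a b} → EdgeIn (pre ++ [ (u , v) ]) a b → EdgeIn pre a b ⊎ ((a ≡ u × b ≡ v) ⊎ (b ≡ u × a ≡ v))
    split (inj₁ e∈) with ∈-++⁻ pre e∈
    ... | inj₁ e∈pre       = inj₁ (inj₁ e∈pre)
    ... | inj₂ (here refl) = inj₂ (inj₁ (refl , refl))
    split (inj₂ e∈) with ∈-++⁻ pre e∈
    ... | inj₁ e∈pre       = inj₁ (inj₂ e∈pre)
    ... | inj₂ (here refl) = inj₂ (inj₂ (refl , refl))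
    atuv : ∀ {X} → has X u v ≡ true → ∃ λ m → c' X ≡ just m
    atuv {X} h with colored? c X
    ... | inj₁ (m , cX) = m , ext cX
    ... | inj₂ cX       = total (cong₂ _∧_ (is-nothing⁺ cX) h)
    colored' : ∀ {X a b} → EdgeIn pre a b ⊎ ((a ≡ u × b ≡ v) ⊎ (b ≡ u × a ≡ v)) → has X a b ≡ true → ∃ λ m → c' X ≡ just m
    colored' (inj₁ ab) h                   = let m , cX = Invariant.colored inv ab h in m , ext cX
    colored' (inj₂ (inj₁ (refl , refl))) h = atuv h
    colored' {X} (inj₂ (inj₂ (refl , refl))) h = atuv {X} (has-sym {X} h)

  -- `cover` is what places an unexplored edge at `u` among the edges to come, as type 4 demands.
  record Frontier (r : Fin n) (pre es : List (Fin n × Fin n)) (vs : List (Fin n)) : Set where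
    field
      search   : Search vs es
      pre-T    : ∀ {a b} → EdgeIn pre a b → T a b ≡ true
      pre-vs   : ∀ {a b} → EdgeIn pre a b → a ∈ vs
      pre-conn : ∀ {d} → d ∈ vs → Star (EdgeIn pre) d r
      cover    : ∀ {a b} → T a b ≡ true → EdgeIn pre a b ⊎ EdgeIn es a b

  Frontier-step : ∀ {r pre u v post vs} → Frontier r pre ((u , v) ∷ post) vs → Frontier r (pre ++ [ (u , v) ]) post (v ∷ vs)
  Frontier-step {r} {pre} {u} {v} {post} {vs} fr with Frontier.search fr
  ... | new u∈ v∉ uv s = record
    { search   = s
    ; pre-T    = λ ab → on-split ab pre-T uv (T-sym uv)
    ; pre-vs   = λ {a} {b} ab → on-split {λ a _ → a ∈ v ∷ vs} ab (there ∘ pre-vs) (there u∈) (here refl)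
    ; pre-conn = conn
    ; cover    = λ ab → case cover ab of λ where
        (inj₁ p)                  → inj₁ (EdgeIn-++ pre p)
        (inj₂ (inj₁ (here refl))) → inj₁ uv∈
        (inj₂ (inj₂ (here refl))) → inj₁ (Sum.swap uv∈)
        (inj₂ (inj₁ (there e∈)))  → inj₂ (inj₁ e∈)
        (inj₂ (inj₂ (there e∈)))  → inj₂ (inj₂ e∈)
    }
    where
    open Frontier fr using (pre-T; pre-vs; pre-conn; cover)
    uv∈ : EdgeIn (pre ++ [ (u , v) ]) u v
    uv∈ = inj₁ (∈-++⁺ʳ pre (here refl))
    on-split : ∀ {P : Fin n → Fin n → Set} {a b} → EdgeIn (pre ++ [ (u , v) ]) a b →
               (∀ {a b} → EdgeIn pre a b → P a b) → P u v → P v u → P a b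
    on-split (inj₁ e∈) f p q with ∈-++⁻ pre e∈
    ... | inj₁ e∈pre       = f (inj₁ e∈pre)
    ... | inj₂ (here refl) = p
    on-split (inj₂ e∈) f p q with ∈-++⁻ pre e∈
    ... | inj₁ e∈pre       = f (inj₂ e∈pre)
    ... | inj₂ (here refl) = q
    widen : ∀ {d} → d ∈ vs → Star (EdgeIn (pre ++ [ (u , v) ])) d r
    widen d∈ = Star.map (EdgeIn-++ pre) (pre-conn d∈)
    conn : ∀ {d} → d ∈ v ∷ vs → Star (EdgeIn (pre ++ [ (u , v) ])) d r
    conn (here refl) = Sum.swap uv∈ ◅ widen u∈
    conn (there d∈)  = widen d∈

  neighbours≤deg : ∀ {u xs} → Unique xs → (∀ {y} → y ∈ xs → T u y ≡ true) → length xs ≤ deg T u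
  neighbours≤deg {u} uxs adj = Unique-⊆⇒length≤ uxs λ {y} y∈ → ∈-filterᵇ⁺ (T u) (∈-allFin y) (adj y∈)

  module Step {r pre u v post vs c} (fr : Frontier r pre ((u , v) ∷ post) vs) (inv : Invariant pre c)
    (u∈ : u ∈ vs) (v∉ : v ∉ vs) (uv : T u v ≡ true) (rest : Search (v ∷ vs) post) where
    open Frontier fr
    open Invariant inv
    open Explored pre u pre-T
      (λ ab → pre-conn (pre-vs ab) ◅◅ Star.reverse Sum.swap (pre-conn u∈))

    uncolored⇒∉pre : ∀ {X a b} → c X ≡ nothing → EdgeIn pre a b → has X a b ≡ false
    uncolored⇒∉pre {X} cX ab = ¬true⇒false λ h → just≢nothing (proj₂ (colored ab h)) cX

    has-V : ∀ {X a b} → has X a b ≡ true → V (ℛ X) a ≡ true × V (ℛ X) b ≡ true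
    has-V {X} = Subtree.und-V (ℛ X) (isSub X)

    has-T : ∀ {X a b} → has X a b ≡ true → T a b ≡ true
    has-T {X} = Subtree.und-T (ℛ X) (isSub X)

    exploredAt : ∀ {S m y} → c S ≡ just m → has S y u ≡ true → ∃ λ z → EdgeIn pre z u × has S z u ≡ true
    exploredAt {S} cS h = let _ , _ , ab , Sab = explored cS
                          in exploredEdgeAt (ℛ S) (isSub S) ab Sab (proj₂ (has-V {S} h))

    sharedAt : ∀ {R S m} → c R ≡ nothing → has R u v ≡ true → c S ≡ just m → Collide ℛ R S →
               ∃ λ y → has R y u ≡ true × has S y u ≡ true
    sharedAt {R} {S} cR hR cS (e₁ , e₂ , Re , Se) =
      let _ , _ , ab , Sab = explored cS
      in sharedEdgeAt (ℛ S) (isSub S) (ℛ R) (isSub R) (uncolored⇒∉pre {R} cR) (proj₁ (has-V {R} hR)) ab Sab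
           (∨-introˡ _ Re) (∨-introˡ _ Se)

    old≢v : ∀ {z} → EdgeIn pre z u → z ≢ v
    old≢v zu refl = v∉ (pre-vs zu)

    new≢old : ∀ {X y z} → c X ≡ nothing → has X y u ≡ true → EdgeIn pre z u → y ≢ z
    new≢old {X} cX h zu refl = true≢false h (uncolored⇒∉pre {X} cX zu)

    -- Otherwise the shared edge leads to some `y` other than `v`, and `S` has an explored edge from
    -- `u` to some `z`. Then `v`, `y`, `z` are all the neighbours of `u`, and {u,y} is still to come
    -- because the uncoloured `R` contains it. This is type 4.
    ¬type4⇒shares-uv : ¬ (∃ λ x → Type4 pre u post x) → ∀ {R S m} →
      c R ≡ nothing → has R u v ≡ true → c S ≡ just m → Collide ℛ R S → has S u v ≡ true
    ¬type4⇒shares-uv ¬t4 {R} {S} cR hR cS col with sharedAt cR hR cS col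
    ... | y , Ry , Sy with y ≟F v
    ...   | yes refl = has-sym {S} Sy
    ...   | no y≢v with exploredAt {S} cS Sy
    ...     | z , zu , _ = ⊥-elim (¬t4 (y , deg≡3 , incident zu , later))
      where
      uy : T u y ≡ true
      uy = has-T {R} (has-sym {R} Ry)
      deg≡3 : deg T u ≡ 3
      deg≡3 = ≤-antisym (maxDeg u) (neighbours≤deg {u} {v ∷ y ∷ z ∷ []}
        (((y≢v ∘ sym) ∷ (old≢v zu ∘ sym) ∷ []) ∷ (new≢old {R} cR Ry zu ∷ []) ∷ [] ∷ [])
        λ { (here refl) → uv ; (there (here refl)) → uy ; (there (there (here refl))) → T-sym (pre-T zu) })
      incident : ∀ {z} → EdgeIn pre z u → Any (Incident u) pre
      incident (inj₁ e∈) = Any.map (λ { refl → inj₂ refl }) e∈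
      incident (inj₂ e∈) = Any.map (λ { refl → inj₁ refl }) e∈
      later : ((u , y) ∈ post) ⊎ ((y , u) ∈ post)
      later with cover uy
      ... | inj₁ old                = ⊥-elim (true≢false Ry (uncolored⇒∉pre {R} cR (Sum.swap old)))
      ... | inj₂ (inj₁ (here refl)) = ⊥-elim (y≢v refl)
      ... | inj₂ (inj₂ (here refl)) = ⊥-elim (v∉ u∈)
      ... | inj₂ (inj₁ (there e∈))  = inj₁ e∈
      ... | inj₂ (inj₂ (there e∈))  = inj₂ e∈

    firstFit-step : ¬ (∃ λ x → Type4 pre u post x) → ∀ {c'} → Loop (Qset c u v) [] c c' →
                    Extension u v c c' × Below limit c'
    firstFit-step ¬t4 {c'} l = firstFit-extension seg L , bnd
      where
      L = firstFitResult l proper pos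
      module L = LoopResult L
      onuv : ∀ {X m} → c X ≡ nothing → c' X ≡ just m → has X u v ≡ true
      onuv cX c'X = proj₂ (∧-true (L.new∈ cX c'X))
      bnd : Below limit c'
      bnd {X} {m} c'X with colored? c X
      ... | inj₁ (_ , cX) with just-injective (trans (sym (L.ext cX)) c'X)
      ...   | refl = bound cX
      bnd {X} {m} c'X | inj₂ cX = ≤-trans (covers⇒≤ m (elements (λ X → has X u v)) c' cov) (≤-trans (load≤ u v) 2K≤limit)
        where
        cov : ∀ j → 1 ≤ j → j ≤ m → ∃ λ Y → Y ∈ elements (λ X → has X u v) × c' Y ≡ just j
        cov j 1≤j j≤m with m≤n⇒m<n∨m≡n j≤m
        ... | inj₂ refl = X , ∈-elements⁺ (λ X → has X u v) (onuv cX c'X) , c'X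
        ... | inj₁ j<m with L.below cX c'X j 1≤j j<m
        ...   | Z , Y , (qZ , cZ) , col , c'Y = Y , ∈-elements⁺ (λ X → has X u v) onY , c'Y
          where
          onY : has Y u v ≡ true
          onY with colored? c Y
          ... | inj₂ cY       = onuv cY c'Y
          ... | inj₁ (_ , cY) = ¬type4⇒shares-uv ¬t4 cZ (proj₂ (∧-true qZ)) cY col

    module _ {x} (t4 : Type4 pre u post x) where

      x∉ : x ∉ v ∷ vs
      x∉ with proj₂ (proj₂ t4)
      ... | inj₁ e∈ = Search-fresh rest e∈
      -- In this orientation `u` would be discovered a second time.
      ... | inj₂ e∈ = ⊥-elim (Search-fresh rest e∈ (there u∈))

      ux : T u x ≡ true
      ux with proj₂ (proj₂ t4)
      ... | inj₁ e∈ = Search-T rest e∈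
      ... | inj₂ e∈ = T-sym (Search-T rest e∈)

      oldNeighbour : ∀ {es} → (∀ {e} → e ∈ es → e ∈ pre) → Any (Incident u) es → ∃ λ w → EdgeIn pre w u
      oldNeighbour es⊆ (here (inj₁ refl)) = _ , inj₂ (es⊆ (here refl))
      oldNeighbour es⊆ (here (inj₂ refl)) = _ , inj₁ (es⊆ (here refl))
      oldNeighbour es⊆ (there i)          = oldNeighbour (es⊆ ∘ there) i

      w : Fin n
      w = proj₁ (oldNeighbour id (proj₁ (proj₂ t4)))

      wu : EdgeIn pre w u
      wu = proj₂ (oldNeighbour id (proj₁ (proj₂ t4)))

      old≢x : ∀ {z} → EdgeIn pre z u → z ≢ x
      old≢x zu refl = x∉ (there (pre-vs zu))

      no-fourth : ∀ {z} → T u z ≡ true → z ≢ v → z ≢ x → z ≡ w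
      no-fourth {z} uz z≢v z≢x = decidable-stable (z ≟F w) λ z≢w → <⇒≱ (n<1+n 3) (subst (4 ≤_) (proj₁ t4)
        (neighbours≤deg {u} {z ∷ v ∷ x ∷ w ∷ []}
          ((z≢v ∷ z≢x ∷ z≢w ∷ []) ∷ ((λ e → x∉ (here (sym e))) ∷ (old≢v wu ∘ sym) ∷ []) ∷ ((old≢x wu ∘ sym) ∷ []) ∷ [] ∷ [])
          λ { (here refl) → uz ; (there (here refl)) → uv ; (there (there (here refl))) → ux
            ; (there (there (there (here refl)))) → T-sym (pre-T wu) }))

      -- A coloured member at `u` has an explored edge there. As `v` and `x` are undiscovered and
      -- `u` has degree 3, that edge leads to `w`.
      anchor : ∀ {X m} → c X ≡ just m → (has X u v ≡ true) ⊎ (has X u x ≡ true) → has X u w ≡ true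
      anchor {X} cX h with [ (λ h → exploredAt {X} cX (has-sym {X} h)) , (λ h → exploredAt {X} cX (has-sym {X} h)) ]′ h
      ... | z , zu , Xz with no-fourth (T-sym (pre-T zu)) (old≢v zu) (old≢x zu)
      ...   | refl = has-sym {X} Xz

      local : ∀ {R S m} → c R ≡ nothing → has R u v ≡ true → c S ≡ just m → Collide ℛ R S →
        (has S u v ≡ true) ⊎ (has R u x ≡ true × has S u x ≡ true)
      local {R} {S} cR hR cS col with sharedAt cR hR cS col
      ... | y , Ry , Sy with y ≟F v | y ≟F x
      ...   | yes refl | _        = inj₁ (has-sym {S} Sy)
      ...   | no _     | yes refl = inj₂ (has-sym {R} Ry , has-sym {S} Sy)
      ...   | no y≢v   | no y≢x   = ⊥-elim (new≢old {R} cR Ry wu (no-fourth (has-T {R} (has-sym {R} Ry)) y≢v y≢x))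

      open Type4Count T ℛ φ validφ c u v w x proper anchor local

      overflow⇒new : ∀ {c' X m} → Extends c c' → c' X ≡ just m → limit < m → c X ≡ nothing
      overflow⇒new {X = X} ext c'X lt with colored? c X
      ... | inj₂ cX = cX
      ... | inj₁ (_ , cX) with just-injective (trans (sym (ext cX)) c'X)
      ...   | refl = ⊥-elim (<⇒≱ lt (bound cX))

      overflow⇒counted : ∀ {m} {N : Set} → limit < m → (∃ λ Y → c Y ≡ just m) ⊎ N ⊎ (m ≤ K * 2) → N
      overflow⇒counted lt (inj₁ (_ , cY))  = ⊥-elim (<⇒≱ lt (bound cY))
      overflow⇒counted lt (inj₂ (inj₁ h))  = h
      overflow⇒counted lt (inj₂ (inj₂ le)) = ⊥-elim (<⇒≱ lt (≤-trans le 2K≤limit))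

      choose-step : ∀ {c₁ c₂} → Extension u v c c₁ → Extension u v c c₂ → Below limit c₁ ⊎ Below limit c₂ →
                    Extension u v c (choose c u v c₁ c₂) × Below limit (choose c u v c₁ c₂)
      choose-step {c₁} {c₂} e₁ e₂ fit with choose-cases e₁ e₂
      ... | inj₁ (le , ≗₁) = Extension-resp ≗₁ e₁ , λ {X} dX → fits fit (trans (sym (≗₁ X)) dX)
        where
        fits : Below limit c₁ ⊎ Below limit c₂ → Below limit c₁
        fits (inj₁ b₁) = b₁
        fits (inj₂ b₂) = λ cX → ≤-trans (segment⇒≤numColors (Extension.seg e₁) cX)
                (≤-trans le (numColorsP≤ c₂ λ cY → Extension.pos e₂ cY , b₂ cY))
      ... | inj₂ (le , ≗₂) = Extension-resp ≗₂ e₂ , λ {X} dX → fits fit (trans (sym (≗₂ X)) dX)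
        where
        fits : Below limit c₁ ⊎ Below limit c₂ → Below limit c₂
        fits (inj₂ b₂) = b₂
        fits (inj₁ b₁) = λ cX → ≤-trans (segment⇒≤numColors (Extension.seg e₂) cX)
                (≤-trans le (numColorsP≤ c₁ λ cY → Extension.pos e₁ cY , b₁ cY))

      type4-step : ∀ {c₁ c₂} → ProcessEdge1 u v c c₁ → ProcessEdge2 u v x c c₂ →
                   Extension u v c (choose c u v c₁ c₂) × Below limit (choose c u v c₁ c₂)
      type4-step {c₁} {c₂} p₁ p₂ = choose-step e₁ e₂ oneFits
        where
        r₁ = processResult {P} {Q} {Q} {a = u} {v} P⁻ Q⁻ id proper pos p₁
        r₂ = processResult {B} {C} {Q} {a = u} {x}
               (λ b → proj₁ (B⁻ b) , proj₁ (proj₂ (B⁻ b)))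
               (λ cz → proj₁ (Q⁻ (proj₁ (C⁻ cz))) , proj₂ (C⁻ cz)) (proj₁ ∘ C⁻) proper pos p₂
        e₁ = process-extension seg r₁
        e₂ = process-extension seg r₂
        oneFits : Below limit c₁ ⊎ Below limit c₂
        oneFits with overflow? limit c₁ | overflow? limit c₂
        ... | inj₂ b₁ | _       = inj₁ b₁
        ... | _       | inj₂ b₂ = inj₂ b₂
        -- A colour above `limit` does not occur in `c` and exceeds 2K, so only the counted
        -- alternative of each process bound remains.
        ... | inj₁ (X₁ , m₁ , h₁ , lt₁) | inj₁ (X₂ , m₂ , h₂ , lt₂) = ⊥-elim (two-over-limit lt₁ lt₂
          (two-bounds {m₁} {m₂} (ProcessResult.isMax r₁) (ProcessResult.isMax r₂)
            (overflow⇒counted lt₁ (process₁-bound r₁ (overflow⇒new (Extension.ext e₁) h₁ lt₁) h₁))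
            (overflow⇒counted lt₂ (process₂-bound r₂ (overflow⇒new (Extension.ext e₂) h₂ lt₂) h₂))))

  run-invariant : ∀ {r pre es vs c c'} → Frontier r pre es vs → Invariant pre c → Run pre es c c' →
    Invariant (pre ++ es) c'
  run-invariant {pre = pre} {c = c} fr inv end = subst (λ p → Invariant p c) (sym (++-identityʳ pre)) inv
  run-invariant {pre = pre} fr inv (next {u} {v} {post} {c} {c'} {c''} s run) with Frontier.search fr
  ... | new u∈ v∉ uv rest = subst (λ p → Invariant p c'') (++-assoc pre [ (u , v) ] post)
          (run-invariant (Frontier-step fr) (Invariant-step inv (proj₁ (stepResult s)) (proj₂ (stepResult s))) run)
    where
    module S = Step fr inv u∈ v∉ uv rest
    stepResult : ∀ {c'} → StepE pre u v post c c' → Extension u v c c' × Below limit c'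
    stepResult (notType4 ¬t4 l) = S.firstFit-step ¬t4 l
    stepResult (type4 t4 p₁ p₂) = S.type4-step t4 p₁ p₂

  greedy-analysis : ∀ {ψ} → GreedyCol ψ → Valid ℛ ψ × (∀ X → ψ X ≤ limit)
  greedy-analysis {ψ} (r , es , bfs , c , run , c' , loop , c'≡ψ) =
    ((λ X → L.pos (c'≡ψ X)) , λ X Y ne col eq → L.proper ne col (c'≡ψ X) (trans (c'≡ψ Y) (cong just (sym eq))))
    , λ X → bnd (c'≡ψ X)
    where
    start : Frontier r [] es (r ∷ [])
    start = record
      { search   = BFS-search bfs
      ; pre-T    = λ { (inj₁ ()) ; (inj₂ ()) }
      ; pre-vs   = λ { (inj₁ ()) ; (inj₂ ()) }
      ; pre-conn = λ { (here refl) → ε }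
      ; cover    = λ ab → inj₂ (BFS-covers bfs ab)
      }
    initial : Invariant [] (λ _ → nothing)
    initial = record
      { explored = λ ()
      ; colored  = λ { (inj₁ ()) ; (inj₂ ()) }
      ; proper = λ _ _ () ; pos = λ () ; seg = λ () ; bound = λ () }
    open Invariant (run-invariant start initial run)
    module L = LoopResult (firstFitResult loop proper pos)
    -- All tree edges are explored by now, so a member left uncoloured has no arc.
    uncolored-arcless : ∀ {Z Y} → c Z ≡ nothing → ¬ Collide ℛ Z Y
    uncolored-arcless {Z} cZ (a , b , ab , _) =
      just≢nothing (proj₂ (colored (BFS-covers bfs (Subtree.und-T (ℛ Z) (isSub Z) (∨-introˡ _ ab))) (∨-introˡ _ ab))) cZ
    bnd : ∀ {X m} → c' X ≡ just m → m ≤ limit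
    bnd {X} {m} c'X with colored? c X
    ... | inj₁ (_ , cX) with just-injective (trans (sym (L.ext cX)) c'X)
    ...   | refl = bound cX
    bnd {X} {m} c'X | inj₂ cX = ≤-trans (≮⇒≥ λ 1<m →
      let Z , Y , (_ , cZ) , col , _ = L.below cX c'X 1 ≤-refl 1<m in uncolored-arcless cZ col) (1≤limit X)

theorem1 : ∀ {n k : ℕ} (T : Graph n) → IsTree T → MaxDeg≤3 T →
    (ℛ : Fin k → DiGraph n) → (∀ i → IsRootedSubtree T (ℛ i)) →
    (Σ (Fin k → ℕ) λ ψ → Greedy.GreedyCol T ℛ ψ)
    × (∀ ψ → Greedy.GreedyCol T ℛ ψ →
    Valid ℛ ψ × (∀ φ → Valid ℛ φ → 2 * numColors ψ ≤ 5 * numColors φ))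
theorem1 {n} {k} T isTree maxDeg ℛ isSub =
  Existence.GreedyCol-exists T ℛ (proj₁ (proj₁ (proj₂ (proj₂ (proj₂ isTree))))) ,
  λ ψ gdy → proj₁ (analysis (suc ∘ toℕ) injective-valid gdy) , λ φ validφ → approximation ψ φ (analysis φ validφ gdy)
  where
  analysis = λ φ validφ {ψ} → Analysis.greedy-analysis T isTree maxDeg ℛ isSub φ validφ {ψ}
  -- The analysis is relative to some valid colouring; for the validity of `ψ` the injective one
  -- serves.
  injective-valid : Valid ℛ (suc ∘ toℕ)
  injective-valid = (λ _ → s≤s z≤n) , λ X Y ne _ eq → ne (toℕ-injective (suc-injective eq))
  approximation : ∀ ψ φ → Valid ℛ ψ × (∀ X → ψ X ≤ (numColors φ * 5) / 2) → 2 * numColors ψ ≤ 5 * numColors φ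
  approximation ψ φ ((pos , _) , bound) = begin
    2 * numColors ψ                ≤⟨ *-monoʳ-≤ 2 (distinct≤ (map ψ (allFin k)) inRange) ⟩
    2 * ((numColors φ * 5) / 2)    ≡⟨ *-comm 2 ((numColors φ * 5) / 2) ⟩
    (numColors φ * 5) / 2 * 2      ≤⟨ m/n*n≤m (numColors φ * 5) 2 ⟩
    numColors φ * 5                ≡⟨ *-comm (numColors φ) 5 ⟩
    5 * numColors φ                ∎
    where
    open ≤-Reasoning
    inRange : ∀ {m} → m ∈ map ψ (allFin k) → 1 ≤ m × m ≤ (numColors φ * 5) / 2
    inRange m∈ with ∈-map⁻ ψ m∈
    ... | X , _ , refl = pos X , bound X
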